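{- Every label-invariant property of distributions can be tested adaptively using at most $\mathrm{poly}(\log n,\epsilon^{ -1},\log(\delta^{ -1}))$ conditional samples. That is, there is a polynomial $p$ such that for every label-invariant property $\mathcal P$ of distributions over $[n]$ there is an adaptive distribution tester for $\mathcal P$ that makes at most $p(\log n,\epsilon^{ -1},\log(\delta^{ -1}))$ conditional samples for all $\epsilon,\delta\in(0,1)$ and all $n$.
   Context: $[n]=\{1,\ldots,n\}$. A property $\mathcal P$ of distributions is (for each $n$) a set of distributions over $[n]$; it is label-invariant if it is invariant under permutations of the domain, i.e. $\mu\in\mathcal P$ implies $\mu\circ\sigma\in\mathcal P$ for every permutation $\sigma$ of $[n]$. The variation distance is $d(\mu,\mu')=\frac12\sum_{i=1}^n|\mu(i)-\mu'(i)|$, and $\mu$ is $\epsilon$-far from $\mathcal P$ if $d(\mu,\mu')\ge\epsilon$ for every $\mu'\in\mathcal P$. A conditional sampling oracle for $\mu$ takes a nonempty set $A\subseteq[n]$ and returns $j\in A$ with probability $\mu(j)/\mu(A)$ if $\mu(A)>0$, and a uniformly random member of $A$ if $\mu(A)=0$, independently of all previous samples. An adaptive distribution tester for $\mathcal P$ is a randomized algorithm that receives $\epsilon,\delta,n$ and a conditional sampling oracle for an unknown $\mu$ over $[n]$, chooses each conditioning set based on previously received samples and its internal coin tosses, and finally accepts or rejects; it must accept with probability at least $1-\delta$ if $\mu\in\mathcal P$ and reject with probability at least $1-\delta$ if $\mu$ is $\epsilon$-far from $\mathcal P$. -}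

module Defs where

open import Algebra.Bundles using (CommutativeRing)
open import Algebra.Core using (Op₁; Op₂)
open import Algebra.Structures using (IsCommutativeRing)
import Algebra.Construct.NaturalChoice.Max as Max
import Algebra.Properties.CommutativeMonoid.Sum as Sum
import Algebra.Properties.Ring as RingProperties
import Algebra.Properties.Semiring.Exp as Exp
import Algebra.Properties.Semiring.Mult as Mult
open import Axiom.ExcludedMiddle using (ExcludedMiddle)
open import Data.Bool.Base using (if_then_else_)
open import Data.Fin.Base using (Fin)
open import Data.Fin.Permutation using (Permutation′; _⟨$⟩ʳ_)
open import Data.Fin.Subset using (Subset; Nonempty; ∣_∣)
open import Data.Fin.Subset.Properties using (_∈?_)
open import Data.List.Base as List using (List)
open import Data.Nat.Base as ℕ using (ℕ; zero; suc; NonZero)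
import Data.Nat.Properties as ℕ
open import Data.Product.Base using (∃; _×_; _,_; proj₁; proj₂)
open import Data.Sum.Base using (inj₁; inj₂; fromInj₁)
open import Data.Vec.Functional as Vector using (Vector)
open import Level using (0ℓ)
open import Relation.Binary.Bundles using (TotalOrder)
open import Relation.Binary.Core using (Rel)
open import Relation.Binary.Structures using (IsTotalOrder)
open import Relation.Nullary.Decidable using (does; yes; no; decidable-stable)
open import Relation.Nullary.Negation using (¬_; contradiction)
open import Relation.Unary using (Pred)

-- The real numbers are characterised (up to isomorphism) as the complete
-- ordered field. As _⁻¹ is total, 0# ⁻¹ is unspecified.
record CompleteOrderedField : Set₁ where
  infix  8 _⁻¹ -_
  infixl 7 _*_
  infixl 6 _+_
  infix  4 _≈_ _≤_ _<_
  field
    Carrier : Set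
    _≈_     : Rel Carrier 0ℓ
    _≤_     : Rel Carrier 0ℓ
    _+_     : Op₂ Carrier
    _*_     : Op₂ Carrier
    -_      : Op₁ Carrier
    0#      : Carrier
    1#      : Carrier
    _⁻¹     : Op₁ Carrier

    isCommutativeRing : IsCommutativeRing _≈_ _+_ _*_ -_ 0# 1#
    1≉0               : ¬ (1# ≈ 0#)
    *-inverseʳ        : ∀ {x} → ¬ (x ≈ 0#) → x * x ⁻¹ ≈ 1#

    isTotalOrder : IsTotalOrder _≈_ _≤_
    +-monoˡ-≤    : ∀ {x y} z → x ≤ y → x + z ≤ y + z
    *-nonNeg     : ∀ {x y} → 0# ≤ x → 0# ≤ y → 0# ≤ x * y

  _<_ : Rel Carrier 0ℓ
  x < y = x ≤ y × ¬ (x ≈ y)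

  UpperBound : Pred Carrier 0ℓ → Pred Carrier 0ℓ
  UpperBound S u = ∀ {x} → S x → x ≤ u

  IsSupremum : Pred Carrier 0ℓ → Pred Carrier 0ℓ
  IsSupremum S u = UpperBound S u × (∀ {v} → UpperBound S v → u ≤ v)

  field
    complete : (S : Pred Carrier 0ℓ) → ∃ S → ∃ (UpperBound S) → ∃ (IsSupremum S)

  commutativeRing : CommutativeRing 0ℓ 0ℓ
  commutativeRing = record { isCommutativeRing = isCommutativeRing }

  totalOrder : TotalOrder 0ℓ 0ℓ 0ℓ
  totalOrder = record { isTotalOrder = isTotalOrder }

-- Excluded middle is needed because the mathematics is classical: the oracle
-- distinguishes μ(A) > 0 from μ(A) = 0, and a tester for an arbitrary property
-- has to decide whether that property contains a suitable distribution.
module Testing (em : ExcludedMiddle 0ℓ) (ℝ : CompleteOrderedField) where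

  open CompleteOrderedField ℝ
    hiding (_≈_; _+_; _*_; -_; 0#; 1#; isCommutativeRing)
  open CommutativeRing commutativeRing
    hiding (Carrier) renaming (zero to *-zero)
  open Mult semiring
    using (×-homo-+; ×-homo-1; ×1-homo-*) renaming (_×_ to _·_)
  open Exp semiring using (_^_; ^-assocʳ)
  open Sum +-commutativeMonoid using (sum; sum-permute)
  open Max totalOrder using (_⊔_)

  fromℕ : ℕ → Carrier
  fromℕ n = n · 1#

  2# ½ : Carrier
  2# = fromℕ 2
  ½  = 2# ⁻¹

  abs : Carrier → Carrier
  abs x = x ⊔ (- x)

  -- 0# when there is no supremum.
  sup : Pred Carrier 0ℓ → Carrier
  sup S with em {∃ (IsSupremum S)}
  ... | yes (s , _) = s
  ... | no  _       = 0#

  -- The fractions a / b (a ≥ 0, b ≥ 1) with 2 ^ (a / b) ≤ x.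
  FractionBelowLog₂ : Carrier → Pred Carrier 0ℓ
  FractionBelowLog₂ x r = ∃ λ a → ∃ λ b →
    NonZero b × fromℕ b * r ≈ fromℕ a × 2# ^ a ≤ x ^ b

  -- Meaningful for x ≥ 1 only: see log₂-isSupremum below.
  log₂ : Carrier → Carrier
  log₂ x = sup (FractionBelowLog₂ x)

  module OrderedFieldProperties where
    module ≤ = IsTotalOrder isTotalOrder
    module ℝ-Ring = RingProperties ring

    ≤-resp : ∀ {w x y z} → w ≈ x → y ≈ z → w ≤ y → x ≤ z
    ≤-resp w≈x y≈z w≤y =
      ≤.trans (≤.reflexive (sym w≈x)) (≤.trans w≤y (≤.reflexive y≈z))

    +-monoʳ-≤ : ∀ {x y} z → x ≤ y → z + x ≤ z + y
    +-monoʳ-≤ z x≤y = ≤-resp (+-comm _ _) (+-comm _ _) (+-monoˡ-≤ z x≤y)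

    +-mono-≤ : ∀ {w x y z} → w ≤ x → y ≤ z → w + y ≤ x + z
    +-mono-≤ w≤x y≤z = ≤.trans (+-monoˡ-≤ _ w≤x) (+-monoʳ-≤ _ y≤z)

    x+y-y≈x : ∀ x y → (x + y) - y ≈ x
    x+y-y≈x x y =
      trans (+-assoc _ _ _) (trans (+-congˡ (-‿inverseʳ y)) (+-identityʳ x))

    x-y+y≈x : ∀ x y → (x - y) + y ≈ x
    x-y+y≈x x y =
      trans (+-assoc _ _ _) (trans (+-congˡ (-‿inverseˡ y)) (+-identityʳ x))

    +-cancelʳ-≤ : ∀ {x y} z → x + z ≤ y + z → x ≤ y
    +-cancelʳ-≤ z = λ le → ≤-resp (x+y-y≈x _ z) (x+y-y≈x _ z) (+-monoˡ-≤ (- z) le)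

    x≤y⇒0≤y-x : ∀ {x y} → x ≤ y → 0# ≤ y - x
    x≤y⇒0≤y-x {x} x≤y = ≤-resp (-‿inverseʳ x) refl (+-monoˡ-≤ (- x) x≤y)

    *-monoˡ-≤ : ∀ {x y z} → 0# ≤ z → x ≤ y → x * z ≤ y * z
    *-monoˡ-≤ {x} {y} {z} 0≤z x≤y =
      ≤-resp (+-identityˡ _) y*z-x*z+x*z≈y*z
        (+-monoˡ-≤ (x * z) (*-nonNeg (x≤y⇒0≤y-x x≤y) 0≤z))
      where
      y*z-x*z+x*z≈y*z : (y - x) * z + x * z ≈ y * z
      y*z-x*z+x*z≈y*z = trans (sym (distribʳ z _ x)) (*-congʳ (x-y+y≈x y x))

    *-monoʳ-≤ : ∀ {x y z} → 0# ≤ z → x ≤ y → z * x ≤ z * y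
    *-monoʳ-≤ 0≤z x≤y = ≤-resp (*-comm _ _) (*-comm _ _) (*-monoˡ-≤ 0≤z x≤y)

    0≤1 : 0# ≤ 1#
    0≤1 with ≤.total 0# 1#
    ... | inj₁ le = le
    ... | inj₂ 1≤0 = ≤-resp refl -1*-1≈1 (*-nonNeg 0≤-1 0≤-1)
      where
      0≤-1 : 0# ≤ - 1#
      0≤-1 = ≤-resp refl (+-identityˡ _) (x≤y⇒0≤y-x 1≤0)
      -1*-1≈1 : - 1# * - 1# ≈ 1#
      -1*-1≈1 = trans (ℝ-Ring.-1*x≈-x (- 1#)) (ℝ-Ring.-‿involutive 1#)

    1≰0 : ¬ (1# ≤ 0#)
    1≰0 1≤0 = 1≉0 (≤.antisym 1≤0 0≤1)

    fromℕ-mono : ∀ {m n} → m ℕ.≤ n → fromℕ m ≤ fromℕ n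
    fromℕ-mono {n = zero}  ℕ.z≤n       = ≤.refl
    fromℕ-mono {n = suc n} ℕ.z≤n       =
      ≤-resp (+-identityˡ 0#) refl (+-mono-≤ 0≤1 (fromℕ-mono {n = n} ℕ.z≤n))
    fromℕ-mono             (ℕ.s≤s m≤n) = +-monoʳ-≤ 1# (fromℕ-mono m≤n)

    1≤fromℕ : ∀ n → .{{_ : NonZero n}} → 1# ≤ fromℕ n
    1≤fromℕ n = ≤-resp (×-homo-1 1#) refl (fromℕ-mono (ℕ.>-nonZero⁻¹ n))

    fromℕ≉0 : ∀ n → .{{_ : NonZero n}} → ¬ (fromℕ n ≈ 0#)
    fromℕ≉0 n n≈0 = 1≰0 (≤-resp refl n≈0 (1≤fromℕ n))

    *-cancelˡ-≤ : ∀ {x y z} → 0# ≤ z → ¬ (z ≈ 0#) → z * x ≤ z * y → x ≤ y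
    *-cancelˡ-≤ {x} {y} {z} 0≤z z≉0 zx≤zy with ≤.total x y
    ... | inj₁ x≤y = x≤y
    ... | inj₂ y≤x = ≤.reflexive (trans (sym (cancel x)) (trans
            (*-congˡ (≤.antisym zx≤zy (*-monoʳ-≤ 0≤z y≤x))) (cancel y)))
      where
      cancel : ∀ w → z ⁻¹ * (z * w) ≈ w
      cancel w = trans (sym (*-assoc _ _ _)) (trans
        (*-congʳ (trans (*-comm _ _) (*-inverseʳ z≉0))) (*-identityˡ w))

    ^-monoˡ-≤ : ∀ {x y} n → 0# ≤ x → x ≤ y → x ^ n ≤ y ^ n
    ^-nonNeg  : ∀ {x} n → 0# ≤ x → 0# ≤ x ^ n
    ^-nonNeg zero    0≤x = 0≤1
    ^-nonNeg (suc n) 0≤x = *-nonNeg 0≤x (^-nonNeg n 0≤x)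
    ^-monoˡ-≤ zero    0≤x x≤y = ≤.refl
    ^-monoˡ-≤ (suc n) 0≤x x≤y = ≤.trans
      (*-monoˡ-≤ (^-nonNeg n 0≤x) x≤y)
      (*-monoʳ-≤ (≤.trans 0≤x x≤y) (^-monoˡ-≤ n 0≤x x≤y))

    2*x≈x+x : ∀ x → 2# * x ≈ x + x
    2*x≈x+x x = trans (distribʳ x 1# _) (+-cong (*-identityˡ x)
      (trans (*-congʳ (+-identityʳ 1#)) (*-identityˡ x)))

    1≤2^ : ∀ n → 1# ≤ 2# ^ n
    1≤2^ zero    = ≤.refl
    1≤2^ (suc n) = ≤-resp (+-identityˡ 1#) (sym (2*x≈x+x _))
      (+-mono-≤ (≤.trans 0≤1 (1≤2^ n)) (1≤2^ n))

    2^-mono : ∀ {m n} → m ℕ.≤ n → 2# ^ m ≤ 2# ^ n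
    2^-mono {n = n} ℕ.z≤n = 1≤2^ n
    2^-mono (ℕ.s≤s m≤n)   = *-monoʳ-≤ (fromℕ-mono {0} {2} ℕ.z≤n) (2^-mono m≤n)

    2^-cancel : ∀ {m n} → 2# ^ m ≤ 2# ^ n → m ℕ.≤ n
    2^-cancel {m} {n} 2^m≤2^n with m ℕ.≤? n
    ... | yes m≤n = m≤n
    ... | no  m≰n = contradiction (≤.trans (1≤2^ n) 2^n≤0) 1≰0
      where
      2^n≤0 : 2# ^ n ≤ 0#
      2^n≤0 = +-cancelʳ-≤ (2# ^ n) (≤-resp (2*x≈x+x _) (sym (+-identityˡ _))
        (≤.trans (2^-mono (ℕ.≰⇒> m≰n)) 2^m≤2^n))

    fromℕ≤2^ : ∀ n → fromℕ n ≤ 2# ^ n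
    fromℕ≤2^ zero    = 0≤1
    fromℕ≤2^ (suc n) = ≤-resp refl (sym (2*x≈x+x _))
      (+-mono-≤ (1≤2^ n) (fromℕ≤2^ n))

    archimedean : ∀ x → ∃ λ n → x ≤ fromℕ n
    archimedean x = decidable-stable em λ none →
      let bounded : ∀ n → fromℕ n ≤ x
          bounded n = fromInj₁ (λ x≤n → contradiction (n , x≤n) none)
                               (≤.total (fromℕ n) x)
          S = λ r → ∃ λ n → r ≈ fromℕ n
          s , ub , lub = complete S (0# , 0 , refl)
            (x , λ (n , r≈n) → ≤-resp (sym r≈n) refl (bounded n))
          s≤s-1 : s ≤ s - 1#
          s≤s-1 = lub λ (n , r≈n) → ≤-resp
            (trans (x+y-y≈x _ 1#) (sym r≈n)) refl
            (+-monoˡ-≤ (- 1#) (≤-resp (+-comm 1# _) refl (ub (suc n , refl))))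
      in 1≰0 (+-cancelʳ-≤ (s - 1#) (≤-resp
           (trans (sym (x-y+y≈x s 1#)) (+-comm _ _)) (sym (+-identityˡ _)) s≤s-1))

  open OrderedFieldProperties

  log₂-isSupremum : ∀ {x} → 1# ≤ x → IsSupremum (FractionBelowLog₂ x) (log₂ x)
  log₂-isSupremum {x} 1≤x with em {∃ (IsSupremum (FractionBelowLog₂ x))}
  ... | yes (_ , isSup) = isSup
  ... | no  none        = contradiction (complete _ nonempty bounded) none
    where
    nonempty : ∃ (FractionBelowLog₂ x)
    nonempty =
      0# , 0 , 1 , _ , zeroʳ _ , ≤-resp refl (sym (*-identityʳ x)) 1≤x
    bounded : ∃ (UpperBound (FractionBelowLog₂ x))
    bounded with N , x≤N ← archimedean x =
      fromℕ N , λ (a , b , b≢0 , br≈a , 2^a≤x^b) →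
      let instance _ = b≢0
          2^a≤2^Nb = ≤.trans 2^a≤x^b (≤-resp refl (^-assocʳ 2# N b)
            (^-monoˡ-≤ b (≤.trans 0≤1 1≤x) (≤.trans x≤N (fromℕ≤2^ N))))
      in *-cancelˡ-≤ (fromℕ-mono {0} {b} ℕ.z≤n) (fromℕ≉0 b)
           (≤-resp (sym br≈a) (trans (×1-homo-* N b) (*-comm _ _))
             (fromℕ-mono (2^-cancel {a} {N ℕ.* b} 2^a≤2^Nb)))

  -- Real polynomials in three variables, as lists of monomials c xⁱ yʲ zᵏ.
  Polynomial₃ : Set
  Polynomial₃ = List (Carrier × ℕ × ℕ × ℕ)

  eval : Polynomial₃ → Carrier → Carrier → Carrier → Carrier
  eval p x y z =
    List.foldr (λ (c , i , j , k) s → c * (x ^ i * (y ^ j * z ^ k)) + s) 0# p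

  -- [n] is represented by Fin n.
  record Distribution (n : ℕ) : Set where
    field
      mass   : Vector Carrier n
      nonNeg : ∀ i → 0# ≤ mass i
      total  : sum mass ≈ 1#

  open Distribution public

  relabel : ∀ {n} → Permutation′ n → Distribution n → Distribution n
  relabel σ μ = record
    { mass   = λ i → mass μ (σ ⟨$⟩ʳ i)
    ; nonNeg = λ i → nonNeg μ (σ ⟨$⟩ʳ i)
    ; total  = trans (sym (sum-permute (mass μ) σ)) (total μ)
    }

  record Property : Set₁ where
    field
      Contains : ∀ n → Pred (Distribution n) 0ℓ
      resp     : ∀ {n} {μ ν : Distribution n} → (∀ i → mass μ i ≈ mass ν i) →
                 Contains n μ → Contains n ν

  _∈ᴾ_ : ∀ {n} → Distribution n → Property → Set
  _∈ᴾ_ {n} μ 𝒫 = Property.Contains 𝒫 n μ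

  LabelInvariant : Property → Set
  LabelInvariant 𝒫 =
    ∀ {n} (σ : Permutation′ n) (μ : Distribution n) → μ ∈ᴾ 𝒫 → relabel σ μ ∈ᴾ 𝒫

  distance : ∀ {n} → Distribution n → Distribution n → Carrier
  distance μ ν = ½ * sum (λ i → abs (mass μ i - mass ν i))

  Far : ∀ {n} → Carrier → Distribution n → Property → Set
  Far ε μ 𝒫 = ∀ ν → ν ∈ᴾ 𝒫 → ε ≤ distance μ ν

  massOf : ∀ {n} → Distribution n → Subset n → Carrier
  massOf μ A = sum λ i → if does (i ∈? A) then mass μ i else 0#

  -- The probability that the oracle for μ, queried on A, returns j.
  oracle : ∀ {n} → Distribution n → Subset n → Fin n → Carrier
  oracle μ A j =
    if does (j ∈? A)
    then (if does (em {0# < massOf μ A})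
          then mass μ j * massOf μ A ⁻¹
          else fromℕ ∣ A ∣ ⁻¹)
    else 0#

  data Verdict : Set where
    accept reject : Verdict

  -- Decision trees: query A _ k requests a sample j from A and continues with
  -- k j; toss s t flips a fair coin and continues with s or with t. As the
  -- oracle returns only members of A, k j is irrelevant for j outside A.
  data Algorithm (n : ℕ) : Set where
    halt  : Verdict → Algorithm n
    toss  : Algorithm n → Algorithm n → Algorithm n
    query : (A : Subset n) → Nonempty A → (Fin n → Algorithm n) → Algorithm n

  -- The number of queries in the worst case.
  queries : ∀ {n} → Algorithm n → ℕ
  queries (halt _)      = 0
  queries (toss s t)    = queries s ℕ.⊔ queries t
  queries (query _ _ k) = suc (Vector.foldr ℕ._⊔_ 0 λ j → queries (k j))

  indicator : Verdict → Verdict → Carrier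
  indicator accept accept = 1#
  indicator reject reject = 1#
  indicator _      _      = 0#

  -- The probability that the algorithm halts with the given verdict.
  Pr : ∀ {n} → Distribution n → Algorithm n → Verdict → Carrier
  Pr μ (halt v)      w = indicator v w
  Pr μ (toss s t)    w = ½ * Pr μ s w + ½ * Pr μ t w
  Pr μ (query A _ k) w = sum λ j → oracle μ A j * Pr μ (k j) w

  InUnitInterval : Pred Carrier 0ℓ
  InUnitInterval x = 0# < x × x < 1#

  -- One algorithm for each ε, δ and n.
  Tester : Set
  Tester = (ε δ : Carrier) (n : ℕ) → Algorithm n

  Tests : Tester → Property → Set
  Tests T 𝒫 =
    ∀ ε δ n → InUnitInterval ε → InUnitInterval δ → (μ : Distribution n) →
      (μ ∈ᴾ 𝒫   → 1# - δ ≤ Pr μ (T ε δ n) accept) ×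
      (Far ε μ 𝒫 → 1# - δ ≤ Pr μ (T ε δ n) reject)

  -- n = 0 is excluded: log 0 is undefined and there are no distributions on ∅.
  QueriesBoundedBy : Tester → Polynomial₃ → Set
  QueriesBoundedBy T p =
    ∀ ε δ n → InUnitInterval ε → InUnitInterval δ → .{{_ : NonZero n}} →
      fromℕ (queries (T ε δ n)) ≤ eval p (log₂ (fromℕ n)) (ε ⁻¹) (log₂ (δ ⁻¹))

{-# OPTIONS --safe #-}

-- If i is drawn from μ, the value μ(i) can be estimated by following the chain of classes
-- [n] = A₀ ⊃ A₁ ⊃ … ⊃ A_T = {i} obtained by repeated halving: conditional samples from Aₜ estimate
-- μ(Aₜ₊₁) / μ(Aₜ), and μ(i) is the product of these ratios. On average over i all T ≈ log n
-- ratios are accurate up to a factor ρ = 1 + 1 / N, so that a random l with ρ ^ l ≈ 1 / μ(i) is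
-- obtained from polynomially many samples. It takes only polynomially many values, hence its
-- frequencies can be learned up to a small error. They determine μ up to a small distance and a
-- relabelling: pairing elements of μ and ν with equal l gives a fractional assignment with large
-- overlap, and by linear programming duality matching the elements in the order of decreasing mass
-- is at least as good. Hence it is sound to accept if some member of the property explains the
-- observed frequencies. A majority vote over O(log (1 / δ)) trials reduces the error
-- probability to δ.

module Submission where

open import Defs
open import Algebra.Bundles using (CommutativeRing; RawRing)
import Algebra.Construct.NaturalChoice.Max as Max
import Algebra.Construct.NaturalChoice.Min as Min
import Algebra.Properties.CommutativeSemiring.Exp as CommutativeExp
import Algebra.Properties.Ring as RingProperties
import Algebra.Properties.Semiring.Exp as Exp
import Algebra.Properties.Semiring.Mult as Mult
import Algebra.Properties.Semiring.Mult.TCOptimised as MultTCO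
import Algebra.Properties.Semiring.Sum as Sum
import Algebra.Solver.Ring as RingSolver
open import Algebra.Solver.Ring.AlmostCommutativeRing using (fromCommutativeRing; _-Raw-AlmostCommutative⟶_)
open import Axiom.ExcludedMiddle using (ExcludedMiddle)
open import Data.Bool.Base using (Bool; true; false; if_then_else_; _∧_)
open import Data.Fin.Base as Fin using (Fin; zero; suc; remQuot; combine)
open import Data.Fin.Permutation as Perm using (Permutation′; _⟨$⟩ʳ_; _⟨$⟩ˡ_; _∘ₚ_; lift₀; transpose)
import Data.Fin.Properties as Fin
open import Data.Fin.Subset using (Subset; Nonempty; ∣_∣; inside; outside)
open import Data.Fin.Subset.Properties using (_∈?_; nonempty?; x∈p⇒∣p-x∣<∣p∣)
open import Data.Integer.Base as ℤ using (ℤ; +_; -[1+_]; _⊖_)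
import Data.Integer.Properties as ℤ
open import Data.List.Base as List using ([]; _∷_)
open import Data.Maybe.Base using (Maybe; just; nothing)
open import Data.Nat.Base as ℕ using (ℕ; zero; suc; NonZero)
import Data.Nat.Properties as ℕ
open import Data.Product.Base using (∃; _×_; _,_; proj₁; proj₂)
open import Data.Sum.Base using (_⊎_; inj₁; inj₂)
open import Data.Unit.Base using (⊤; tt)
open import Data.Vec.Base as Vec using (Vec; []; _∷_)
open import Data.Vec.Functional as Vector using (Vector)
open import Function.Base using (_∘_)
open import Level using (0ℓ)
open import Relation.Binary.Bundles using (TotalOrder)
open import Relation.Binary.PropositionalEquality.Core as ≡ using (_≡_)
import Relation.Binary.Reasoning.PartialOrder as PartialOrderReasoning
import Relation.Binary.Reasoning.Setoid as SetoidReasoning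
open import Relation.Nullary using (¬_; Dec; yes; no; does; contradiction; decidable-stable)
open import Relation.Nullary.Decidable using (dec-true; dec-false)

-- The label l is itself random, and its law given i depends on how the halvings fall, so l is no
-- function of μ(i) and the masses cannot be read off a histogram. Two distributions are compared
-- instead through the joint weights of pairs (i, l), restricted to good outcomes, where μ(i) ρ ^ l
-- lies between 1 / κ and κ for κ = ρ ^ (2 T). If P and Q are the resulting weights of the labels,
-- giving the pair (i, j) the amount Σ p(i, l) q(j, l) ρ ^ l / (κ max(P(l), Q(l))), summed over l,
-- is a fractional assignment whose overlap is at least Σ min(P(l), Q(l)) / κ². The loss κ² = ρ ^ (4
-- T) becomes an additive 4 T / N. The frequencies of l may change under relabelling, and this is
-- harmless. A member ν of the property is tried in its own labelling; if μ is a member, it explains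
-- its own typical samples. Invariance enters only at the end, when closeness up to a relabelling
-- has been shown. Conditional samples provide the relative precision for light elements: each ratio
-- compares a class with its half, however small both are.

module Development (em : ExcludedMiddle 0ℓ) (ℝ : CompleteOrderedField) where

  open Testing em ℝ
  open OrderedFieldProperties
  open CompleteOrderedField ℝ
    hiding (_≈_; _+_; _*_; -_; 0#; 1#; isCommutativeRing)
  open CommutativeRing commutativeRing
    hiding (Carrier) renaming (zero to *-zero)
  open Mult semiring
    using (×-homo-+; ×1-homo-*) renaming (_×_ to _·_)
  open Exp semiring using (_^_; ^-assocʳ; ^-homo-*; ^-congˡ; ^-congʳ)
  open CommutativeExp commutativeSemiring using (^-distrib-*)
  open Sum semiring using (sum; sum-permute; sum-cong-≋; ∑-distrib-+; ∑-comm; *-distribˡ-sum; *-distribʳ-sum; sum-replicate-zero)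
  open Max totalOrder using (_⊔_; x≤y⇒x⊔y≈y; x≤y⇒y⊔x≈y; ⊔-cong)
  open RingProperties ring using (-‿involutive; -‿distribˡ-*; -‿distribʳ-*; -‿+-comm; -0#≈0#)

  -- Integer coefficients for the ring solver

  module Mult′ = MultTCO semiring
  module ≈-Reasoning = SetoidReasoning setoid

  ℤ-rawRing : RawRing 0ℓ 0ℓ
  ℤ-rawRing = CommutativeRing.rawRing ℤ.+-*-commutativeRing

  -- With this definition the literals 0 and 1 of the ring solver are 0# and 1#.
  lit : ℕ → Carrier
  lit n = n Mult′.× 1#

  fromℕ≈lit : ∀ n → fromℕ n ≈ lit n
  fromℕ≈lit n = Mult′.×ᵤ≈× n 1#

  fromℤ : ℤ → Carrier
  fromℤ (+ n)    = lit n
  fromℤ -[1+ n ] = - lit (suc n)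

  fromℤ-⊖ : ∀ m n → fromℤ (m ⊖ n) ≈ lit m - lit n
  fromℤ-⊖ m       zero    = sym (trans (+-congˡ -0#≈0#) (+-identityʳ _))
  fromℤ-⊖ zero    (suc n) = sym (+-identityˡ _)
  fromℤ-⊖ (suc m) (suc n) = trans (reflexive (≡.cong fromℤ (ℤ.[1+m]⊖[1+n]≡m⊖n m n)))
    (trans (fromℤ-⊖ m n) (sym (begin
      lit (suc m) - lit (suc n)             ≈⟨ +-cong (Mult′.1+× m 1#) (-‿cong (Mult′.1+× n 1#)) ⟩
      (1# + lit m) - (1# + lit n)       ≈⟨ +-congˡ (sym (-‿+-comm _ _)) ⟩
      (1# + lit m) + (- 1# + - lit n)   ≈⟨ +-congʳ (+-comm _ _) ⟩
      (lit m + 1#) + (- 1# + - lit n)   ≈⟨ +-assoc _ _ _ ⟩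
      lit m + (1# + (- 1# + - lit n))   ≈⟨ +-congˡ (sym (+-assoc _ _ _)) ⟩
      lit m + ((1# + - 1#) + - lit n)   ≈⟨ +-congˡ (+-congʳ (-‿inverseʳ 1#)) ⟩
      lit m + (0# + - lit n)            ≈⟨ +-congˡ (+-identityˡ _) ⟩
      lit m - lit n ∎)))
    where open ≈-Reasoning

  fromℤ-neg : ∀ i → fromℤ (ℤ.- i) ≈ - fromℤ i
  fromℤ-neg (+ zero)  = sym -0#≈0#
  fromℤ-neg (+ suc n) = refl
  fromℤ-neg -[1+ n ]  = sym (-‿involutive _)

  fromℤ-+ : ∀ i j → fromℤ (i ℤ.+ j) ≈ fromℤ i + fromℤ j
  fromℤ-+ (+ m)    (+ n)    = Mult′.×-homo-+ 1# m n
  fromℤ-+ (+ m)    -[1+ n ] = fromℤ-⊖ m (suc n)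
  fromℤ-+ -[1+ m ] (+ n)    = trans (fromℤ-⊖ n (suc m)) (+-comm _ _)
  fromℤ-+ -[1+ m ] -[1+ n ] = trans
    (-‿cong (trans (reflexive (≡.cong (λ k → lit (suc k)) (≡.sym (ℕ.+-suc m n)))) (Mult′.×-homo-+ 1# (suc m) (suc n))))
    (sym (-‿+-comm _ _))

  fromℤ-+* : ∀ m j → fromℤ (+ m ℤ.* j) ≈ lit m * fromℤ j
  fromℤ-+* m (+ n) = trans (reflexive (≡.cong fromℤ (≡.sym (ℤ.pos-* m n)))) (Mult′.×1-homo-* m n)
  fromℤ-+* m -[1+ n ] = begin
    fromℤ (+ m ℤ.* -[1+ n ])        ≡⟨ ≡.cong fromℤ (≡.sym (ℤ.neg-distribʳ-* (+ m) (+ suc n))) ⟩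
    fromℤ (ℤ.- (+ m ℤ.* + suc n))   ≈⟨ fromℤ-neg (+ m ℤ.* + suc n) ⟩
    - fromℤ (+ m ℤ.* + suc n)       ≈⟨ -‿cong (fromℤ-+* m (+ suc n)) ⟩
    - (lit m * lit (suc n))     ≈⟨ -‿distribʳ-* _ _ ⟩
    lit m * - lit (suc n)       ∎
    where open ≈-Reasoning

  fromℤ-* : ∀ i j → fromℤ (i ℤ.* j) ≈ fromℤ i * fromℤ j
  fromℤ-* (+ m)    j = fromℤ-+* m j
  fromℤ-* -[1+ m ] j = begin
    fromℤ (-[1+ m ] ℤ.* j)          ≡⟨ ≡.cong fromℤ (≡.sym (ℤ.neg-distribˡ-* (+ suc m) j)) ⟩
    fromℤ (ℤ.- (+ suc m ℤ.* j))     ≈⟨ fromℤ-neg (+ suc m ℤ.* j) ⟩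
    - fromℤ (+ suc m ℤ.* j)         ≈⟨ -‿cong (fromℤ-+* (suc m) j) ⟩
    - (lit (suc m) * fromℤ j)     ≈⟨ -‿distribˡ-* _ _ ⟩
    - lit (suc m) * fromℤ j       ∎
    where open ≈-Reasoning

  fromℤ-homomorphism : ℤ-rawRing -Raw-AlmostCommutative⟶ fromCommutativeRing commutativeRing
  fromℤ-homomorphism = record
    { ⟦_⟧    = fromℤ
    ; +-homo = fromℤ-+
    ; *-homo = fromℤ-*
    ; -‿homo = fromℤ-neg
    ; 0-homo = refl
    ; 1-homo = refl
    }

  fromℤ-≟ : ∀ i j → Maybe (fromℤ i ≈ fromℤ j)
  fromℤ-≟ i j with i ℤ.≟ j
  ... | yes i≡j = just (reflexive (≡.cong fromℤ i≡j))
  ... | no  _   = nothing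

  open RingSolver ℤ-rawRing (fromCommutativeRing commutativeRing) fromℤ-homomorphism fromℤ-≟
    using (solve; _:=_; _:+_; _:*_; _:-_; :-_; con)

  -- Ordered fields

  module ≤-Reasoning = PartialOrderReasoning (TotalOrder.poset totalOrder)

  ≤-+ : ∀ {x y z} → 0# ≤ z → x + z ≈ y → x ≤ y
  ≤-+ {x} 0≤z x+z≈y = ≤-resp (+-identityʳ x) x+z≈y (+-monoʳ-≤ x 0≤z)

  +-nonNeg : ∀ {x y} → 0# ≤ x → 0# ≤ y → 0# ≤ x + y
  +-nonNeg 0≤x 0≤y = ≤-resp (+-identityˡ 0#) refl (+-mono-≤ 0≤x 0≤y)

  x²-nonNeg : ∀ x → 0# ≤ x * x
  x²-nonNeg x with ≤.total 0# x
  ... | inj₁ 0≤x = *-nonNeg 0≤x 0≤x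
  ... | inj₂ x≤0 = ≤-resp refl (solve 1 (λ x → (con (+ 0) :- x) :* (con (+ 0) :- x) := x :* x) refl x)
                     (*-nonNeg (x≤y⇒0≤y-x x≤0) (x≤y⇒0≤y-x x≤0))

  *-mono-≤ : ∀ {w x y z} → 0# ≤ w → 0# ≤ y → w ≤ x → y ≤ z → w * y ≤ x * z
  *-mono-≤ 0≤w 0≤y w≤x y≤z = ≤.trans (*-monoˡ-≤ 0≤y w≤x) (*-monoʳ-≤ (≤.trans 0≤w w≤x) y≤z)

  0≤y-x⇒x≤y : ∀ {x y} → 0# ≤ y - x → x ≤ y
  0≤y-x⇒x≤y {x} {y} le = ≤-+ le (solve 2 (λ x y → x :+ (y :- x) := y) refl x y)

  ≰⇒≥ : ∀ {x y} → ¬ (x ≤ y) → y ≤ x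
  ≰⇒≥ {x} {y} x≰y with ≤.total x y
  ... | inj₁ x≤y = contradiction x≤y x≰y
  ... | inj₂ y≤x = y≤x

  pos⇒≉0 : ∀ {x} → 0# < x → ¬ (x ≈ 0#)
  pos⇒≉0 (_ , 0≉x) x≈0 = 0≉x (sym x≈0)

  <-≤-trans : ∀ {x y z} → x < y → y ≤ z → x < z
  <-≤-trans (x≤y , x≉y) y≤z = ≤.trans x≤y y≤z , λ x≈z → x≉y (≤.antisym x≤y (≤.trans y≤z (≤.reflexive (sym x≈z))))

  ≤-<-trans : ∀ {x y z} → x ≤ y → y < z → x < z
  ≤-<-trans x≤y (y≤z , y≉z) = ≤.trans x≤y y≤z , λ x≈z → y≉z (≤.antisym y≤z (≤.trans (≤.reflexive (sym x≈z)) x≤y))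

  <-irrefl : ∀ {x y} → x < y → ¬ (y ≤ x)
  <-irrefl (x≤y , x≉y) y≤x = x≉y (≤.antisym x≤y y≤x)

  ≰⇒> : ∀ {x y} → ¬ (x ≤ y) → y < x
  ≰⇒> x≰y = ≰⇒≥ x≰y , λ y≈x → x≰y (≤.reflexive (sym y≈x))

  0<1 : 0# < 1#
  0<1 = 0≤1 , λ 0≈1 → 1≉0 (sym 0≈1)

  *-pos : ∀ {x y} → 0# < x → 0# < y → 0# < x * y
  *-pos {x} {y} 0<x@(0≤x , _) 0<y@(0≤y , _) = *-nonNeg 0≤x 0≤y , λ 0≈xy → <-irrefl 0<y
    (*-cancelˡ-≤ 0≤x (pos⇒≉0 0<x) (≤.reflexive (trans (sym 0≈xy) (sym (zeroʳ x)))))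

  pos-cancelˡ-≤ : ∀ {x y z} → 0# < z → z * x ≤ z * y → x ≤ y
  pos-cancelˡ-≤ 0<z = *-cancelˡ-≤ (proj₁ 0<z) (pos⇒≉0 0<z)

  ⁻¹-nonNeg : ∀ {x} → 0# < x → 0# ≤ x ⁻¹
  ⁻¹-nonNeg {x} 0<x = pos-cancelˡ-≤ 0<x (≤-resp (sym (zeroʳ x)) (sym (*-inverseʳ (pos⇒≉0 0<x))) 0≤1)

  0<fromℕ : ∀ n → .{{_ : NonZero n}} → 0# < fromℕ n
  0<fromℕ n = <-≤-trans 0<1 (1≤fromℕ n)

  0≤fromℕ : ∀ n → 0# ≤ fromℕ n
  0≤fromℕ n = fromℕ-mono {0} {n} ℕ.z≤n

  0≤lit : ∀ k → 0# ≤ lit k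
  0≤lit k = ≤-resp refl (fromℕ≈lit k) (0≤fromℕ k)

  0<lit : ∀ k → .{{_ : NonZero k}} → 0# < lit k
  0<lit k = <-≤-trans (0<fromℕ k) (≤.reflexive (fromℕ≈lit k))

  square-≤⇒≤ : ∀ {x y} → 0# ≤ y → x * x ≤ y * y → x ≤ y
  square-≤⇒≤ {x} {y} 0≤y x²≤y² = decidable-stable em λ x≰y →
    let 0<x   = ≤-<-trans 0≤y (≰⇒> x≰y)
        0<x+y = <-≤-trans 0<x (≤-+ 0≤y refl)
    in x≰y (pos-cancelˡ-≤ 0<x+y (≤-resp
         (solve 2 (λ x y → x :* x :+ x :* y := (x :+ y) :* x) refl x y)
         (solve 2 (λ x y → y :* y :+ x :* y := (x :+ y) :* y) refl x y)
         (+-monoˡ-≤ (x * y) x²≤y²)))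

  sum-mono : ∀ {n} {f g : Vector Carrier n} → (∀ i → f i ≤ g i) → sum f ≤ sum g
  sum-mono {zero}  f≤g = ≤.refl
  sum-mono {suc n} f≤g = +-mono-≤ (f≤g zero) (sum-mono (λ i → f≤g (suc i)))

  sum-nonNeg : ∀ {n} {f : Vector Carrier n} → (∀ i → 0# ≤ f i) → 0# ≤ sum f
  sum-nonNeg {zero}  0≤f = ≤.refl
  sum-nonNeg {suc n} 0≤f = +-nonNeg (0≤f zero) (sum-nonNeg (λ i → 0≤f (suc i)))

  sum-const : ∀ n x → sum {n} (λ _ → x) ≈ fromℕ n * x
  sum-const zero    x = sym (zeroˡ x)
  sum-const (suc n) x = trans (+-congˡ (sum-const n x)) (solve 2 (λ x m → x :+ m :* x := (con (+ 1) :+ m) :* x) refl x (fromℕ n))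

  sum-cong : ∀ {n} {f g : Vector Carrier n} → (∀ i → f i ≈ g i) → sum f ≈ sum g
  sum-cong {f = f} {g} = sum-cong-≋ {x = f} {g}

  [_] : Bool → Carrier
  [ b ] = if b then 1# else 0#

  0≤[] : ∀ b → 0# ≤ [ b ]
  0≤[] true  = 0≤1
  0≤[] false = ≤.refl

  []≤1 : ∀ b → [ b ] ≤ 1#
  []≤1 true  = ≤.refl
  []≤1 false = 0≤1

  if≈[]* : ∀ b x → (if b then x else 0#) ≈ [ b ] * x
  if≈[]* true  x = sym (*-identityˡ x)
  if≈[]* false x = sym (zeroˡ x)

  𝟙 : Set → Carrier
  𝟙 P = [ does (em {P}) ]

  0≤𝟙 : ∀ {P} → 0# ≤ 𝟙 P
  0≤𝟙 = 0≤[] _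

  𝟙≤1 : ∀ {P} → 𝟙 P ≤ 1#
  𝟙≤1 = []≤1 _

  𝟙-true : ∀ {P} → P → 𝟙 P ≈ 1#
  𝟙-true p = reflexive (≡.cong [_] (dec-true em p))

  𝟙-false : ∀ {P} → ¬ P → 𝟙 P ≈ 0#
  𝟙-false ¬p = reflexive (≡.cong [_] (dec-false em ¬p))

  []≤𝟙¬ : ∀ {P} b → (P → b ≡ false) → [ b ] ≤ 𝟙 (¬ P)
  []≤𝟙¬ {P} b P⇒¬b with em {¬ P}
  ... | yes _   = []≤1 b
  ... | no  ¬¬p = ≤.reflexive (reflexive (≡.cong [_] (P⇒¬b (decidable-stable em ¬¬p))))

  -- Programs and expectations

  -- Query trees with results of any type, so that sampling procedures can be sequenced by `_>>=_`
  -- before `toAlgorithm` turns the final one into an `Algorithm`.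
  data Prog (n : ℕ) (A : Set) : Set where
    ret : A → Prog n A
    ask : (S : Subset n) → Nonempty S → (Fin n → Prog n A) → Prog n A

  infixl 1 _>>=_
  _>>=_ : ∀ {n A B} → Prog n A → (A → Prog n B) → Prog n B
  ret a      >>= f = f a
  ask S ne k >>= f = ask S ne λ j → k j >>= f

  mapᴾ : ∀ {n A B} → (A → B) → Prog n A → Prog n B
  mapᴾ f p = p >>= λ a → ret (f a)

  data Cost≤ {n A} : ℕ → Prog n A → Set where
    ret : ∀ {c a} → Cost≤ c (ret a)
    ask : ∀ {c S ne k} → (∀ j → Cost≤ c (k j)) → Cost≤ (suc c) (ask S ne k)

  >>=-cost : ∀ {n A B c d} {p : Prog n A} {f : A → Prog n B} →
             Cost≤ c p → (∀ a → Cost≤ d (f a)) → Cost≤ (c ℕ.+ d) (p >>= f)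
  >>=-cost {c = c} {d} (ret {a = a}) cf = weaken (ℕ.m≤n+m d c) (cf a)
    where
    weaken : ∀ {n A c d} {p : Prog n A} → c ℕ.≤ d → Cost≤ c p → Cost≤ d p
    weaken c≤d            ret     = ret
    weaken (ℕ.s≤s c≤d) (ask ck) = ask λ j → weaken c≤d (ck j)
  >>=-cost (ask ck) cf = ask λ j → >>=-cost (ck j) cf

  mapᴾ-cost : ∀ {n A B c} {p : Prog n A} {f : A → B} → Cost≤ c p → Cost≤ c (mapᴾ f p)
  mapᴾ-cost {c = c} cp = ≡.subst (λ d → Cost≤ d _) (ℕ.+-identityʳ c) (>>=-cost cp λ _ → ret)

  toAlgorithm : ∀ {n} → Prog n Verdict → Algorithm n
  toAlgorithm (ret v)      = halt v
  toAlgorithm (ask S ne k) = query S ne λ j → toAlgorithm (k j)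

  queries-toAlgorithm : ∀ {n c} {p : Prog n Verdict} → Cost≤ c p → queries (toAlgorithm p) ℕ.≤ c
  queries-toAlgorithm ret      = ℕ.z≤n
  queries-toAlgorithm (ask ck) = ℕ.s≤s (max≤ _ λ j → queries-toAlgorithm (ck j))
    where
    max≤ : ∀ {m c} (f : Vector ℕ m) → (∀ j → f j ℕ.≤ c) → Vector.foldr ℕ._⊔_ 0 f ℕ.≤ c
    max≤ {zero}  f f≤c = ℕ.z≤n
    max≤ {suc m} f f≤c = ℕ.⊔-lub (f≤c zero) (max≤ (f ∘ suc) (f≤c ∘ suc))

  module _ {n : ℕ} (μ : Distribution n) where

    E : ∀ {A} → Prog n A → (A → Carrier) → Carrier
    E (ret a)     f = f a
    E (ask S _ k) f = sum λ j → oracle μ S j * E (k j) f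

    Pr-toAlgorithm : ∀ p w → Pr μ (toAlgorithm p) w ≈ E p λ v → indicator v w
    Pr-toAlgorithm (ret v)      w = refl
    Pr-toAlgorithm (ask S ne k) w = sum-cong λ j → *-congˡ (Pr-toAlgorithm (k j) w)

    massOf≈ : ∀ S → massOf μ S ≈ sum λ i → [ does (i ∈? S) ] * mass μ i
    massOf≈ S = sum-cong {n} λ i → if≈[]* _ _

    sum-∈≈∣∣ : ∀ {m} (S : Subset m) → sum (λ i → [ does (i ∈? S) ]) ≈ fromℕ ∣ S ∣
    sum-∈≈∣∣ []            = refl
    sum-∈≈∣∣ (outside ∷ S) = trans (+-identityˡ _) (sum-∈≈∣∣ S)
    sum-∈≈∣∣ (inside  ∷ S) = +-congˡ (sum-∈≈∣∣ S)

    ∣S∣-nonZero : ∀ {m} {S : Subset m} → Nonempty S → NonZero ∣ S ∣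
    ∣S∣-nonZero (i , i∈S) = ℕ.>-nonZero (ℕ.≤-<-trans ℕ.z≤n (x∈p⇒∣p-x∣<∣p∣ i∈S))

    oracle-nonNeg : ∀ {S} → Nonempty S → ∀ j → 0# ≤ oracle μ S j
    oracle-nonNeg {S} ne j with does (j ∈? S) | em {0# < massOf μ S}
    ... | false | _       = ≤.refl
    ... | true  | yes 0<M = *-nonNeg (nonNeg μ j) (⁻¹-nonNeg 0<M)
    ... | true  | no  _   = ⁻¹-nonNeg (0<fromℕ ∣ S ∣ {{∣S∣-nonZero ne}})

    oracle-mass : ∀ {S} → 0# < massOf μ S → ∀ j →
                  oracle μ S j ≈ [ does (j ∈? S) ] * mass μ j * massOf μ S ⁻¹
    oracle-mass {S} 0<M j with does (j ∈? S) | em {0# < massOf μ S}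
    ... | false | _       = sym (trans (*-congʳ (zeroˡ _)) (zeroˡ _))
    ... | true  | yes _   = *-congʳ (sym (*-identityˡ _))
    ... | true  | no  0≮M = contradiction 0<M 0≮M

    oracle-total : ∀ {S} → Nonempty S → sum (oracle μ S) ≈ 1#
    oracle-total {S} ne with em {0# < massOf μ S} in eq
    ... | yes 0<M = begin
      sum (λ j → if does (j ∈? S) then mass μ j * M ⁻¹ else 0#)
        ≈⟨ sum-cong {n} (λ j → trans (if≈[]* _ _) (sym (*-assoc _ _ _))) ⟩
      sum (λ j → [ does (j ∈? S) ] * mass μ j * M ⁻¹)
        ≈⟨ sym (*-distribʳ-sum {n} (M ⁻¹) (λ j → [ does (j ∈? S) ] * mass μ j)) ⟩
      sum (λ j → [ does (j ∈? S) ] * mass μ j) * M ⁻¹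
        ≈⟨ *-congʳ (sym (massOf≈ S)) ⟩
      M * M ⁻¹
        ≈⟨ *-inverseʳ (pos⇒≉0 0<M) ⟩
      1# ∎
      where
      M = massOf μ S
      open ≈-Reasoning
    ... | no _ = begin
      sum (λ j → if does (j ∈? S) then fromℕ ∣ S ∣ ⁻¹ else 0#)
        ≈⟨ sum-cong {n} (λ j → if≈[]* _ _) ⟩
      sum (λ j → [ does (j ∈? S) ] * fromℕ ∣ S ∣ ⁻¹)
        ≈⟨ sym (*-distribʳ-sum {n} (fromℕ ∣ S ∣ ⁻¹) (λ j → [ does (j ∈? S) ])) ⟩
      sum (λ j → [ does (j ∈? S) ]) * fromℕ ∣ S ∣ ⁻¹
        ≈⟨ *-congʳ (sum-∈≈∣∣ S) ⟩
      fromℕ ∣ S ∣ * fromℕ ∣ S ∣ ⁻¹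
        ≈⟨ *-inverseʳ (fromℕ≉0 ∣ S ∣ {{∣S∣-nonZero ne}}) ⟩
      1# ∎
      where open ≈-Reasoning

    E-cong : ∀ {A} (p : Prog n A) {f g} → (∀ a → f a ≈ g a) → E p f ≈ E p g
    E-cong (ret a)      f≈g = f≈g a
    E-cong (ask S ne k) f≈g = sum-cong {n} λ j → *-congˡ (E-cong (k j) f≈g)

    E-mono : ∀ {A} (p : Prog n A) {f g} → (∀ a → f a ≤ g a) → E p f ≤ E p g
    E-mono (ret a)      f≤g = f≤g a
    E-mono (ask S ne k) f≤g = sum-mono {n} λ j → *-monoʳ-≤ (oracle-nonNeg ne j) (E-mono (k j) f≤g)

    E-const : ∀ {A} (p : Prog n A) c → E p (λ _ → c) ≈ c
    E-const (ret a)      c = refl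
    E-const (ask S ne k) c = begin
      sum (λ j → oracle μ S j * E (k j) (λ _ → c))  ≈⟨ sum-cong {n} (λ j → *-congˡ (E-const (k j) c)) ⟩
      sum (λ j → oracle μ S j * c)                  ≈⟨ sym (*-distribʳ-sum c (oracle μ S)) ⟩
      sum (oracle μ S) * c                          ≈⟨ *-congʳ (oracle-total ne) ⟩
      1# * c                                        ≈⟨ *-identityˡ c ⟩
      c ∎
      where open ≈-Reasoning

    E-+ : ∀ {A} (p : Prog n A) f g → E p (λ a → f a + g a) ≈ E p f + E p g
    E-+ (ret a)      f g = refl
    E-+ (ask S ne k) f g = trans
      (sum-cong {n} λ j → trans (*-congˡ (E-+ (k j) f g)) (distribˡ _ _ _))
      (∑-distrib-+ (λ j → oracle μ S j * E (k j) f) _)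

    E-* : ∀ {A} (p : Prog n A) c f → E p (λ a → c * f a) ≈ c * E p f
    E-* (ret a)      c f = refl
    E-* (ask S ne k) c f = trans
      (sum-cong {n} λ j → trans (*-congˡ (E-* (k j) c f))
        (solve 3 (λ o c e → o :* (c :* e) := c :* (o :* e)) refl _ _ _))
      (sym (*-distribˡ-sum c (λ j → oracle μ S j * E (k j) f)))

    E-sum : ∀ {A m} (p : Prog n A) (f : A → Fin m → Carrier) →
            E p (λ a → sum (f a)) ≈ sum λ l → E p λ a → f a l
    E-sum {m = zero}  p f = E-const p 0#
    E-sum {m = suc m} p f = trans (E-+ p (λ a → f a zero) (λ a → sum (f a ∘ suc)))
      (+-congˡ (E-sum p λ a → f a ∘ suc))

    E->>= : ∀ {A B} (p : Prog n A) (f : A → Prog n B) g → E (p >>= f) g ≈ E p λ a → E (f a) g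
    E->>= (ret a)      f g = refl
    E->>= (ask S ne k) f g = sum-cong {n} λ j → *-congˡ (E->>= (k j) f g)

    E-nonNeg : ∀ {A} (p : Prog n A) {f} → (∀ a → 0# ≤ f a) → 0# ≤ E p f
    E-nonNeg p 0≤f = ≤-resp (E-const p 0#) refl (E-mono p 0≤f)

  open Min totalOrder using (_⊓_; x≤y⇒x⊓y≈x; x≤y⇒y⊓x≈x; x⊓y≤x; x⊓y≤y; ⊓-glb; ⊓-sel; ⊓-comm; ⊓-cong)

  -- Optimal assignments

  Descending : ∀ {n} → Vector Carrier n → Set
  Descending {zero}  a = ⊤
  Descending {suc n} a = (∀ j → a (suc j) ≤ a zero) × Descending (a ∘ suc)

  descending-sort : ∀ {n} (a : Vector Carrier n) → ∃ λ (σ : Permutation′ n) → Descending (a ∘ (σ ⟨$⟩ʳ_))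
  descending-sort {zero}  a = Perm.id , tt
  descending-sort {suc n} a = sort (argmax a)
    where
    argmax : ∀ {m} (b : Vector Carrier (suc m)) → ∃ λ k → ∀ j → b j ≤ b k
    argmax {zero}  b = zero , λ { zero → ≤.refl }
    argmax {suc m} b with argmax (b ∘ suc)
    ... | k , max with ≤.total (b zero) (b (suc k))
    ...   | inj₁ b₀≤bₖ = suc k , λ { zero → b₀≤bₖ ; (suc j) → max j }
    ...   | inj₂ bₖ≤b₀ = zero  , λ { zero → ≤.refl ; (suc j) → ≤.trans (max j) bₖ≤b₀ }
    sort : (∃ λ k → ∀ j → a j ≤ a k) → ∃ λ (σ : Permutation′ (suc n)) → Descending (a ∘ (σ ⟨$⟩ʳ_))
    sort (k , max) with descending-sort (λ j → a (transpose zero k ⟨$⟩ʳ suc j))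
    ... | τ , desc = lift₀ τ ∘ₚ transpose zero k , (λ j → max _) , desc

  -- Optimal solutions of the linear program dual to the assignment problem with gains aᵢ ⊓ bⱼ,
  -- showing that the identity is an optimal assignment of descending sequences.
  record Potentials {n} (a b : Vector Carrier n) : Set where
    field
      u v      : Vector Carrier n
      u-nonNeg : ∀ i → 0# ≤ u i
      v-nonNeg : ∀ i → 0# ≤ v i
      covers   : ∀ i j → a i ⊓ b j ≤ u i + v j
      tight    : ∀ i → u i + v i ≈ a i ⊓ b i

  potentials-sym : ∀ {n} {a b : Vector Carrier n} → Potentials a b → Potentials b a
  potentials-sym P = record
    { u = v ; v = u ; u-nonNeg = v-nonNeg ; v-nonNeg = u-nonNeg
    ; covers = λ i j → ≤-resp (⊓-comm _ _) (+-comm _ _) (covers j i)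
    ; tight  = λ i → trans (+-comm _ _) (trans (tight i) (⊓-comm _ _))
    }
    where open Potentials P

  -- The new column copies the potential of the next one, and the new row receives the increase
  -- `m₀ - m₁` of the diagonal gain, which keeps the diagonal tight. An old row is covered in the
  -- new column because `a (suc i)` ≤ `a₁` ≤ `b₁`: raising `b₁` to `b zero` gains nothing there. In
  -- the new row, raising `a₁` to `a zero` increases no gain by more than `m₀ - a₁`, and `m₁` ≤
  -- `a₁`.
  potentials-step : ∀ {n} {a b : Vector Carrier (suc (suc n))} → Descending a → Descending b →
                    a (suc zero) ≤ b (suc zero) → Potentials (a ∘ suc) (b ∘ suc) → Potentials a b
  potentials-step {n} {a} {b} (a≤a₀ , a≤a₁ , _) (b≤b₀ , _) a₁≤b₁ P = record
    { u        = (u zero + (m₀ - m₁)) Vector.∷ u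
    ; v        = v zero Vector.∷ v
    ; u-nonNeg = λ { zero → +-nonNeg (u-nonNeg zero) (x≤y⇒0≤y-x m₁≤m₀) ; (suc i) → u-nonNeg i }
    ; v-nonNeg = λ { zero → v-nonNeg zero ; (suc i) → v-nonNeg i }
    ; covers   = λ { zero    zero    → ≤.reflexive (sym tight₀)
                   ; zero    (suc j) → covers₀ j
                   ; (suc i) zero    → ≤.trans (x⊓y≤x _ _) (≤.trans (⊓-glb ≤.refl (a′≤b₁ i)) (covers i zero))
                   ; (suc i) (suc j) → covers i j }
    ; tight    = λ { zero → tight₀ ; (suc i) → tight i }
    }
    where
    open Potentials P
    a₁ = a (suc zero)
    b₁ = b (suc zero)
    m₀ = a zero ⊓ b zero
    m₁ = a₁ ⊓ b₁
    a₁≤m₀ : a₁ ≤ m₀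
    a₁≤m₀ = ⊓-glb (a≤a₀ zero) (≤.trans a₁≤b₁ (b≤b₀ zero))
    m₁≤m₀ : m₁ ≤ m₀
    m₁≤m₀ = ≤.trans (x⊓y≤x _ _) a₁≤m₀
    tight₀ : (u zero + (m₀ - m₁)) + v zero ≈ m₀
    tight₀ = trans (solve 4 (λ u v m₀ m₁ → (u :+ (m₀ :- m₁)) :+ v := (u :+ v) :+ (m₀ :- m₁)) refl _ _ _ _)
      (trans (+-congʳ (tight zero)) (solve 2 (λ m₀ m₁ → m₁ :+ (m₀ :- m₁) := m₀) refl _ _))
    a′≤b₁ : ∀ i → a (suc i) ≤ b₁
    a′≤b₁ zero    = a₁≤b₁
    a′≤b₁ (suc i) = ≤.trans (a≤a₁ i) a₁≤b₁
    covers₀ : ∀ j → a zero ⊓ b (suc j) ≤ (u zero + (m₀ - m₁)) + v j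
    covers₀ j = ≤.trans bound (≤.trans
      (+-mono-≤ (covers zero j) (+-monoʳ-≤ m₀ (-‿anti (x⊓y≤x a₁ b₁))))
      (≤.reflexive (solve 4 (λ u v m₀ m₁ → (u :+ v) :+ (m₀ :- m₁) := (u :+ (m₀ :- m₁)) :+ v) refl _ _ _ _)))
      where
      -‿anti : ∀ {x y} → x ≤ y → - y ≤ - x
      -‿anti {x} {y} x≤y = ≤-+ (x≤y⇒0≤y-x x≤y) (solve 2 (λ x y → (:- y) :+ (y :- x) := :- x) refl x y)
      bound : a zero ⊓ b (suc j) ≤ (a₁ ⊓ b (suc j)) + (m₀ - a₁)
      bound with ⊓-sel a₁ (b (suc j))
      ... | inj₁ ≈a₁ = ≤.trans (⊓-glb (x⊓y≤x _ _) (≤.trans (x⊓y≤y _ _) (b≤b₀ j)))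
        (≤.reflexive (trans (solve 2 (λ a m → m := a :+ (m :- a)) refl a₁ m₀) (+-congʳ (sym ≈a₁))))
      ... | inj₂ ≈b = ≤.trans (x⊓y≤y _ _) (≤-+ (x≤y⇒0≤y-x a₁≤m₀) (+-congʳ (sym ≈b)))

  potentials-extend : ∀ {n} {a b : Vector Carrier (suc (suc n))} → Descending a → Descending b →
                      Potentials (a ∘ suc) (b ∘ suc) → Potentials a b
  potentials-extend {n} {a} {b} da db P with ≤.total (a (suc zero)) (b (suc zero))
  ... | inj₁ a₁≤b₁ = potentials-step da db a₁≤b₁ P
  ... | inj₂ b₁≤a₁ = potentials-sym (potentials-step db da b₁≤a₁ (potentials-sym P))

  potentials : ∀ {n} {a b : Vector Carrier n} → Descending a → Descending b →
               (∀ i → 0# ≤ a i) → (∀ i → 0# ≤ b i) → Potentials a b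
  potentials {zero} _ _ _ _ = record
    { u = λ () ; v = λ () ; u-nonNeg = λ () ; v-nonNeg = λ () ; covers = λ () ; tight = λ () }
  potentials {suc zero} {a} {b} _ _ 0≤a 0≤b = record
    { u        = λ i → a i ⊓ b i
    ; v        = λ _ → 0#
    ; u-nonNeg = λ i → ⊓-glb (0≤a i) (0≤b i)
    ; v-nonNeg = λ _ → ≤.refl
    ; covers   = λ { zero zero → ≤.reflexive (sym (+-identityʳ _)) }
    ; tight    = λ i → +-identityʳ _
    }
  potentials {suc (suc n)} da db 0≤a 0≤b = potentials-extend da db
    (potentials {suc n} (proj₂ da) (proj₂ db) (0≤a ∘ suc) (0≤b ∘ suc))

  sum*sum : ∀ {m n} (f : Vector Carrier m) (g : Vector Carrier n) →
            sum (λ i → sum λ j → f i * g j) ≈ sum f * sum g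
  sum*sum {m} f g = trans (sum-cong {m} λ i → sym (*-distribˡ-sum (f i) g)) (sym (*-distribʳ-sum (sum g) f))

  -- In the application `p i l` is the probability that `i` is drawn and yields the label `l` by a
  -- good outcome, `q` is the same for the other distribution, and `w l` is ρ ^ l. The support
  -- conditions express `κ * (a i * w l)` ≥ 1 wherever `p i l` > 0, and likewise for `q`;
  -- multiplying by the weight itself avoids a case distinction.
  module _ {n K} {a b : Vector Carrier n} (P : Potentials a b)
    (p q : Fin n → Fin K → Carrier) (w : Vector Carrier K) (κ : Carrier)
    (0≤p : ∀ i l → 0# ≤ p i l) (0≤q : ∀ i l → 0# ≤ q i l)
    (0<w : ∀ l → 0# < w l) (0<κ : 0# < κ)
    (p-weight : ∀ i → sum (λ l → p i l * w l) ≤ κ) (q-weight : ∀ i → sum (λ l → q i l * w l) ≤ κ)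
    (p-support : ∀ i l → p i l ≤ p i l * (κ * (a i * w l)))
    (q-support : ∀ i l → q i l ≤ q i l * (κ * (b i * w l))) where

    open Potentials P
    private
      Pˡ Qˡ Uˡ Vˡ : Vector Carrier K
      Pˡ l = sum λ i → p i l
      Qˡ l = sum λ i → q i l
      Uˡ l = sum λ i → u i * p i l
      Vˡ l = sum λ i → v i * q i l

      -- Where both factors are positive, `a i` and `b j` are each at least 1 / (κ w(l)), hence so
      -- is their minimum, which `covers` bounds by the potentials.
      pair : ∀ l i j → p i l * q j l ≤ (κ * w l) * ((u i * p i l) * q j l + p i l * (v j * q j l))
      pair l i j = begin
        p i l * q j l
          ≤⟨ by-⊓ (⊓-sel (a i) (b j)) ⟩
        (κ * w l) * (p i l * q j l * (a i ⊓ b j))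
          ≤⟨ *-monoʳ-≤ (*-nonNeg (proj₁ 0<κ) (proj₁ (0<w l)))
               (*-monoʳ-≤ (*-nonNeg (0≤p i l) (0≤q j l)) (covers i j)) ⟩
        (κ * w l) * (p i l * q j l * (u i + v j))
          ≈⟨ *-congˡ (solve 4 (λ p q u v → p :* q :* (u :+ v) := u :* p :* q :+ p :* (v :* q)) refl _ _ _ _) ⟩
        (κ * w l) * ((u i * p i l) * q j l + p i l * (v j * q j l)) ∎
        where
        open ≤-Reasoning
        by-⊓ : (a i ⊓ b j ≈ a i) ⊎ (a i ⊓ b j ≈ b j) → p i l * q j l ≤ (κ * w l) * (p i l * q j l * (a i ⊓ b j))
        by-⊓ (inj₁ ≈a) = ≤.trans (*-monoˡ-≤ (0≤q j l) (p-support i l)) (≤.reflexive (trans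
          (solve 5 (λ p q κ a w → p :* (κ :* (a :* w)) :* q := κ :* w :* (p :* q :* a)) refl _ _ _ _ _)
          (*-congˡ (*-congˡ (sym ≈a)))))
        by-⊓ (inj₂ ≈b) = ≤.trans (*-monoʳ-≤ (0≤p i l) (q-support j l)) (≤.reflexive (trans
          (solve 5 (λ p q κ a w → p :* (q :* (κ :* (a :* w))) := κ :* w :* (p :* q :* a)) refl _ _ _ _ _)
          (*-congˡ (*-congˡ (sym ≈b)))))

      0≤P : ∀ l → 0# ≤ Pˡ l
      0≤P l = sum-nonNeg {n} λ i → 0≤p i l
      0≤Q : ∀ l → 0# ≤ Qˡ l
      0≤Q l = sum-nonNeg {n} λ i → 0≤q i l
      0≤U : ∀ l → 0# ≤ Uˡ l
      0≤U l = sum-nonNeg {n} λ i → *-nonNeg (u-nonNeg i) (0≤p i l)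
      0≤V : ∀ l → 0# ≤ Vˡ l
      0≤V l = sum-nonNeg {n} λ i → *-nonNeg (v-nonNeg i) (0≤q i l)

      PQ≤ : ∀ l → Pˡ l * Qˡ l ≤ (κ * w l) * (Uˡ l * Qˡ l + Pˡ l * Vˡ l)
      PQ≤ l = begin
        Pˡ l * Qˡ l
          ≈⟨ sym (sum*sum (λ i → p i l) (λ j → q j l)) ⟩
        sum (λ i → sum λ j → p i l * q j l)
          ≤⟨ sum-mono {n} (λ i → sum-mono {n} λ j → pair l i j) ⟩
        sum (λ i → sum λ j → (κ * w l) * (up i * q′ j + p′ i * vq j))
          ≈⟨ sum-cong {n} (λ i → sym (*-distribˡ-sum {n} (κ * w l) λ j → up i * q′ j + p′ i * vq j)) ⟩
        sum (λ i → (κ * w l) * sum λ j → up i * q′ j + p′ i * vq j)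
          ≈⟨ sym (*-distribˡ-sum {n} (κ * w l) λ i → sum λ j → up i * q′ j + p′ i * vq j) ⟩
        (κ * w l) * sum (λ i → sum λ j → up i * q′ j + p′ i * vq j)
          ≈⟨ *-congˡ (sum-cong {n} λ i → ∑-distrib-+ {n} (λ j → up i * q′ j) (λ j → p′ i * vq j)) ⟩
        (κ * w l) * sum (λ i → sum (λ j → up i * q′ j) + sum λ j → p′ i * vq j)
          ≈⟨ *-congˡ (∑-distrib-+ {n} (λ i → sum λ j → up i * q′ j) (λ i → sum λ j → p′ i * vq j)) ⟩
        (κ * w l) * (sum (λ i → sum λ j → up i * q′ j) + sum (λ i → sum λ j → p′ i * vq j))
          ≈⟨ *-congˡ (+-cong (sum*sum up q′) (sum*sum p′ vq)) ⟩
        (κ * w l) * (Uˡ l * Qˡ l + Pˡ l * Vˡ l) ∎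
        where
        open ≤-Reasoning
        up vq p′ q′ : Vector Carrier n
        up i = u i * p i l
        vq i = v i * q i l
        p′ i = p i l
        q′ i = q i l

      -- Division by the larger total `y`, after raising `x * v` to `y * v`. If `y` vanishes, so
      -- does `x`.
      cancel : ∀ {x y c u v} → 0# ≤ c → 0# ≤ x → 0# ≤ y → 0# ≤ u → 0# ≤ v → x ≤ y →
               x * y ≤ c * (u * y + x * v) → x ≤ c * (u + v)
      cancel {x} {y} {c} {u} {v} 0≤c 0≤x 0≤y 0≤u 0≤v x≤y xy≤ with em {0# ≈ y}
      ... | yes 0≈y = ≤.trans x≤y (≤-resp 0≈y refl (*-nonNeg 0≤c (+-nonNeg 0≤u 0≤v)))
      ... | no  0≉y = pos-cancelˡ-≤ (0≤y , 0≉y) (begin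
        y * x                  ≈⟨ *-comm y x ⟩
        x * y                  ≤⟨ xy≤ ⟩
        c * (u * y + x * v)    ≤⟨ *-monoʳ-≤ 0≤c (+-monoʳ-≤ (u * y) (*-monoˡ-≤ 0≤v x≤y)) ⟩
        c * (u * y + y * v)    ≈⟨ solve 4 (λ c u y v → c :* (u :* y :+ y :* v) := y :* (c :* (u :+ v))) refl c u y v ⟩
        y * (c * (u + v))      ∎)
        where open ≤-Reasoning

      P⊓Q≤ : ∀ l → Pˡ l ⊓ Qˡ l ≤ (κ * w l) * (Uˡ l + Vˡ l)
      P⊓Q≤ l = by-total (≤.total (Pˡ l) (Qˡ l))
        where
        0≤c = *-nonNeg (proj₁ 0<κ) (proj₁ (0<w l))
        by-total : Pˡ l ≤ Qˡ l ⊎ Qˡ l ≤ Pˡ l → Pˡ l ⊓ Qˡ l ≤ (κ * w l) * (Uˡ l + Vˡ l)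
        by-total (inj₁ P≤Q) = ≤.trans (x⊓y≤x _ _)
          (cancel 0≤c (0≤P l) (0≤Q l) (0≤U l) (0≤V l) P≤Q (PQ≤ l))
        by-total (inj₂ Q≤P) = ≤.trans (x⊓y≤y _ _) (≤-resp refl (*-congˡ (+-comm _ _))
          (cancel 0≤c (0≤Q l) (0≤P l) (0≤V l) (0≤U l) Q≤P (≤-resp (*-comm _ _)
            (*-congˡ (solve 4 (λ u q p v → u :* q :+ p :* v := v :* p :+ q :* u) refl _ _ _ _)) (PQ≤ l))))

      weighted : ∀ (x : Vector Carrier n) (r : Fin n → Fin K → Carrier) → (∀ i → 0# ≤ x i) →
                 (∀ i → sum (λ l → r i l * w l) ≤ κ) →
                 sum (λ l → w l * sum λ i → x i * r i l) ≤ sum x * κ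
      weighted x r 0≤x r-weight = begin
        sum (λ l → w l * sum λ i → x i * r i l)
          ≈⟨ sum-cong {K} (λ l → *-distribˡ-sum {n} (w l) λ i → x i * r i l) ⟩
        sum (λ l → sum λ i → w l * (x i * r i l))
          ≈⟨ ∑-comm {K} {n} (λ l i → w l * (x i * r i l)) ⟩
        sum (λ i → sum λ l → w l * (x i * r i l))
          ≈⟨ sum-cong {n} (λ i → sum-cong {K} λ l →
               solve 3 (λ w x r → w :* (x :* r) := x :* (r :* w)) refl _ _ _) ⟩
        sum (λ i → sum λ l → x i * (r i l * w l))
          ≈⟨ sum-cong {n} (λ i → sym (*-distribˡ-sum {K} (x i) λ l → r i l * w l)) ⟩
        sum (λ i → x i * sum λ l → r i l * w l)
          ≤⟨ sum-mono {n} (λ i → *-monoʳ-≤ (0≤x i) (r-weight i)) ⟩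
        sum (λ i → x i * κ)
          ≈⟨ sym (*-distribʳ-sum κ x) ⟩
        sum x * κ ∎
        where open ≤-Reasoning

    -- Weak duality for the fractional assignment that gives (i, j) the amount Σ p(i, l) q(j, l)
    -- w(l) / (κ max(P(l), Q(l))), summed over l. Its row and column sums are at most 1 by the
    -- weight conditions, and by the support conditions its gain is at least Σ min(P(l), Q(l)) / κ².
    -- The assignment is never formed: the dual inequality is averaged label by label, and `tight`
    -- identifies the dual value with the diagonal overlap.
    ⊓-overlap : sum (λ l → sum (λ i → p i l) ⊓ sum (λ i → q i l)) ≤ κ * (κ * sum (λ i → a i ⊓ b i))
    ⊓-overlap = begin
      sum (λ l → Pˡ l ⊓ Qˡ l)
        ≤⟨ sum-mono {K} P⊓Q≤ ⟩
      sum (λ l → (κ * w l) * (Uˡ l + Vˡ l))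
        ≈⟨ sum-cong {K} (λ l → solve 4 (λ κ w u v → κ :* w :* (u :+ v) := κ :* (w :* u :+ w :* v)) refl _ _ _ _) ⟩
      sum (λ l → κ * (w l * Uˡ l + w l * Vˡ l))
        ≈⟨ sym (*-distribˡ-sum {K} κ λ l → w l * Uˡ l + w l * Vˡ l) ⟩
      κ * sum (λ l → w l * Uˡ l + w l * Vˡ l)
        ≈⟨ *-congˡ (∑-distrib-+ {K} (λ l → w l * Uˡ l) (λ l → w l * Vˡ l)) ⟩
      κ * (sum (λ l → w l * Uˡ l) + sum (λ l → w l * Vˡ l))
        ≤⟨ *-monoʳ-≤ (proj₁ 0<κ) (+-mono-≤ (weighted u p u-nonNeg p-weight) (weighted v q v-nonNeg q-weight)) ⟩
      κ * (sum u * κ + sum v * κ)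
        ≈⟨ solve 3 (λ κ u v → κ :* (u :* κ :+ v :* κ) := κ :* (κ :* (u :+ v))) refl κ (sum u) (sum v) ⟩
      κ * (κ * (sum u + sum v))
        ≈⟨ *-congˡ (*-congˡ (trans (sym (∑-distrib-+ u v)) (sum-cong {n} tight))) ⟩
      κ * (κ * sum (λ i → a i ⊓ b i)) ∎
      where open ≤-Reasoning

  -- Repeated trials

  repeatᴾ : ∀ {n A} m → Prog n A → Prog n (Vec A m)
  repeatᴾ zero    p = ret []
  repeatᴾ (suc m) p = p >>= λ x → mapᴾ (x ∷_) (repeatᴾ m p)

  repeatᴾ-cost : ∀ {n A c} {p : Prog n A} m → Cost≤ c p → Cost≤ (m ℕ.* c) (repeatᴾ m p)
  repeatᴾ-cost zero    cp = ret
  repeatᴾ-cost (suc m) cp = >>=-cost cp λ x → mapᴾ-cost (repeatᴾ-cost m cp)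

  count : ∀ {A : Set} {m} → (A → Bool) → Vec A m → ℕ
  count b []       = 0
  count b (x ∷ xs) = if b x then suc (count b xs) else count b xs

  fromℕ-count : ∀ {A : Set} {m} (b : A → Bool) x (xs : Vec A m) →
                fromℕ (count b (x ∷ xs)) ≈ [ b x ] + fromℕ (count b xs)
  fromℕ-count b x xs with b x
  ... | true  = refl
  ... | false = sym (+-identityˡ _)

  []-idem : ∀ b → [ b ] * [ b ] ≈ [ b ]
  []-idem true  = *-identityˡ 1#
  []-idem false = zeroˡ 0#

  module _ {n} (μ : Distribution n) {A : Set} (p : Prog n A) where

    E-mapᴾ : ∀ {B : Set} (f : A → B) g → E μ (mapᴾ f p) g ≈ E μ p λ a → g (f a)
    E-mapᴾ f g = E->>= μ p (λ a → ret (f a)) g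

  module _ {n} (μ : Distribution n) {A : Set} (p : Prog n A) where

    E-repeatᴾ-suc : ∀ m g → E μ (repeatᴾ (suc m) p) g ≈ E μ p λ x → E μ (repeatᴾ m p) λ xs → g (x ∷ xs)
    E-repeatᴾ-suc m g = trans (E->>= μ p _ g) (E-cong μ p λ x → E-mapᴾ μ (repeatᴾ m p) (x ∷_) g)

    module _ (b : A → Bool) where
      private
        q : Carrier
        q = E μ p λ x → [ b x ]

      E-affine : ∀ s t → E μ p (λ x → s + t * [ b x ]) ≈ s + t * q
      E-affine s t = trans (E-+ μ p _ _) (+-cong (E-const μ p s) (E-* μ p t _))

      -- The offset `c` makes the induction go through: the centred contribution of the first sample
      -- is absorbed into it, and its cross term has mean zero.
      second-moment : ∀ m c →
        E μ (repeatᴾ m p) (λ xs → (c + (fromℕ (count b xs) - fromℕ m * q)) * (c + (fromℕ (count b xs) - fromℕ m * q)))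
          ≈ c * c + fromℕ m * (q * (1# - q))
      second-moment zero c = solve 2 (λ c q →
        (c :+ (con (+ 0) :- con (+ 0) :* q)) :* (c :+ (con (+ 0) :- con (+ 0) :* q)) :=
        c :* c :+ con (+ 0) :* (q :* (con (+ 1) :- q))) refl c q
      second-moment (suc m) c = begin
        E μ (repeatᴾ (suc m) p) (λ xs → square (c + (fromℕ (count b xs) - fromℕ (suc m) * q)))
          ≈⟨ E-repeatᴾ-suc m _ ⟩
        E μ p (λ x → E μ (repeatᴾ m p) λ xs → square (c + (fromℕ (count b (x ∷ xs)) - fromℕ (suc m) * q)))
          ≈⟨ E-cong μ p (λ x → E-cong μ (repeatᴾ m p) λ xs → square-cong (shift x xs)) ⟩
        E μ p (λ x → E μ (repeatᴾ m p) λ xs → square ((c + ([ b x ] - q)) + (fromℕ (count b xs) - fromℕ m * q)))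
          ≈⟨ E-cong μ p (λ x → second-moment m (c + ([ b x ] - q))) ⟩
        E μ p (λ x → square (c + ([ b x ] - q)) + fromℕ m * (q * (1# - q)))
          ≈⟨ E-cong μ p linear ⟩
        E μ p (λ x → (square (c - q) + fromℕ m * (q * (1# - q))) + (lit 2 * (c - q) + 1#) * [ b x ])
          ≈⟨ E-affine _ _ ⟩
        (square (c - q) + fromℕ m * (q * (1# - q))) + (lit 2 * (c - q) + 1#) * q
          ≈⟨ solve 3 (λ c q m → ((c :- q) :* (c :- q) :+ m :* (q :* (con (+ 1) :- q))) :+ (con (+ 2) :* (c :- q) :+ con (+ 1)) :* q
               := c :* c :+ (con (+ 1) :+ m) :* (q :* (con (+ 1) :- q))) refl c q (fromℕ m) ⟩
        c * c + fromℕ (suc m) * (q * (1# - q)) ∎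
        where
        open ≈-Reasoning
        square : Carrier → Carrier
        square x = x * x
        square-cong : ∀ {x y} → x ≈ y → square x ≈ square y
        square-cong x≈y = *-cong x≈y x≈y
        shift : ∀ x (xs : Vec A m) → c + (fromℕ (count b (x ∷ xs)) - fromℕ (suc m) * q)
                         ≈ (c + ([ b x ] - q)) + (fromℕ (count b xs) - fromℕ m * q)
        shift x xs = trans (+-congˡ (+-congʳ (fromℕ-count b x xs)))
          (solve 5 (λ c b k m q → c :+ ((b :+ k) :- (con (+ 1) :+ m) :* q) := (c :+ (b :- q)) :+ (k :- m :* q))
            refl c [ b x ] (fromℕ (count b xs)) (fromℕ m) q)
        linear : ∀ x → square (c + ([ b x ] - q)) + fromℕ m * (q * (1# - q))
                       ≈ (square (c - q) + fromℕ m * (q * (1# - q))) + (lit 2 * (c - q) + 1#) * [ b x ]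
        linear x = trans
          (solve 4 (λ c b q s → (c :+ (b :- q)) :* (c :+ (b :- q)) :+ s :=
            ((c :- q) :* (c :- q) :+ s) :+ (con (+ 2) :* (c :- q) :* b :+ b :* b)) refl c [ b x ] q _)
          (+-congˡ (trans (+-congˡ ([]-idem (b x)))
            (solve 2 (λ s b → s :* b :+ b := (s :+ con (+ 1)) :* b) refl _ [ b x ])))

      0≤E[] : 0# ≤ q
      0≤E[] = E-nonNeg μ p λ x → 0≤[] (b x)

      -- The factor `q` is kept and only 1 - `q` is dropped. A variance of order `m * q` gives small
      -- relative errors for counts with large mean, and it adds up over disjoint labels to at most
      -- the number of samples.
      variance : ∀ m → E μ (repeatᴾ m p) (λ xs → (fromℕ (count b xs) - fromℕ m * q) * (fromℕ (count b xs) - fromℕ m * q))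
                       ≤ fromℕ m * q
      variance m = begin
        E μ (repeatᴾ m p) (λ xs → (fromℕ (count b xs) - fromℕ m * q) * (fromℕ (count b xs) - fromℕ m * q))
          ≈⟨ E-cong μ (repeatᴾ m p) (λ xs → *-cong (sym (+-identityˡ _)) (sym (+-identityˡ _))) ⟩
        E μ (repeatᴾ m p) (λ xs → (0# + (fromℕ (count b xs) - fromℕ m * q)) * (0# + (fromℕ (count b xs) - fromℕ m * q)))
          ≈⟨ second-moment m 0# ⟩
        0# * 0# + fromℕ m * (q * (1# - q))
          ≤⟨ ≤-+ (*-nonNeg (0≤fromℕ m) (x²-nonNeg q))
               (solve 2 (λ m q → con (+ 0) :* con (+ 0) :+ m :* (q :* (con (+ 1) :- q)) :+ m :* (q :* q) := m :* q) refl (fromℕ m) q) ⟩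
        fromℕ m * q ∎
        where open ≤-Reasoning

      -- By independence this is a power of the mean of 4 ^ [b], which is 1 + 3 q. It serves the
      -- Chernoff bound for the majority vote.
      exponential-moment : ∀ m → E μ (repeatᴾ m p) (λ xs → lit 4 ^ count b xs) ≈ (1# + lit 3 * q) ^ m
      exponential-moment zero    = refl
      exponential-moment (suc m) = begin
        E μ (repeatᴾ (suc m) p) (λ xs → lit 4 ^ count b xs)
          ≈⟨ E-repeatᴾ-suc m _ ⟩
        E μ p (λ x → E μ (repeatᴾ m p) λ xs → lit 4 ^ count b (x ∷ xs))
          ≈⟨ E-cong μ p (λ x → trans (E-cong μ (repeatᴾ m p) (factor x)) (E-* μ (repeatᴾ m p) (1# + lit 3 * [ b x ]) _)) ⟩
        E μ p (λ x → (1# + lit 3 * [ b x ]) * E μ (repeatᴾ m p) λ xs → lit 4 ^ count b xs)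
          ≈⟨ E-cong μ p (λ x → trans (*-congˡ (exponential-moment m)) (*-comm _ _)) ⟩
        E μ p (λ x → (1# + lit 3 * q) ^ m * (1# + lit 3 * [ b x ]))
          ≈⟨ E-* μ p _ _ ⟩
        (1# + lit 3 * q) ^ m * E μ p (λ x → 1# + lit 3 * [ b x ])
          ≈⟨ trans (*-congˡ (E-affine 1# (lit 3))) (*-comm _ _) ⟩
        (1# + lit 3 * q) ^ suc m ∎
        where
        open ≈-Reasoning
        factor : ∀ x (xs : Vec A m) → lit 4 ^ count b (x ∷ xs) ≈ (1# + lit 3 * [ b x ]) * lit 4 ^ count b xs
        factor x xs with b x
        ... | true  = solve 1 (λ y → con (+ 4) :* y := (con (+ 1) :+ con (+ 3) :* con (+ 1)) :* y) refl _
        ... | false = solve 1 (λ y → y := (con (+ 1) :+ con (+ 3) :* con (+ 0)) :* y) refl _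

  -- Sampling from classes of elements

  term≤sum : ∀ {n} (f : Vector Carrier n) → (∀ i → 0# ≤ f i) → ∀ i → f i ≤ sum f
  term≤sum {suc n} f 0≤f zero    = ≤-+ (sum-nonNeg {n} (0≤f ∘ suc)) refl
  term≤sum {suc n} f 0≤f (suc i) = ≤-resp (+-identityˡ _) refl (+-mono-≤ (0≤f zero) (term≤sum (f ∘ suc) (0≤f ∘ suc) i))

  sum-delta : ∀ {n} (f : Vector Carrier n) i → sum (λ j → [ does (j Fin.≟ i) ] * f j) ≈ f i
  sum-delta {suc n} f zero = trans (+-cong (*-identityˡ _)
    (trans (sum-cong {n} λ j → zeroˡ (f (suc j))) (sum-replicate-zero n))) (+-identityʳ _)
  sum-delta {suc n} f (suc i) = trans (+-congʳ (zeroˡ _)) (trans (+-identityˡ _) (sum-delta (f ∘ suc) i))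

  toSubset : ∀ {n} → (Fin n → Bool) → Subset n
  toSubset = Vec.tabulate

  does-∈?-toSubset : ∀ {n} (φ : Fin n → Bool) i → does (i ∈? toSubset φ) ≡ φ i
  does-∈?-toSubset φ zero with φ zero
  ... | true  = ≡.refl
  ... | false = ≡.refl
  does-∈?-toSubset φ (suc i) = does-∈?-toSubset (φ ∘ suc) i

  -- The element `i` is a default for the empty class, on which the oracle may not be queried;
  -- `E-draw` concerns classes of positive weight only.
  draw : ∀ {n} → (Fin n → Bool) → Fin n → Prog n (Fin n)
  draw φ i with nonempty? (toSubset φ)
  ... | yes ne = ask (toSubset φ) ne ret
  ... | no  _  = ret i

  draw-cost : ∀ {n} (φ : Fin n → Bool) i → Cost≤ 1 (draw φ i)
  draw-cost φ i with nonempty? (toSubset φ)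
  ... | yes ne = ask λ _ → ret
  ... | no  _  = ret

  weight : ∀ {n} → Distribution n → (Fin n → Bool) → Carrier
  weight μ φ = sum λ i → [ φ i ] * mass μ i

  module _ {n} (μ : Distribution n) where

    weight-term-nonNeg : ∀ (φ : Fin n → Bool) i → 0# ≤ [ φ i ] * mass μ i
    weight-term-nonNeg φ i = *-nonNeg (0≤[] (φ i)) (nonNeg μ i)

    weight-nonNeg : ∀ φ → 0# ≤ weight μ φ
    weight-nonNeg φ = sum-nonNeg {n} (weight-term-nonNeg φ)

    mass≤weight : ∀ φ {i} → φ i ≡ true → mass μ i ≤ weight μ φ
    mass≤weight φ {i} φi = ≤-resp (trans (*-congʳ (reflexive (≡.cong [_] φi))) (*-identityˡ _)) refl
      (term≤sum (λ j → [ φ j ] * mass μ j) (weight-term-nonNeg φ) i)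

    massOf-toSubset : ∀ φ → massOf μ (toSubset φ) ≈ weight μ φ
    massOf-toSubset φ = trans (massOf≈ μ (toSubset φ))
      (sum-cong {n} λ i → *-congʳ (reflexive (≡.cong [_] (does-∈?-toSubset φ i))))

    E-draw : ∀ φ i f → 0# < weight μ φ → weight μ φ * E μ (draw φ i) f ≈ sum λ j → [ φ j ] * mass μ j * f j
    E-draw φ i f 0<w with nonempty? (toSubset φ)
    ... | yes ne = begin
      weight μ φ * sum (λ j → oracle μ S j * f j)
        ≈⟨ *-distribˡ-sum {n} (weight μ φ) (λ j → oracle μ S j * f j) ⟩
      sum (λ j → weight μ φ * (oracle μ S j * f j))
        ≈⟨ sum-cong {n} (λ j → begin
             weight μ φ * (oracle μ S j * f j)
               ≈⟨ *-cong (sym (massOf-toSubset φ)) (*-congʳ (trans (oracle-mass μ 0<M j)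
                    (*-congʳ (*-congʳ (reflexive (≡.cong [_] (does-∈?-toSubset φ j))))))) ⟩
             M * ([ φ j ] * mass μ j * M ⁻¹ * f j)
               ≈⟨ solve 4 (λ m w m⁻¹ f → m :* (w :* m⁻¹ :* f) := m :* m⁻¹ :* (w :* f)) refl M _ (M ⁻¹) (f j) ⟩
             M * M ⁻¹ * ([ φ j ] * mass μ j * f j)
               ≈⟨ trans (*-congʳ (*-inverseʳ (pos⇒≉0 0<M))) (*-identityˡ _) ⟩
             [ φ j ] * mass μ j * f j ∎) ⟩
      sum (λ j → [ φ j ] * mass μ j * f j) ∎
      where
      open ≈-Reasoning
      S = toSubset φ
      M = massOf μ S
      0<M : 0# < M
      0<M = <-≤-trans 0<w (≤.reflexive (sym (massOf-toSubset φ)))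
    ... | no  empty = contradiction
      (trans (sum-cong {n} λ j → trans (*-congʳ (reflexive (≡.cong [_] (outside-φ j)))) (zeroˡ _)) (sum-replicate-zero n))
      (pos⇒≉0 0<w)
      where
      outside-φ : ∀ j → φ j ≡ false
      outside-φ j with j ∈? toSubset φ | does-∈?-toSubset φ j
      ... | yes j∈ | _  = contradiction (j , j∈) empty
      ... | no  _  | eq = ≡.sym eq

  least : ∀ (P : ℕ → Set) n → P n → ∃ λ l → l ℕ.≤ n × P l × (l ≡ 0 ⊎ ∃ λ k → l ≡ suc k × ¬ P k)
  least P zero    p = 0 , ℕ.z≤n , p , inj₁ ≡.refl
  least P (suc n) p with em {P 0}
  ... | yes p₀ = 0 , ℕ.z≤n , p₀ , inj₁ ≡.refl
  ... | no ¬p₀ with least (P ∘ suc) n p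
  ...   | l , l≤n , pl , inj₁ ≡.refl           = suc l , ℕ.s≤s l≤n , pl , inj₂ (0 , ≡.refl , ¬p₀)
  ...   | l , l≤n , pl , inj₂ (k , ≡.refl , ¬pk) = suc l , ℕ.s≤s l≤n , pl , inj₂ (l , ≡.refl , ¬pk)

  1≤^ : ∀ {x} n → 1# ≤ x → 1# ≤ x ^ n
  1≤^ zero    1≤x = ≤.refl
  1≤^ (suc n) 1≤x = ≤-resp (*-identityˡ 1#) refl (*-mono-≤ 0≤1 0≤1 1≤x (1≤^ n 1≤x))

  module _ {ν ρ z h : Carrier} (1≤ν : 1# ≤ ν) (ρν≈ : ρ * ν ≈ ν + 1#) (0≤z : 0# ≤ z) where
    private
      0<ν : 0# < ν
      0<ν = <-≤-trans 0<1 1≤ν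

    -- A relative error of 1 / (2 ν) is allowed because (1 + 1 / ν) (1 - 1 / (2 ν)) = 1 + (ν - 1) /
    -- (2 ν²), which is at least 1 when ν ≥ 1.
    relative-error⇒lower : (lit 2 * ν) * (z - h) ≤ z → z ≤ ρ * h
    relative-error⇒lower close = pos-cancelˡ-≤ (*-pos (*-pos (0<lit 2) 0<ν) 0<ν) (≤-+
      (+-nonNeg (*-nonNeg (≤.trans (proj₁ 0<ν) (≤-+ 0≤1 refl)) (x≤y⇒0≤y-x close)) (*-nonNeg (x≤y⇒0≤y-x 1≤ν) 0≤z))
      (trans (solve 3 (λ n z h → con (+ 2) :* n :* n :* z :+ ((n :+ con (+ 1)) :* (z :- con (+ 2) :* n :* (z :- h)) :+ (n :- con (+ 1)) :* z)
                := con (+ 2) :* n :* ((n :+ con (+ 1)) :* h)) refl ν z h)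
        (trans (*-congˡ (*-congʳ (sym ρν≈))) (solve 3 (λ n r h → con (+ 2) :* n :* (r :* n :* h) := con (+ 2) :* n :* n :* (r :* h)) refl ν ρ h))))

    relative-error⇒upper : (lit 2 * ν) * (h - z) ≤ z → h ≤ ρ * z
    relative-error⇒upper close = pos-cancelˡ-≤ (*-pos (0<lit 2) 0<ν) (≤-+
      (+-nonNeg (x≤y⇒0≤y-x close) 0≤z)
      (trans (solve 3 (λ n z h → con (+ 2) :* n :* h :+ ((z :- con (+ 2) :* n :* (h :- z)) :+ z)
                := con (+ 2) :* ((n :+ con (+ 1)) :* z)) refl ν z h)
        (trans (*-congˡ (*-congʳ (sym ρν≈))) (solve 3 (λ n r h → con (+ 2) :* (r :* n :* h) := con (+ 2) :* n :* (r :* h)) refl ν ρ z))))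

  -- The walk down the halvings of the domain

  -- The leading binary digit of the code; `rest` keeps the remaining digits.
  bit : ∀ {n} t → (Fin n → Fin (2 ℕ.^ suc t)) → Fin n → Fin 2
  bit t c i = proj₁ (remQuot (2 ℕ.^ t) (c i))

  rest : ∀ {n} t → (Fin n → Fin (2 ℕ.^ suc t)) → Fin n → Fin (2 ℕ.^ t)
  rest t c i = proj₂ (remQuot {2} (2 ℕ.^ t) (c i))

  child : ∀ {n} t → (Fin n → Fin (2 ℕ.^ suc t)) → (Fin n → Bool) → Fin 2 → Fin n → Bool
  child t c φ β i = φ i ∧ does (bit t c i Fin.≟ β)

  -- The invariant of the walk. Once all digits are used up, codes lie in `Fin 1`, so a class on
  -- which the code is injective has at most one element.
  InjectiveOn : ∀ {n K} → (Fin n → Bool) → (Fin n → Fin K) → Set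
  InjectiveOn φ c = ∀ {i j} → φ i ≡ true → φ j ≡ true → c i ≡ c j → i ≡ j

  ∧-true : ∀ {a b} → a ∧ b ≡ true → a ≡ true × b ≡ true
  ∧-true {true} {true} _ = ≡.refl , ≡.refl

  does-true : ∀ {A : Set} (a? : Dec A) → does a? ≡ true → A
  does-true (yes a) _ = a

  child-⊆ : ∀ {n} t (c : Fin n → Fin (2 ℕ.^ suc t)) φ β {j} → child t c φ β j ≡ true → φ j ≡ true
  child-⊆ t c φ β {j} ψj = proj₁ (∧-true {φ j} ψj)

  child-injectiveOn : ∀ {n} t {c : Fin n → Fin (2 ℕ.^ suc t)} {φ} → InjectiveOn φ c →
                      ∀ β → InjectiveOn (child t c φ β) (rest t c)
  child-injectiveOn t {c} {φ} inj β {i} {j} ψi ψj rest≡ with ∧-true {φ i} ψi | ∧-true {φ j} ψj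
  ... | φi , bi | φj , bj = inj φi φj (≡.trans (≡.sym (Fin.combine-remQuot {2} (2 ℕ.^ t) (c i)))
    (≡.trans (≡.cong₂ combine (≡.trans (does-true (bit t c i Fin.≟ β) bi) (≡.sym (does-true (bit t c j Fin.≟ β) bj))) rest≡)
      (Fin.combine-remQuot {2} (2 ℕ.^ t) (c j))))

  -- The walk follows the child that contains `i`, which varies with `i`; this rewrites it as a sum
  -- over the two fixed children, so that sums over `i` can be taken child by child.
  sum-child : ∀ {n} t (c : Fin n → Fin (2 ℕ.^ suc t)) φ i (X : Fin 2 → Carrier) →
              [ φ i ] * X (bit t c i) ≈ sum λ β → [ child t c φ β i ] * X β
  sum-child t c φ i X with φ i | bit t c i
  ... | false | β        = solve 3 (λ x y z → con (+ 0) :* x := con (+ 0) :* y :+ (con (+ 0) :* z :+ con (+ 0))) refl _ _ _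
  ... | true  | zero     = solve 2 (λ x y → con (+ 1) :* x := con (+ 1) :* x :+ (con (+ 0) :* y :+ con (+ 0))) refl _ _
  ... | true  | suc zero = solve 2 (λ x y → con (+ 1) :* y := con (+ 0) :* x :+ (con (+ 1) :* y :+ con (+ 0))) refl _ _

  weight-children : ∀ {n} (μ : Distribution n) t (c : Fin n → Fin (2 ℕ.^ suc t)) φ →
                    sum (λ β → weight μ (child t c φ β)) ≈ weight μ φ
  weight-children {n} μ t c φ = trans (∑-comm {2} {n} (λ β i → [ child t c φ β i ] * mass μ i))
    (sum-cong {n} λ i → sym (sum-child t c φ i (λ _ → mass μ i)))

  -- An element i of the class φ is reached from φ by t halvings of the class, according to the digits
  -- of c i. The output l of the walk is meant to satisfy ρ ^ l ≈ μ(φ) / μ(i): in each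
  -- halving, ρ ^ scale h ≈ m / h rounds the inverse of the fraction of m samples from the
  -- current class that fell into the next one.
  module Walk (N m L₁ : ℕ) .{{_ : NonZero N}} .{{_ : NonZero m}} where

    ρ : Carrier
    ρ = 1# + fromℕ N ⁻¹

    private
      ν : Carrier
      ν = fromℕ N

    1≤ρ : 1# ≤ ρ
    1≤ρ = ≤-+ (⁻¹-nonNeg (0<fromℕ N)) refl

    0≤ρ : 0# ≤ ρ
    0≤ρ = ≤.trans 0≤1 1≤ρ

    ρν≈ν+1 : ρ * ν ≈ ν + 1#
    ρν≈ν+1 = trans (solve 2 (λ n n⁻¹ → (con (+ 1) :+ n⁻¹) :* n := n :+ n :* n⁻¹) refl ν (ν ⁻¹))
      (+-congˡ (*-inverseʳ (fromℕ≉0 N)))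

    RoundsTo : ℕ → ℕ → Set
    RoundsTo h l = l ℕ.≤ L₁ × fromℕ m ≤ fromℕ h * ρ ^ l × fromℕ h * ρ ^ l ≤ ρ * fromℕ m

    -- For `h` = 0 no exponent fits, and the value 0 is arbitrary: such a count is a misestimation
    -- whenever the next class has positive weight.
    scale : ℕ → ℕ
    scale h with em {∃ (RoundsTo h)}
    ... | yes (l , _) = l
    ... | no  _       = 0

    walk : ∀ {n} t → (Fin n → Fin (2 ℕ.^ t)) → (Fin n → Bool) → Fin n → Prog n ℕ
    walk zero    c φ i = ret 0
    walk (suc t) c φ i = repeatᴾ m (draw φ i) >>= λ js →
      mapᴾ (λ r → scale (count ψ js) ℕ.+ r) (walk t (rest t c) ψ i)
      where ψ = child t c φ (bit t c i)

    walk-cost : ∀ {n} t (c : Fin n → Fin (2 ℕ.^ t)) φ i → Cost≤ (t ℕ.* m) (walk t c φ i)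
    walk-cost zero    c φ i = ret
    walk-cost (suc t) c φ i = >>=-cost
      (≡.subst (λ k → Cost≤ k (repeatᴾ m (draw φ i))) (ℕ.*-identityʳ m) (repeatᴾ-cost m (draw-cost φ i)))
      λ js → mapᴾ-cost (walk-cost t (rest t c) _ i)

    -- Each halving may lose one factor `ρ` by sampling and one by rounding to a power of `ρ`.
    κ : ℕ → Carrier
    κ t = (ρ * ρ) ^ t

    0≤κ : ∀ t → 0# ≤ κ t
    0≤κ t = ^-nonNeg t (*-nonNeg 0≤ρ 0≤ρ)

    Good : ∀ {n} → Distribution n → ℕ → (Fin n → Bool) → Fin n → ℕ → Set
    Good μ t φ i l = l ℕ.≤ t ℕ.* L₁
                   × weight μ φ ≤ κ t * (mass μ i * ρ ^ l)
                   × mass μ i * ρ ^ l ≤ κ t * weight μ φ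

    module _ (m≤ρ^L₁ : fromℕ m ≤ ρ ^ L₁) where

      -- The least exponent `l` with m ≤ h ρ ^ l works: if `l` is positive, minimality gives the
      -- upper bound, and if `l` is 0, the assumption h ≤ ρ m does.
      scale-rounds : ∀ h → 1# ≤ fromℕ h → fromℕ h ≤ ρ * fromℕ m → RoundsTo h (scale h)
      scale-rounds h 1≤h h≤ρm with em {∃ (RoundsTo h)}
      ... | yes (_ , rounds) = rounds
      ... | no  none = contradiction (exists (least (λ l → fromℕ m ≤ fromℕ h * ρ ^ l) L₁ m≤hρ^L₁)) none
        where
        m≤hρ^L₁ : fromℕ m ≤ fromℕ h * ρ ^ L₁
        m≤hρ^L₁ = ≤.trans m≤ρ^L₁ (≤-resp (*-identityˡ _) refl (*-monoˡ-≤ (^-nonNeg L₁ 0≤ρ) 1≤h))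
        exists : (∃ λ l → l ℕ.≤ L₁ × fromℕ m ≤ fromℕ h * ρ ^ l ×
                   (l ≡ 0 ⊎ ∃ λ k → l ≡ suc k × ¬ (fromℕ m ≤ fromℕ h * ρ ^ k))) → ∃ (RoundsTo h)
        exists (l , l≤L₁ , m≤ , inj₁ ≡.refl) = l , l≤L₁ , m≤ , ≤-resp (sym (*-identityʳ _)) refl h≤ρm
        exists (l , l≤L₁ , m≤ , inj₂ (k , ≡.refl , m≰)) = l , l≤L₁ , m≤ , (begin
          fromℕ h * (ρ * ρ ^ k)  ≈⟨ solve 3 (λ h r s → h :* (r :* s) := r :* (h :* s)) refl _ _ _ ⟩
          ρ * (fromℕ h * ρ ^ k)  ≤⟨ *-monoʳ-≤ 0≤ρ (≰⇒≥ m≰) ⟩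
          ρ * fromℕ m            ∎)
          where open ≤-Reasoning

      module _ {n} (μ : Distribution n) where

        -- The ratio μ(φ) / μ(ψ) = 1 / q is compared with m / h, up to a factor `ρ` either way, and
        -- m / h with ρ ^ `scale h`, which exceeds it by at most a factor `ρ`. The remaining factor
        -- μ(ψ) / μ(i) is estimated by `r`.
        good-step : ∀ t {φ ψ i h r q} →
          0# < weight μ φ → weight μ φ * q ≈ weight μ ψ → 0# ≤ q → q ≤ 1# →
          0# < fromℕ m * q → fromℕ m * q ≤ ρ * fromℕ h → fromℕ h ≤ ρ * (fromℕ m * q) →
          Good μ t ψ i r → Good μ (suc t) φ i (scale h ℕ.+ r)
        good-step t {φ} {ψ} {i} {h} {r} {q} 0<y yq≈x 0≤q q≤1 0<mq mq≤ρh h≤ρmq (r≤ , x≤ , ≤x) =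
          add-bound (scale-rounds h 1≤h h≤ρm)
          where
          open ≤-Reasoning
          y = weight μ φ
          x = weight μ ψ
          H = fromℕ h
          M = fromℕ m
          R = ρ ^ scale h
          a = mass μ i
          0<M : 0# < M
          0<M = 0<fromℕ m
          1≤h : 1# ≤ H
          1≤h = positive h mq≤ρh
            where
            positive : ∀ h → M * q ≤ ρ * fromℕ h → 1# ≤ fromℕ h
            positive zero    mq≤0 = contradiction (≤-resp refl (zeroʳ ρ) mq≤0) (<-irrefl 0<mq)
            positive (suc h) _    = 1≤fromℕ (suc h)
          h≤ρm : H ≤ ρ * M
          h≤ρm = ≤.trans h≤ρmq (*-monoʳ-≤ 0≤ρ (≤-resp refl (*-identityʳ M) (*-monoʳ-≤ (proj₁ 0<M) q≤1)))
          0≤R : 0# ≤ R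
          0≤R = ^-nonNeg (scale h) 0≤ρ
          y≤ρRx : M ≤ H * R → y ≤ ρ * (R * x)
          y≤ρRx M≤HR = pos-cancelˡ-≤ 0<M (begin
            M * y                    ≤⟨ *-monoˡ-≤ (proj₁ 0<y) M≤HR ⟩
            H * R * y                ≤⟨ *-monoˡ-≤ (proj₁ 0<y) (*-monoˡ-≤ 0≤R h≤ρmq) ⟩
            ρ * (M * q) * R * y      ≈⟨ solve 5 (λ ρ M q R y → ρ :* (M :* q) :* R :* y := M :* (ρ :* (R :* (y :* q)))) refl ρ M q R y ⟩
            M * (ρ * (R * (y * q)))  ≈⟨ *-congˡ (*-congˡ (*-congˡ yq≈x)) ⟩
            M * (ρ * (R * x))        ∎)
          xR≤ρρy : H * R ≤ ρ * M → x * R ≤ ρ * ρ * y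
          xR≤ρρy HR≤ρM = pos-cancelˡ-≤ 0<M (begin
            M * (x * R)        ≈⟨ *-congˡ (*-congʳ (sym yq≈x)) ⟩
            M * (y * q * R)    ≈⟨ solve 4 (λ M y q R → M :* (y :* q :* R) := M :* q :* (R :* y)) refl M y q R ⟩
            M * q * (R * y)    ≤⟨ *-monoˡ-≤ (*-nonNeg 0≤R (proj₁ 0<y)) mq≤ρh ⟩
            ρ * H * (R * y)    ≈⟨ solve 4 (λ ρ H R y → ρ :* H :* (R :* y) := ρ :* (H :* R) :* y) refl ρ H R y ⟩
            ρ * (H * R) * y    ≤⟨ *-monoˡ-≤ (proj₁ 0<y) (*-monoʳ-≤ 0≤ρ HR≤ρM) ⟩
            ρ * (ρ * M) * y    ≈⟨ solve 3 (λ ρ M y → ρ :* (ρ :* M) :* y := M :* (ρ :* ρ :* y)) refl ρ M y ⟩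
            M * (ρ * ρ * y)    ∎)
          0≤κaρ^ : 0# ≤ κ t * (a * ρ ^ r)
          0≤κaρ^ = *-nonNeg (0≤κ t) (*-nonNeg (nonNeg μ i) (^-nonNeg r 0≤ρ))
          add-bound : RoundsTo h (scale h) → Good μ (suc t) φ i (scale h ℕ.+ r)
          add-bound (l≤ , M≤HR , HR≤ρM) = ℕ.+-mono-≤ l≤ r≤ , (begin
            y                                       ≤⟨ y≤ρRx M≤HR ⟩
            ρ * (R * x)                             ≤⟨ *-monoʳ-≤ 0≤ρ (*-monoʳ-≤ 0≤R x≤) ⟩
            ρ * (R * (κ t * (a * ρ ^ r)))           ≈⟨ sym (*-identityˡ _) ⟩
            -- Rounding is upwards, so only the sampling error costs a factor here; the second one
            -- is padding up to `κ (suc t)`.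
            1# * (ρ * (R * (κ t * (a * ρ ^ r))))    ≤⟨ *-monoˡ-≤ (*-nonNeg 0≤ρ (*-nonNeg 0≤R 0≤κaρ^)) 1≤ρ ⟩
            ρ * (ρ * (R * (κ t * (a * ρ ^ r))))     ≈⟨ solve 5 (λ ρ R k a s → ρ :* (ρ :* (R :* (k :* (a :* s)))) := ρ :* ρ :* k :* (a :* (R :* s))) refl ρ R (κ t) a (ρ ^ r) ⟩
            κ (suc t) * (a * (R * ρ ^ r))           ≈⟨ *-congˡ (*-congˡ (sym (^-homo-* ρ (scale h) r))) ⟩
            κ (suc t) * (a * ρ ^ (scale h ℕ.+ r))   ∎) , (begin
            a * ρ ^ (scale h ℕ.+ r)                 ≈⟨ *-congˡ (^-homo-* ρ (scale h) r) ⟩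
            a * (R * ρ ^ r)                         ≈⟨ solve 3 (λ a R s → a :* (R :* s) := a :* s :* R) refl a R (ρ ^ r) ⟩
            a * ρ ^ r * R                           ≤⟨ *-monoˡ-≤ 0≤R ≤x ⟩
            κ t * x * R                             ≈⟨ *-assoc _ _ _ ⟩
            κ t * (x * R)                           ≤⟨ *-monoʳ-≤ (0≤κ t) (xR≤ρρy HR≤ρM) ⟩
            κ t * (ρ * ρ * y)                       ≈⟨ solve 3 (λ k s y → k :* (s :* y) := s :* k :* y) refl (κ t) (ρ * ρ) y ⟩
            κ (suc t) * y                           ∎)

  -- Error probability of the walk

  markov : ∀ {n A} (μ : Distribution n) (p : Prog n A) {X : A → Carrier} s → (∀ a → 0# ≤ X a) →
           s * E μ p (λ a → 𝟙 (¬ (X a ≤ s))) ≤ E μ p X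
  markov μ p {X} s 0≤X = ≤-resp (E-* μ p s _) refl (E-mono μ p bound)
    where
    bound : ∀ a → s * 𝟙 (¬ (X a ≤ s)) ≤ X a
    bound a with em {¬ (X a ≤ s)}
    ... | yes X≰s = ≤-resp (sym (*-identityʳ s)) refl (≰⇒≥ X≰s)
    ... | no  _   = ≤-resp (sym (zeroʳ s)) refl (0≤X a)

  module WalkError (N m L₁ : ℕ) .{{_ : NonZero N}} .{{_ : NonZero m}}
                   (m≤ρ^L₁ : fromℕ m ≤ Walk.ρ N m L₁ ^ L₁) {n : ℕ} (μ : Distribution n) where
    open Walk N m L₁

    d : Carrier
    d = lit 2 * fromℕ N

    -- The count `h` has relative error at most 1 / `d` from its mean `z`; in squared form this is
    -- the event that Markov's inequality controls through the variance.
    Close : Carrier → Carrier → Set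
    Close z h = (d * d) * ((h - z) * (h - z)) ≤ z * z

    close-lower : ∀ {z h} → 0# ≤ z → Close z h → z ≤ ρ * h
    close-lower {z} {h} 0≤z close = relative-error⇒lower (1≤fromℕ N) ρν≈ν+1 0≤z
      (square-≤⇒≤ 0≤z (≤-resp (solve 3 (λ d h z → d :* d :* ((h :- z) :* (h :- z)) := d :* (z :- h) :* (d :* (z :- h))) refl d h z) refl close))

    close-upper : ∀ {z h} → 0# ≤ z → Close z h → h ≤ ρ * z
    close-upper {z} {h} 0≤z close = relative-error⇒upper (1≤fromℕ N) ρν≈ν+1 0≤z
      (square-≤⇒≤ 0≤z (≤-resp (solve 3 (λ d h z → d :* d :* ((h :- z) :* (h :- z)) := d :* (h :- z) :* (d :* (h :- z))) refl d h z) refl close))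

    fraction : (φ ψ : Fin n → Bool) → Fin n → Carrier
    fraction φ ψ i = E μ (draw φ i) λ j → [ ψ j ]

    misestimation : (φ ψ : Fin n → Bool) → Fin n → Carrier
    misestimation φ ψ i = E μ (repeatᴾ m (draw φ i)) λ js →
      𝟙 (¬ Close (fromℕ m * fraction φ ψ i) (fromℕ (count ψ js)))

    misestimation≤1 : ∀ φ ψ i → misestimation φ ψ i ≤ 1#
    misestimation≤1 φ ψ i = ≤-resp refl (E-const μ (repeatᴾ m (draw φ i)) 1#) (E-mono μ (repeatᴾ m (draw φ i)) λ _ → 𝟙≤1)

    0<m : 0# < fromℕ m
    0<m = 0<fromℕ m

    0≤dd : 0# ≤ d * d
    0≤dd = x²-nonNeg d

    module _ {φ ψ : Fin n → Bool} (ψ⊆φ : ∀ {j} → ψ j ≡ true → φ j ≡ true) (0<x : 0# < weight μ ψ) where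

      [φ]*[ψ] : ∀ j → [ φ j ] * [ ψ j ] ≈ [ ψ j ]
      [φ]*[ψ] j with ψ j in ψj
      ... | false = zeroʳ _
      ... | true  = trans (*-identityʳ _) (reflexive (≡.cong [_] (ψ⊆φ ψj)))

      ψ≤φ : weight μ ψ ≤ weight μ φ
      ψ≤φ = sum-mono {n} λ j → *-monoˡ-≤ (nonNeg μ j) (≤-resp ([φ]*[ψ] j) (*-identityʳ _) (*-monoʳ-≤ (0≤[] (φ j)) ([]≤1 (ψ j))))

      0<φ : 0# < weight μ φ
      0<φ = <-≤-trans 0<x ψ≤φ

      weight*fraction : ∀ i → weight μ φ * fraction φ ψ i ≈ weight μ ψ
      weight*fraction i = trans (E-draw μ φ i _ 0<φ) (sum-cong {n} λ j →
        trans (solve 3 (λ a m b → a :* m :* b := a :* b :* m) refl _ _ _) (*-congʳ ([φ]*[ψ] j)))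

      0<fraction : ∀ i → 0# < fraction φ ψ i
      0<fraction i = E-nonNeg μ (draw φ i) (λ j → 0≤[] (ψ j)) , λ 0≈q →
        pos⇒≉0 0<x (trans (sym (weight*fraction i)) (trans (*-congˡ (sym 0≈q)) (zeroʳ _)))

      fraction≤1 : ∀ i → fraction φ ψ i ≤ 1#
      fraction≤1 i = ≤-resp refl (E-const μ (draw φ i) 1#) (E-mono μ (draw φ i) λ j → []≤1 (ψ j))

      -- Chebyshev's inequality: the variance is at most `z` and the allowed squared error is z² /
      -- d², so the failure probability is at most d² / z, where z = m μ(ψ) / μ(φ).
      misestimation-bound : ∀ i → fromℕ m * (weight μ ψ * misestimation φ ψ i) ≤ (d * d) * weight μ φ
      misestimation-bound i = begin
        fromℕ m * (weight μ ψ * F)           ≈⟨ *-congˡ (*-congʳ (sym (weight*fraction i))) ⟩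
        fromℕ m * (weight μ φ * q * F)       ≈⟨ solve 4 (λ m y q F → m :* (y :* q :* F) := m :* q :* F :* y) refl _ _ _ _ ⟩
        z * F * weight μ φ                   ≤⟨ *-monoˡ-≤ (proj₁ 0<φ) zF≤dd ⟩
        d * d * weight μ φ ∎
        where
        open ≤-Reasoning
        q = fraction φ ψ i
        z = fromℕ m * q
        F = misestimation φ ψ i
        0<z : 0# < z
        0<z = *-pos 0<m (0<fraction i)
        zF≤dd : z * F ≤ d * d
        zF≤dd = pos-cancelˡ-≤ 0<z (begin
          z * (z * F)
            ≈⟨ sym (*-assoc _ _ _) ⟩
          z * z * F
            ≤⟨ markov μ (repeatᴾ m (draw φ i)) (z * z) (λ js → *-nonNeg 0≤dd (x²-nonNeg _)) ⟩
          E μ (repeatᴾ m (draw φ i)) (λ js → (d * d) * ((fromℕ (count ψ js) - z) * (fromℕ (count ψ js) - z)))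
            ≈⟨ E-* μ (repeatᴾ m (draw φ i)) (d * d) _ ⟩
          (d * d) * E μ (repeatᴾ m (draw φ i)) (λ js → (fromℕ (count ψ js) - z) * (fromℕ (count ψ js) - z))
            ≤⟨ *-monoʳ-≤ 0≤dd (variance μ (draw φ i) ψ m) ⟩
          (d * d) * z
            ≈⟨ *-comm _ _ ⟩
          z * (d * d) ∎)

    -- Weighting by μ(i) and summing over ψ multiplies the Chebyshev bound by μ(ψ), which cancels
    -- its denominator. For a class of weight zero the sum itself vanishes.
    misestimated-mass : ∀ {φ ψ} → (∀ {j} → ψ j ≡ true → φ j ≡ true) →
      fromℕ m * sum (λ i → [ ψ i ] * (mass μ i * misestimation φ ψ i)) ≤ (d * d) * weight μ φ
    misestimated-mass {φ} {ψ} ψ⊆φ with em {0# < weight μ ψ}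
    ... | no 0≮x = ≤.trans (*-monoʳ-≤ (proj₁ 0<m) Σ≤0)
      (≤-resp (sym (zeroʳ _)) refl (*-nonNeg 0≤dd (weight-nonNeg μ φ)))
      where
      Σ≤0 : sum (λ i → [ ψ i ] * (mass μ i * misestimation φ ψ i)) ≤ 0#
      Σ≤0 = ≤.trans
        (sum-mono {n} λ i → *-monoʳ-≤ (0≤[] (ψ i))
          (≤-resp refl (*-identityʳ _) (*-monoʳ-≤ (nonNeg μ i) (misestimation≤1 φ ψ i))))
        (decidable-stable em λ x≰0 → 0≮x (≰⇒> x≰0))
    ... | yes 0<x = pos-cancelˡ-≤ 0<x (begin
      weight μ ψ * (fromℕ m * sum term)
        ≈⟨ solve 3 (λ x m s → x :* (m :* s) := m :* x :* s) refl _ _ _ ⟩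
      fromℕ m * weight μ ψ * sum term
        ≈⟨ *-distribˡ-sum {n} (fromℕ m * weight μ ψ) term ⟩
      sum (λ i → fromℕ m * weight μ ψ * term i)
        ≈⟨ sum-cong {n} (λ i → solve 5 (λ m x c a F → m :* x :* (c :* (a :* F)) := c :* a :* (m :* (x :* F))) refl _ _ _ _ _) ⟩
      sum (λ i → [ ψ i ] * mass μ i * (fromℕ m * (weight μ ψ * misestimation φ ψ i)))
        ≤⟨ sum-mono {n} (λ i → *-monoʳ-≤ (weight-term-nonNeg μ ψ i) (misestimation-bound ψ⊆φ 0<x i)) ⟩
      sum (λ i → [ ψ i ] * mass μ i * ((d * d) * weight μ φ))
        ≈⟨ sym (*-distribʳ-sum {n} ((d * d) * weight μ φ) λ i → [ ψ i ] * mass μ i) ⟩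
      weight μ ψ * ((d * d) * weight μ φ) ∎)
      where
      open ≤-Reasoning
      term : Vector Carrier n
      term i = [ ψ i ] * (mass μ i * misestimation φ ψ i)

    badness : ∀ t → (Fin n → Fin (2 ℕ.^ t)) → (Fin n → Bool) → Fin n → Carrier
    badness t c φ i = E μ (walk t c φ i) λ r → 𝟙 (¬ Good μ t φ i r)

    -- A bad outcome requires a misestimation in this halving or a bad continuation. The factor μ(i)
    -- disposes of elements of mass zero, whose child class may have weight zero and then has no
    -- meaningful ratio to estimate.
    badness-step : ∀ t c {φ i} → φ i ≡ true → let ψ = child t c φ (bit t c i) in
      mass μ i * badness (suc t) c φ i ≤ mass μ i * (misestimation φ ψ i + badness t (rest t c) ψ i)
    badness-step t c {φ} {i} φi with em {0# ≈ mass μ i}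
    ... | yes 0≈μᵢ = ≤.reflexive (trans (*-congʳ (sym 0≈μᵢ)) (trans (zeroˡ _) (sym (trans (*-congʳ (sym 0≈μᵢ)) (zeroˡ _)))))
    ... | no  0≉μᵢ = *-monoʳ-≤ (nonNeg μ i) (begin
      E μ (walk (suc t) c φ i) (λ r → 𝟙 (¬ Good μ (suc t) φ i r))
        ≈⟨ trans (E->>= μ sample _ _) (E-cong μ sample λ js → E-mapᴾ μ continue _ _) ⟩
      E μ sample (λ js → E μ continue λ r → 𝟙 (¬ Good μ (suc t) φ i (scale (count ψ js) ℕ.+ r)))
        ≤⟨ E-mono μ sample (λ js → E-mono μ continue (union js)) ⟩
      E μ sample (λ js → E μ continue λ r → 𝟙 (¬ Close z (fromℕ (count ψ js))) + 𝟙 (¬ Good μ t ψ i r))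
        ≈⟨ E-cong μ sample (λ js → trans (E-+ μ continue _ _) (+-congʳ (E-const μ continue _))) ⟩
      E μ sample (λ js → 𝟙 (¬ Close z (fromℕ (count ψ js))) + badness t (rest t c) ψ i)
        ≈⟨ trans (E-+ μ sample _ _) (+-congˡ (E-const μ sample _)) ⟩
      misestimation φ ψ i + badness t (rest t c) ψ i ∎)
      where
      open ≤-Reasoning
      ψ = child t c φ (bit t c i)
      sample = repeatᴾ m (draw φ i)
      continue = walk t (rest t c) ψ i
      z = fromℕ m * fraction φ ψ i
      ψ⊆φ : ∀ {j} → ψ j ≡ true → φ j ≡ true
      ψ⊆φ = child-⊆ t c φ (bit t c i)
      ψi : ψ i ≡ true
      ψi = ≡.cong₂ _∧_ φi (dec-true (bit t c i Fin.≟ bit t c i) ≡.refl)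
      0<x : 0# < weight μ ψ
      0<x = <-≤-trans (nonNeg μ i , 0≉μᵢ) (mass≤weight μ ψ ψi)
      0<q = 0<fraction ψ⊆φ 0<x i
      0<z : 0# < z
      0<z = *-pos 0<m 0<q
      union : ∀ js r → 𝟙 (¬ Good μ (suc t) φ i (scale (count ψ js) ℕ.+ r))
                       ≤ 𝟙 (¬ Close z (fromℕ (count ψ js))) + 𝟙 (¬ Good μ t ψ i r)
      union js r with em {Close z (fromℕ (count ψ js))} | em {Good μ t ψ i r}
      ... | no ¬close | _ = ≤.trans 𝟙≤1 (≤-+ 0≤𝟙 (+-congʳ (sym (𝟙-true ¬close))))
      ... | yes _ | no ¬good = ≤.trans 𝟙≤1 (≤-+ 0≤𝟙 (trans (+-comm _ _) (+-congˡ (sym (𝟙-true ¬good)))))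
      ... | yes close | yes good = ≤.trans (≤.reflexive (𝟙-false λ ¬good → ¬good
        (good-step m≤ρ^L₁ μ t {φ} {ψ} {i} {count ψ js} (0<φ ψ⊆φ 0<x) (weight*fraction ψ⊆φ 0<x i) (proj₁ 0<q) (fraction≤1 ψ⊆φ 0<x i)
          0<z (close-lower (proj₁ 0<z) close) (close-upper (proj₁ 0<z) close) good)))
        (+-nonNeg 0≤𝟙 0≤𝟙)

    -- Chebyshev's inequality bounds the probability of a misestimation by d² μ(φ) / (m μ(ψ)), which is
    -- useless for a light child ψ. But averaged over i ∈ φ it is at most 2 d² / m, since each of the
    -- two children ψ contributes μ(ψ) · μ(φ) / μ(ψ).
    bad-mass : ∀ t c {φ} → InjectiveOn φ c →
      fromℕ m * sum (λ i → [ φ i ] * (mass μ i * badness t c φ i)) ≤ fromℕ t * (lit 2 * (d * d) * weight μ φ)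
    bad-mass zero c {φ} inj = ≤.reflexive (trans (*-congˡ (trans (sum-cong {n} vanishes) (sum-replicate-zero n)))
      (trans (zeroʳ _) (sym (zeroˡ _))))
      where
      Fin1-unique : ∀ (x y : Fin 1) → x ≡ y
      Fin1-unique zero zero = ≡.refl
      weight≈ : ∀ {i} → φ i ≡ true → weight μ φ ≈ mass μ i
      weight≈ {i} φi = trans (sum-cong {n} λ j → *-congʳ (reflexive (≡.cong [_] (singleton j)))) (sum-delta (mass μ) i)
        where
        singleton : ∀ j → φ j ≡ does (j Fin.≟ i)
        singleton j with φ j in φj | j Fin.≟ i
        ... | true  | yes _      = ≡.refl
        ... | true  | no  j≢i    = contradiction (inj φj φi (Fin1-unique _ _)) j≢i
        ... | false | yes ≡.refl = ≡.trans (≡.sym φj) φi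
        ... | false | no  _      = ≡.refl
      vanishes : ∀ i → [ φ i ] * (mass μ i * badness zero c φ i) ≈ 0#
      vanishes i with φ i in φi
      ... | false = zeroˡ _
      ... | true  = trans (*-identityˡ _) (trans (*-congˡ (𝟙-false λ ¬good → ¬good
        (ℕ.z≤n , ≤.reflexive (trans (weight≈ φi) (sym (trans (*-identityˡ _) (*-identityʳ _))))
               , ≤.reflexive (trans (*-identityʳ _) (sym (trans (*-identityˡ _) (weight≈ φi))))))) (zeroʳ _))
    bad-mass (suc t) c {φ} inj = begin
      fromℕ m * sum (λ i → [ φ i ] * (mass μ i * badness (suc t) c φ i))
        ≤⟨ *-monoʳ-≤ (proj₁ 0<m) (sum-mono {n} pointwise) ⟩
      fromℕ m * sum (λ i → sum λ β → mis β i + bad β i)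
        ≈⟨ *-congˡ (∑-comm {n} {2} λ i β → mis β i + bad β i) ⟩
      fromℕ m * sum (λ β → sum λ i → mis β i + bad β i)
        ≈⟨ *-distribˡ-sum {2} (fromℕ m) (λ β → sum λ i → mis β i + bad β i) ⟩
      sum {2} (λ β → fromℕ m * sum λ i → mis β i + bad β i)
        ≈⟨ sum-cong {2} split ⟩
      sum {2} (λ β → fromℕ m * sum (mis β) + fromℕ m * sum (bad β))
        ≤⟨ sum-mono {2} (λ β → +-mono-≤ (misestimated-mass {φ} {ψ β} (λ {j} → child-⊆ t c φ β {j}))
             (bad-mass t (rest t c) (child-injectiveOn t inj β))) ⟩
      sum {2} (λ β → (d * d) * weight μ φ + fromℕ t * (lit 2 * (d * d) * weight μ (ψ β)))
        ≈⟨ solve 5 (λ D y t u v → (D :* y :+ t :* (con (+ 2) :* D :* u)) :+ ((D :* y :+ t :* (con (+ 2) :* D :* v)) :+ con (+ 0))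
             := con (+ 2) :* D :* y :+ t :* (con (+ 2) :* D :* (u :+ (v :+ con (+ 0))))) refl _ _ _ _ _ ⟩
      lit 2 * (d * d) * weight μ φ + fromℕ t * (lit 2 * (d * d) * sum {2} (λ β → weight μ (ψ β)))
        ≈⟨ +-congˡ (*-congˡ (*-congˡ (weight-children μ t c φ))) ⟩
      lit 2 * (d * d) * weight μ φ + fromℕ t * (lit 2 * (d * d) * weight μ φ)
        ≈⟨ solve 2 (λ x t → x :+ t :* x := (con (+ 1) :+ t) :* x) refl _ _ ⟩
      fromℕ (suc t) * (lit 2 * (d * d) * weight μ φ) ∎
      where
      open ≤-Reasoning
      ψ : Fin 2 → Fin n → Bool
      ψ β = child t c φ β
      mis bad : Fin 2 → Vector Carrier n
      mis β i = [ ψ β i ] * (mass μ i * misestimation φ (ψ β) i)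
      bad β i = [ ψ β i ] * (mass μ i * badness t (rest t c) (ψ β) i)
      split : ∀ β → fromℕ m * sum (λ i → mis β i + bad β i) ≈ fromℕ m * sum (mis β) + fromℕ m * sum (bad β)
      split β = trans (*-congˡ (∑-distrib-+ {n} (mis β) (bad β))) (distribˡ _ _ _)
      pointwise : ∀ i → [ φ i ] * (mass μ i * badness (suc t) c φ i) ≤ sum λ β → mis β i + bad β i
      pointwise i = ≤.trans on-φ (≤.reflexive (trans
        (sum-child t c φ i λ β → mass μ i * (misestimation φ (ψ β) i + badness t (rest t c) (ψ β) i))
        (sum-cong {2} expand)))
        where
        expand : ∀ β → [ ψ β i ] * (mass μ i * (misestimation φ (ψ β) i + badness t (rest t c) (ψ β) i)) ≈ mis β i + bad β i
        expand β = trans (*-congˡ (distribˡ _ _ _)) (distribˡ _ _ _)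
        on-φ : [ φ i ] * (mass μ i * badness (suc t) c φ i) ≤
               [ φ i ] * (mass μ i * (misestimation φ (ψ (bit t c i)) i + badness t (rest t c) (ψ (bit t c i)) i))
        on-φ with φ i in φi
        ... | false = ≤.reflexive (trans (zeroˡ _) (sym (zeroˡ _)))
        ... | true  = *-monoʳ-≤ 0≤1 (badness-step t c φi)

  -- Distance and overlap

  abs-⊓ : ∀ a b → abs (a - b) + lit 2 * (a ⊓ b) ≈ a + b
  abs-⊓ a b = by-total (≤.total a b)
    where
    by-total : a ≤ b ⊎ b ≤ a → abs (a - b) + lit 2 * (a ⊓ b) ≈ a + b
    by-total (inj₁ a≤b) = trans (+-cong
      (x≤y⇒x⊔y≈y (≤-+ (+-nonNeg (x≤y⇒0≤y-x a≤b) (x≤y⇒0≤y-x a≤b))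
        (solve 2 (λ a b → (a :- b) :+ ((b :- a) :+ (b :- a)) := :- (a :- b)) refl a b)))
      (*-congˡ (x≤y⇒x⊓y≈x a≤b)))
      (solve 2 (λ a b → :- (a :- b) :+ con (+ 2) :* a := a :+ b) refl a b)
    by-total (inj₂ b≤a) = trans (+-cong
      (x≤y⇒y⊔x≈y (≤-+ (+-nonNeg (x≤y⇒0≤y-x b≤a) (x≤y⇒0≤y-x b≤a))
        (solve 2 (λ a b → :- (a :- b) :+ ((a :- b) :+ (a :- b)) := a :- b) refl a b)))
      (*-congˡ (x≤y⇒y⊓x≈x b≤a)))
      (solve 2 (λ a b → a :- b :+ con (+ 2) :* b := a :+ b) refl a b)

  ½*2≈1 : ½ * lit 2 ≈ 1#
  ½*2≈1 = trans (*-congˡ (sym (fromℕ≈lit 2))) (trans (*-comm _ _) (*-inverseʳ (fromℕ≉0 2)))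

  abs-cong : ∀ {x y} → x ≈ y → abs x ≈ abs y
  abs-cong x≈y = ⊔-cong x≈y (-‿cong x≈y)

  distance+overlap≈1 : ∀ {n} (μ ν : Distribution n) → distance μ ν + sum (λ i → mass μ i ⊓ mass ν i) ≈ 1#
  distance+overlap≈1 {n} μ ν = begin
    ½ * D + O
      ≈⟨ +-congˡ (trans (sym (*-identityˡ O)) (*-congʳ (sym ½*2≈1))) ⟩
    ½ * D + ½ * lit 2 * O
      ≈⟨ solve 4 (λ h D t O → h :* D :+ h :* t :* O := h :* (D :+ t :* O)) refl ½ D (lit 2) O ⟩
    ½ * (D + lit 2 * O)
      ≈⟨ *-congˡ (+-congˡ (*-distribˡ-sum {n} (lit 2) λ i → mass μ i ⊓ mass ν i)) ⟩
    ½ * (D + sum (λ i → lit 2 * (mass μ i ⊓ mass ν i)))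
      ≈⟨ *-congˡ (sym (∑-distrib-+ {n} (λ i → abs (mass μ i - mass ν i)) (λ i → lit 2 * (mass μ i ⊓ mass ν i)))) ⟩
    ½ * sum (λ i → abs (mass μ i - mass ν i) + lit 2 * (mass μ i ⊓ mass ν i))
      ≈⟨ *-congˡ (trans (sum-cong {n} λ i → abs-⊓ (mass μ i) (mass ν i)) (∑-distrib-+ (mass μ) (mass ν))) ⟩
    ½ * (sum (mass μ) + sum (mass ν))
      ≈⟨ *-congˡ (+-cong (total μ) (total ν)) ⟩
    ½ * (1# + 1#)
      ≈⟨ ½*2≈1 ⟩
    1# ∎
    where
    open ≈-Reasoning
    D = sum λ i → abs (mass μ i - mass ν i)
    O = sum λ i → mass μ i ⊓ mass ν i

  -- A common relabelling preserves distance, so the sorting of `μ` can be undone at the expense of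
  -- `ν`.
  distance-align : ∀ {n} (μ ν : Distribution n) (σ τ : Permutation′ n) →
                   distance μ (relabel (Perm.flip σ ∘ₚ τ) ν) ≈ distance (relabel σ μ) (relabel τ ν)
  distance-align {n} μ ν σ τ = *-congˡ (trans
    (sum-permute (λ i → abs (mass μ i - mass ν (τ ⟨$⟩ʳ (σ ⟨$⟩ˡ i)))) σ)
    (sum-cong {n} λ j → abs-cong (+-congˡ (-‿cong (reflexive (≡.cong (λ k → mass ν (τ ⟨$⟩ʳ k)) (Perm.inverseˡ σ)))))))

  -- The induction uses (1 + x) (1 - (j + 1) x) = 1 - j x - (j + 1) x². With x = 1 / N and j = 4 T
  -- it turns the multiplicative loss in the overlap into an additive one.
  bernoulli : ∀ {x} j → 0# ≤ x → (1# - fromℕ j * x) * (1# + x) ^ j ≤ 1#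
  bernoulli {x} zero    0≤x = ≤.reflexive (solve 1 (λ x → (con (+ 1) :- con (+ 0) :* x) :* con (+ 1) := con (+ 1)) refl x)
  bernoulli {x} (suc j) 0≤x = ≤.trans
    (≤-+ (*-nonNeg (*-nonNeg (0≤fromℕ (suc j)) (x²-nonNeg x)) (^-nonNeg j (+-nonNeg 0≤1 0≤x)))
      (solve 3 (λ x j p → (con (+ 1) :- (con (+ 1) :+ j) :* x) :* ((con (+ 1) :+ x) :* p) :+ (con (+ 1) :+ j) :* (x :* x) :* p
         := (con (+ 1) :- j :* x) :* p) refl x (fromℕ j) ((1# + x) ^ j)))
    (bernoulli j 0≤x)

  module Buckets (L : ℕ) where

    at : Fin L → ℕ → Bool
    at l r = does (r ℕ.≟ Fin.toℕ l)

    at-true : ∀ l r → at l r ≡ true → r ≡ Fin.toℕ l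
    at-true l r = does-true (r ℕ.≟ Fin.toℕ l)

    sum-at-< : ∀ {r} → r ℕ.< L → sum (λ l → [ at l r ]) ≈ 1#
    sum-at-< {r} r<L = trans (sum-cong {L} λ l → trans (reflexive (≡.cong [_] (at-≟ l))) (sym (*-identityʳ _)))
      (sum-delta (λ _ → 1#) (Fin.fromℕ< r<L))
      where
      at-≟ : ∀ l → at l r ≡ does (l Fin.≟ Fin.fromℕ< r<L)
      at-≟ l with l Fin.≟ Fin.fromℕ< r<L
      ... | yes l≡ = dec-true (r ℕ.≟ Fin.toℕ l) (≡.trans (≡.sym (Fin.toℕ-fromℕ< r<L)) (≡.cong Fin.toℕ (≡.sym l≡)))
      ... | no  l≢ = dec-false (r ℕ.≟ Fin.toℕ l) λ r≡l →
        l≢ (Fin.toℕ-injective (≡.trans (≡.sym r≡l) (≡.sym (Fin.toℕ-fromℕ< r<L))))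

    sum-at≤1 : ∀ r → sum (λ l → [ at l r ]) ≤ 1#
    sum-at≤1 r with r ℕ.<? L
    ... | yes r<L = ≤.reflexive (sum-at-< r<L)
    ... | no  r≮L = ≤.trans (≤.reflexive (trans (sum-cong {L} λ l → reflexive (≡.cong [_] (dec-false (r ℕ.≟ Fin.toℕ l)
      λ { ≡.refl → r≮L (Fin.toℕ<n l) }))) (sum-replicate-zero L))) 0≤1

  -- The profile of a distribution

  everything : ∀ {n} → Fin n → Bool
  everything _ = true

  module Profile (N m L₁ T L : ℕ) .{{_ : NonZero N}} .{{_ : NonZero m}} {n : ℕ} (i₀ : Fin n)
                 (m≤ρ^L₁ : fromℕ m ≤ Walk.ρ N m L₁ ^ L₁) (n≤2^T : n ℕ.≤ 2 ℕ.^ T)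
                 (TL₁<L : T ℕ.* L₁ ℕ.< L) where
    open Walk N m L₁

    code : Fin n → Fin (2 ℕ.^ T)
    code i = Fin.inject≤ i n≤2^T

    code-injectiveOn : InjectiveOn everything code
    code-injectiveOn {i} {j} _ _ = Fin.inject≤-injective n≤2^T n≤2^T i j

    descent : Fin n → Prog n ℕ
    descent = walk T code everything

    observe : Prog n ℕ
    observe = draw everything i₀ >>= descent

    observe-cost : Cost≤ (1 ℕ.+ T ℕ.* m) observe
    observe-cost = >>=-cost (draw-cost everything i₀) (walk-cost T code everything)

    open Buckets L

    module _ (μ : Distribution n) where
      open WalkError N m L₁ m≤ρ^L₁ μ using (badness; bad-mass; d)

      weight-everything : weight μ everything ≈ 1#
      weight-everything = trans (sum-cong {n} λ i → *-identityˡ _) (total μ)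

      E-observe : ∀ f → E μ observe f ≈ sum λ i → mass μ i * E μ (descent i) f
      E-observe f = begin
        E μ observe f
          ≈⟨ E->>= μ (draw everything i₀) _ f ⟩
        E μ (draw everything i₀) (λ i → E μ (descent i) f)
          ≈⟨ sym (trans (*-congʳ weight-everything) (*-identityˡ _)) ⟩
        weight μ everything * E μ (draw everything i₀) (λ i → E μ (descent i) f)
          ≈⟨ E-draw μ everything i₀ _ (<-≤-trans 0<1 (≤.reflexive (sym weight-everything))) ⟩
        sum {n} (λ i → 1# * mass μ i * E μ (descent i) f)
          ≈⟨ sum-cong {n} (λ i → *-congʳ (*-identityˡ _)) ⟩
        sum {n} (λ i → mass μ i * E μ (descent i) f) ∎
        where open ≈-Reasoning

      Goodᵢ : Fin n → ℕ → Set
      Goodᵢ i r = r ℕ.≤ T ℕ.* L₁ × 1# ≤ κ T * (mass μ i * ρ ^ r) × mass μ i * ρ ^ r ≤ κ T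

      good⇒goodᵢ : ∀ {i r} → Good μ T everything i r → Goodᵢ i r
      good⇒goodᵢ (r≤ , y≤ , ≤y) = r≤ , ≤-resp weight-everything refl y≤ ,
        ≤-resp refl (trans (*-congˡ weight-everything) (*-identityʳ _)) ≤y

      frequency : Fin L → Carrier
      frequency l = E μ observe λ r → [ at l r ]

      -- Unlike `frequency`, this counts good outcomes only, so that mass and label match up to
      -- `κ T` without exception, as the assignment argument requires. The discarded part is bounded
      -- by `bad` on average.
      hit : Fin n → Fin L → Carrier
      hit i l = E μ (descent i) λ r → [ at l r ] * 𝟙 (Goodᵢ i r)

      joint : Fin n → Fin L → Carrier
      joint i l = mass μ i * hit i l

      0≤hit : ∀ i l → 0# ≤ hit i l
      0≤hit i l = E-nonNeg μ (descent i) λ r → *-nonNeg (0≤[] (at l r)) 0≤𝟙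

      0≤joint : ∀ i l → 0# ≤ joint i l
      0≤joint i l = *-nonNeg (nonNeg μ i) (0≤hit i l)

      b𝟙≤b : ∀ i l r → [ at l r ] * 𝟙 (Goodᵢ i r) ≤ [ at l r ]
      b𝟙≤b i l r = ≤-resp refl (*-identityʳ _) (*-monoʳ-≤ (0≤[] (at l r)) 𝟙≤1)

      joint≤frequency : ∀ l → sum (λ i → joint i l) ≤ frequency l
      joint≤frequency l = ≤-resp refl (sym (E-observe _))
        (sum-mono {n} λ i → *-monoʳ-≤ (nonNeg μ i) (E-mono μ (descent i) (b𝟙≤b i l)))

      frequency-total : sum frequency ≤ 1#
      frequency-total = ≤-resp (E-sum μ observe λ r l → [ at l r ]) (E-const μ observe 1#) (E-mono μ observe sum-at≤1)

      hit-total : ∀ i → sum (hit i) ≤ 1#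
      hit-total i = ≤-resp (E-sum μ (descent i) λ r l → [ at l r ] * 𝟙 (Goodᵢ i r)) (E-const μ (descent i) 1#)
        (E-mono μ (descent i) λ r → ≤.trans (sum-mono {L} λ l → b𝟙≤b i l r) (sum-at≤1 r))

      weighted-hit : ∀ i l → joint i l * ρ ^ Fin.toℕ l ≤ hit i l * κ T
      weighted-hit i l = begin
        mass μ i * hit i l * ρ ^ Fin.toℕ l
          ≈⟨ solve 3 (λ a e s → a :* e :* s := (a :* s) :* e) refl _ _ _ ⟩
        (mass μ i * ρ ^ Fin.toℕ l) * hit i l
          ≈⟨ sym (E-* μ (descent i) _ _) ⟩
        E μ (descent i) (λ r → (mass μ i * ρ ^ Fin.toℕ l) * ([ at l r ] * 𝟙 (Goodᵢ i r)))
          ≤⟨ E-mono μ (descent i) bound ⟩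
        E μ (descent i) (λ r → κ T * ([ at l r ] * 𝟙 (Goodᵢ i r)))
          ≈⟨ E-* μ (descent i) _ _ ⟩
        κ T * hit i l
          ≈⟨ *-comm _ _ ⟩
        hit i l * κ T ∎
        where
        open ≤-Reasoning
        bound : ∀ r → (mass μ i * ρ ^ Fin.toℕ l) * ([ at l r ] * 𝟙 (Goodᵢ i r)) ≤ κ T * ([ at l r ] * 𝟙 (Goodᵢ i r))
        bound r with at l r in atl | em {Goodᵢ i r}
        ... | false | _     = ≤.reflexive (trans (*-congˡ (zeroˡ _)) (trans (zeroʳ _) (sym (trans (*-congˡ (zeroˡ _)) (zeroʳ _)))))
        ... | true  | no  _ = ≤.reflexive (trans (*-congˡ (zeroʳ _)) (trans (zeroʳ _) (sym (trans (*-congˡ (zeroʳ _)) (zeroʳ _)))))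
        ... | true  | yes (_ , _ , ≤κ) = *-monoˡ-≤ (*-nonNeg 0≤1 0≤1)
          (≤-resp (*-congˡ (^-congʳ ρ (at-true l r atl))) refl ≤κ)

      -- This condition comes from the upper half of `Goodᵢ`; it keeps the row sums of the
      -- fractional assignment at most 1.
      joint-weight : ∀ i → sum (λ l → joint i l * ρ ^ Fin.toℕ l) ≤ κ T
      joint-weight i = begin
        sum {L} (λ l → joint i l * ρ ^ Fin.toℕ l)  ≤⟨ sum-mono {L} (weighted-hit i) ⟩
        sum {L} (λ l → hit i l * κ T)              ≈⟨ sym (*-distribʳ-sum (κ T) (hit i)) ⟩
        sum (hit i) * κ T                          ≤⟨ *-monoˡ-≤ (0≤κ T) (hit-total i) ⟩
        1# * κ T                                   ≈⟨ *-identityˡ _ ⟩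
        κ T                                        ∎
        where open ≤-Reasoning

      -- Here the lower half of `Goodᵢ` is used: an element can yield the label `l` by a good
      -- outcome only if its mass is not much below ρ ^ (- l).
      joint-support : ∀ i l → joint i l ≤ joint i l * (κ T * (mass μ i * ρ ^ Fin.toℕ l))
      joint-support i l = ≤-resp refl (sym (*-assoc _ _ _)) (*-monoʳ-≤ (nonNeg μ i) (begin
        hit i l
          ≤⟨ E-mono μ (descent i) bound ⟩
        E μ (descent i) (λ r → w * ([ at l r ] * 𝟙 (Goodᵢ i r)))
          ≈⟨ trans (E-* μ (descent i) _ _) (*-comm _ _) ⟩
        hit i l * w ∎))
        where
        open ≤-Reasoning
        w = κ T * (mass μ i * ρ ^ Fin.toℕ l)
        bound : ∀ r → [ at l r ] * 𝟙 (Goodᵢ i r) ≤ w * ([ at l r ] * 𝟙 (Goodᵢ i r))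
        bound r with at l r in atl | em {Goodᵢ i r}
        ... | false | _     = ≤.reflexive (trans (zeroˡ _) (sym (trans (*-congˡ (zeroˡ _)) (zeroʳ _))))
        ... | true  | no  _ = ≤.reflexive (trans (zeroʳ _) (sym (trans (*-congˡ (zeroʳ _)) (zeroʳ _))))
        ... | true  | yes (_ , 1≤ , _) = ≤-resp (*-identityˡ _) refl (*-monoˡ-≤ (*-nonNeg 0≤1 0≤1)
          (≤-resp refl (*-congˡ (*-congˡ (^-congʳ ρ (at-true l r atl)))) 1≤))

      bad : Carrier
      bad = sum λ i → mass μ i * badness T code everything i

      bad-bound : fromℕ m * bad ≤ fromℕ T * (lit 2 * (d * d))
      bad-bound = ≤-resp (*-congˡ (sum-cong {n} λ i → *-identityˡ _))
        (*-congˡ (trans (*-congˡ weight-everything) (*-identityʳ _)))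
        (bad-mass T code {everything} λ {i} {j} → code-injectiveOn {i} {j})

      joint-total : 1# ≤ sum (λ l → sum λ i → joint i l) + bad
      joint-total = begin
        1#
          ≈⟨ sym (total μ) ⟩
        sum (mass μ)
          ≤⟨ sum-mono {n} (λ i → ≤-resp (*-identityʳ _) refl (*-monoʳ-≤ (nonNeg μ i) (covered i))) ⟩
        sum (λ i → mass μ i * (sum (hit i) + badness T code everything i))
          ≈⟨ sum-cong {n} (λ i → trans (distribˡ _ _ _) (+-congʳ (*-distribˡ-sum {L} (mass μ i) (hit i)))) ⟩
        sum (λ i → sum (joint i) + mass μ i * badness T code everything i)
          ≈⟨ ∑-distrib-+ {n} (λ i → sum (joint i)) (λ i → mass μ i * badness T code everything i) ⟩
        sum (λ i → sum (joint i)) + bad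
          ≈⟨ +-congʳ (∑-comm {n} {L} joint) ⟩
        sum (λ l → sum λ i → joint i l) + bad ∎
        where
        open ≤-Reasoning
        covered : ∀ i → 1# ≤ sum (hit i) + badness T code everything i
        covered i = ≤-resp (E-const μ (descent i) 1#)
          (trans (E-+ μ (descent i) _ _) (+-congʳ (E-sum μ (descent i) λ r l → [ at l r ] * 𝟙 (Goodᵢ i r))))
          (E-mono μ (descent i) bound)
          where
          bound : ∀ r → 1# ≤ sum (λ l → [ at l r ] * 𝟙 (Goodᵢ i r)) + 𝟙 (¬ Good μ T everything i r)
          bound r with em {Good μ T everything i r}
          ... | no ¬good = ≤-+ (sum-nonNeg {L} λ l → *-nonNeg (0≤[] (at l r)) 0≤𝟙)
                (trans (+-comm _ _) (+-congˡ (sym (𝟙-true ¬good))))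
          ... | yes good = ≤-+ 0≤𝟙 (+-congʳ (sym (trans
                (sum-cong {L} λ l → trans (*-congˡ (𝟙-true (good⇒goodᵢ good))) (*-identityʳ _))
                (sum-at-< (ℕ.≤-<-trans (proj₁ good) TL₁<L)))))

    module _ (k : ℕ) .{{_ : NonZero k}} (β : Carrier) where

      tolerance : Carrier
      tolerance = (fromℕ k * β) * (fromℕ k * β)

      deviation : Distribution n → Fin L → Vec ℕ k → Carrier
      deviation μ l rs = (fromℕ (count (at l) rs) - fromℕ k * frequency μ l) * (fromℕ (count (at l) rs) - fromℕ k * frequency μ l)

      Consistent : Distribution n → Vec ℕ k → Set
      Consistent μ rs = ∀ l → deviation μ l rs ≤ tolerance

      -- Chebyshev's inequality for each label. As the frequencies sum to at most 1, the variances
      -- sum to at most `k`, and the union bound costs no factor `L`.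
      inconsistent-probability : ∀ μ →
        tolerance * E μ (repeatᴾ k observe) (λ rs → 𝟙 (¬ Consistent μ rs)) ≤ fromℕ k
      inconsistent-probability μ = begin
        tolerance * E μ sample (λ rs → 𝟙 (¬ Consistent μ rs))
          ≤⟨ *-monoʳ-≤ (x²-nonNeg _) (E-mono μ sample union) ⟩
        tolerance * E μ sample (λ rs → sum λ l → 𝟙 (¬ (deviation μ l rs ≤ tolerance)))
          ≈⟨ trans (*-congˡ (E-sum μ {m = L} sample λ rs l → 𝟙 (¬ (deviation μ l rs ≤ tolerance)))) (*-distribˡ-sum {L} tolerance _) ⟩
        sum {L} (λ l → tolerance * E μ sample (λ rs → 𝟙 (¬ (deviation μ l rs ≤ tolerance))))
          ≤⟨ sum-mono {L} (λ l → ≤.trans (markov μ sample tolerance (λ rs → x²-nonNeg _)) (variance μ observe (at l) k)) ⟩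
        sum {L} (λ l → fromℕ k * frequency μ l)
          ≈⟨ sym (*-distribˡ-sum (fromℕ k) (frequency μ)) ⟩
        fromℕ k * sum (frequency μ)
          ≤⟨ *-monoʳ-≤ (0≤fromℕ k) (frequency-total μ) ⟩
        fromℕ k * 1#
          ≈⟨ *-identityʳ _ ⟩
        fromℕ k ∎
        where
        open ≤-Reasoning
        sample = repeatᴾ k observe
        union : ∀ rs → 𝟙 (¬ Consistent μ rs) ≤ sum λ l → 𝟙 (¬ (deviation μ l rs ≤ tolerance))
        union rs with Fin.any? (λ l → em {¬ (deviation μ l rs ≤ tolerance)})
        ... | yes (l , big) = ≤.trans 𝟙≤1 (≤-resp (𝟙-true big) refl
          (term≤sum (λ l → 𝟙 (¬ (deviation μ l rs ≤ tolerance))) (λ _ → 0≤𝟙) l))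
        ... | no  none = ≤.trans (≤.reflexive (𝟙-false λ ¬consistent →
                ¬consistent λ l → decidable-stable em λ big → none (l , big)))
                (sum-nonNeg {L} λ _ → 0≤𝟙)

      frequencies-close : 0# ≤ β → ∀ {μ ν rs} → Consistent μ rs → Consistent ν rs → ∀ l →
                          frequency μ l ≤ frequency ν l + lit 2 * β
      frequencies-close 0≤β {μ} {ν} {rs} cμ cν l = pos-cancelˡ-≤ (0<fromℕ k) (begin
        K * frequency μ l
          ≈⟨ solve 2 (λ x c → x := (x :- c) :+ c) refl (K * frequency μ l) C ⟩
        (K * frequency μ l - C) + C
          ≤⟨ +-mono-≤ (square-≤⇒≤ 0≤Kβ (≤-resp (solve 2 (λ c x → (c :- x) :* (c :- x) := (x :- c) :* (x :- c)) refl C _) refl (cμ l)))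
               (≤-resp refl refl (≤.reflexive (solve 2 (λ x c → c := (c :- x) :+ x) refl (K * frequency ν l) C))) ⟩
        K * β + ((C - K * frequency ν l) + K * frequency ν l)
          ≤⟨ +-monoʳ-≤ _ (+-monoˡ-≤ _ (square-≤⇒≤ 0≤Kβ (cν l))) ⟩
        K * β + (K * β + K * frequency ν l)
          ≈⟨ solve 3 (λ k b f → k :* b :+ (k :* b :+ k :* f) := k :* (f :+ con (+ 2) :* b)) refl K β _ ⟩
        K * (frequency ν l + lit 2 * β) ∎)
        where
        open ≤-Reasoning
        K = fromℕ k
        C = fromℕ (count (at l) rs)
        0≤Kβ : 0# ≤ K * β
        0≤Kβ = *-nonNeg (0≤fromℕ k) 0≤β

      -- Where `J l` exceeds `J′ l`, it is still at most `frequency μ l`, hence at most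
      -- `frequency ν l` + 2 β. The excess over `J′ l` is thus 2 β plus the weight of the bad
      -- outcomes of ν with label l, and the latter sums to at most `bad ν`.
      consistent⇒joint-close : 0# ≤ β → ∀ {μ ν rs} → Consistent μ rs → Consistent ν rs →
        1# ≤ sum (λ l → sum (λ i → joint μ i l) ⊓ sum (λ i → joint ν i l)) + (bad μ + (bad ν + fromℕ L * (lit 2 * β)))
      consistent⇒joint-close 0≤β {μ} {ν} {rs} cμ cν = begin
        1#
          ≤⟨ joint-total μ ⟩
        sum J + bad μ
          ≤⟨ +-monoˡ-≤ (bad μ) (begin
            sum J
              ≤⟨ sum-mono {L} shared ⟩
            sum (λ l → J l ⊓ J′ l + (frequency ν l - J′ l + lit 2 * β))
              ≈⟨ trans (∑-distrib-+ {L} (λ l → J l ⊓ J′ l) _) (+-congˡ (∑-distrib-+ {L} (λ l → frequency ν l - J′ l) _)) ⟩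
            S + (sum (λ l → frequency ν l - J′ l) + sum {L} (λ l → lit 2 * β))
              ≤⟨ +-monoʳ-≤ S (+-mono-≤ excess (≤.reflexive (sum-const L _))) ⟩
            S + (bad ν + fromℕ L * (lit 2 * β)) ∎) ⟩
        S + (bad ν + fromℕ L * (lit 2 * β)) + bad μ
          ≈⟨ solve 3 (λ s x y → s :+ x :+ y := s :+ (y :+ x)) refl S _ (bad μ) ⟩
        S + (bad μ + (bad ν + fromℕ L * (lit 2 * β))) ∎
        where
        open ≤-Reasoning
        J J′ : Fin L → Carrier
        J l = sum λ i → joint μ i l
        J′ l = sum λ i → joint ν i l
        S = sum λ l → J l ⊓ J′ l
        shared : ∀ l → J l ≤ J l ⊓ J′ l + (frequency ν l - J′ l + lit 2 * β)
        shared l = by-sel (⊓-sel (J l) (J′ l))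
          where
          by-sel : (J l ⊓ J′ l ≈ J l) ⊎ (J l ⊓ J′ l ≈ J′ l) → J l ≤ J l ⊓ J′ l + (frequency ν l - J′ l + lit 2 * β)
          by-sel (inj₁ ≈J) = ≤-+ (+-nonNeg (x≤y⇒0≤y-x (joint≤frequency ν l)) (*-nonNeg (0≤lit 2) 0≤β)) (+-congʳ (sym ≈J))
          by-sel (inj₂ ≈J′) = ≤.trans (≤.trans (joint≤frequency μ l) (frequencies-close 0≤β {μ} {ν} {rs} cμ cν l)) (≤.reflexive (trans
            (solve 3 (λ f j b → f :+ b := j :+ (f :- j :+ b)) refl (frequency ν l) (J′ l) (lit 2 * β)) (+-congʳ (sym ≈J′))))
        excess : sum (λ l → frequency ν l - J′ l) ≤ bad ν
        excess = 0≤y-x⇒x≤y (≤-resp refl (solve 3 (λ s b d → (s :+ b) :- (s :+ d) := b :- d) refl (sum J′) (bad ν) _)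
          (x≤y⇒0≤y-x (≤.trans (≤-resp (trans (sum-cong {L} λ l → solve 2 (λ j f → f := j :+ (f :- j)) refl (J′ l) (frequency ν l))
            (∑-distrib-+ {L} J′ λ l → frequency ν l - J′ l)) refl (frequency-total ν)) (joint-total ν))))

    ρρ^-bernoulli : (1# - fromℕ (4 ℕ.* T) * fromℕ N ⁻¹) * (κ T * κ T) ≤ 1#
    ρρ^-bernoulli = ≤-resp (*-congˡ ρ^4T≈) refl (bernoulli (4 ℕ.* T) (⁻¹-nonNeg (0<fromℕ N)))
      where
      ρ^4T≈ : ρ ^ (4 ℕ.* T) ≈ κ T * κ T
      ρ^4T≈ = trans (sym (^-assocʳ ρ 4 T)) (trans (^-congˡ T (solve 1 (λ r → r :* (r :* (r :* (r :* con (+ 1)))) := (r :* r) :* (r :* r)) refl ρ))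
        (^-square T))
        where
        ^-square : ∀ t → ((ρ * ρ) * (ρ * ρ)) ^ t ≈ κ t * κ t
        ^-square zero    = sym (*-identityˡ 1#)
        ^-square (suc t) = trans (*-congˡ (^-square t))
          (solve 2 (λ s k → (s :* s) :* (k :* k) := (s :* k) :* (s :* k)) refl (ρ * ρ) (κ t))

  module Nearness (N m L₁ T L : ℕ) .{{_ : NonZero N}} .{{_ : NonZero m}} {n : ℕ} (i₀ : Fin n)
                  (m≤ρ^L₁ : fromℕ m ≤ Walk.ρ N m L₁ ^ L₁) (n≤2^T : n ℕ.≤ 2 ℕ.^ T)
                  (TL₁<L : T ℕ.* L₁ ℕ.< L) (k : ℕ) .{{_ : NonZero k}} (β : Carrier) (0≤β : 0# ≤ β)
                  (γ≤1 : fromℕ (4 ℕ.* T) * fromℕ N ⁻¹ ≤ 1#) where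
    open Walk N m L₁
    open Profile N m L₁ T L i₀ m≤ρ^L₁ n≤2^T TL₁<L

    error : Distribution n → Distribution n → Carrier
    error μ ν = fromℕ (4 ℕ.* T) * fromℕ N ⁻¹ + (bad μ + (bad ν + fromℕ L * (lit 2 * β)))

    bad-nonNeg : ∀ μ → 0# ≤ bad μ
    bad-nonNeg μ = sum-nonNeg {n} λ i → *-nonNeg (nonNeg μ i) (E-nonNeg μ (descent i) λ _ → 0≤𝟙)

    -- With both distributions sorted, `⊓-overlap` bounds the overlap of the masses from below by
    -- that of the label weights, up to κ². Distance is one minus overlap.
    consistent⇒near : ∀ {μ ν rs} → Consistent k β μ rs → Consistent k β ν rs →
                      ∃ λ σ → distance μ (relabel σ ν) ≤ error μ ν
    consistent⇒near {μ} {ν} {rs} cμ cν = align (descending-sort (mass μ)) (descending-sort (mass ν))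
      where
      align : (∃ λ (σ : Permutation′ n) → Descending (mass μ ∘ (σ ⟨$⟩ʳ_))) →
              (∃ λ (τ : Permutation′ n) → Descending (mass ν ∘ (τ ⟨$⟩ʳ_))) →
              ∃ λ σ → distance μ (relabel σ ν) ≤ error μ ν
      align (σ , σ-desc) (τ , τ-desc) = Perm.flip σ ∘ₚ τ , (begin
        distance μ (relabel (Perm.flip σ ∘ₚ τ) ν)
          ≈⟨ distance-align μ ν σ τ ⟩
        D
          ≤⟨ +-cancelʳ-≤ O (begin
            D + O
              ≈⟨ distance+overlap≈1 (relabel σ μ) (relabel τ ν) ⟩
            1#
              ≈⟨ solve 1 (λ g → con (+ 1) := (con (+ 1) :- g) :* con (+ 1) :+ g) refl γ ⟩
            -- Since 1 - γ ≤ 1 / κ² by Bernoulli's inequality, this factor removes κ² from the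
            -- overlap at the additive cost γ; it is nonnegative because γ ≤ 1.
            (1# - γ) * 1# + γ
              ≤⟨ +-monoˡ-≤ γ (*-monoʳ-≤ (x≤y⇒0≤y-x γ≤1) 1≤κκO+B) ⟩
            (1# - γ) * (κ T * (κ T * O) + B) + γ
              ≈⟨ solve 4 (λ g k O B → (con (+ 1) :- g) :* (k :* (k :* O) :+ B) :+ g
                   := ((con (+ 1) :- g) :* (k :* k)) :* O :+ ((con (+ 1) :- g) :* B :+ g)) refl γ (κ T) O B ⟩
            ((1# - γ) * (κ T * κ T)) * O + ((1# - γ) * B + γ)
              ≤⟨ +-mono-≤ (*-monoˡ-≤ 0≤O ρρ^-bernoulli) (+-monoˡ-≤ γ (≤-+ (*-nonNeg 0≤γ 0≤B)
                   (solve 2 (λ g B → (con (+ 1) :- g) :* B :+ g :* B := con (+ 1) :* B) refl γ B))) ⟩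
            1# * O + (1# * B + γ)
              ≈⟨ solve 3 (λ g B O → con (+ 1) :* O :+ (con (+ 1) :* B :+ g) := (g :+ B) :+ O) refl γ B O ⟩
            (γ + B) + O ∎) ⟩
        γ + B ∎)
        where
        open ≤-Reasoning
        γ = fromℕ (4 ℕ.* T) * fromℕ N ⁻¹
        B = bad μ + (bad ν + fromℕ L * (lit 2 * β))
        D = distance (relabel σ μ) (relabel τ ν)
        O = sum λ i → mass (relabel σ μ) i ⊓ mass (relabel τ ν) i
        0≤γ : 0# ≤ γ
        0≤γ = *-nonNeg (0≤fromℕ (4 ℕ.* T)) (⁻¹-nonNeg (0<fromℕ N))
        0≤B : 0# ≤ B
        0≤B = +-nonNeg (bad-nonNeg μ) (+-nonNeg (bad-nonNeg ν)
          (*-nonNeg (0≤fromℕ L) (*-nonNeg (0≤lit 2) 0≤β)))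
        0≤O : 0# ≤ O
        0≤O = sum-nonNeg {n} λ i → ⊓-glb (nonNeg μ _) (nonNeg ν _)
        0<κ : 0# < κ T
        0<κ = <-≤-trans 0<1 (1≤^ T (≤-resp (*-identityˡ 1#) refl (*-mono-≤ 0≤1 0≤1 1≤ρ 1≤ρ)))
        1≤κκO+B : 1# ≤ κ T * (κ T * O) + B
        1≤κκO+B = ≤.trans (consistent⇒joint-close k β 0≤β {μ} {ν} {rs} cμ cν) (+-monoˡ-≤ B (≤-resp
          -- The label weights belong to the original labellings; sorting only permutes the elements
          -- over which they are summed.
          (sum-cong {L} λ l → ⊓-cong (sym (sum-permute (λ i → joint μ i l) σ)) (sym (sum-permute (λ i → joint ν i l) τ)))
          refl
          (⊓-overlap (potentials σ-desc τ-desc (λ i → nonNeg μ _) (λ i → nonNeg ν _))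
            (λ i l → joint μ (σ ⟨$⟩ʳ i) l) (λ i l → joint ν (τ ⟨$⟩ʳ i) l) (λ l → ρ ^ Fin.toℕ l) (κ T)
            (λ i l → 0≤joint μ _ l) (λ i l → 0≤joint ν _ l)
            (λ l → <-≤-trans 0<1 (1≤^ (Fin.toℕ l) 1≤ρ)) 0<κ
            (λ i → joint-weight μ _) (λ i → joint-weight ν _)
            (λ i l → joint-support μ _ l) (λ i l → joint-support ν _ l))))

  -- Amplification

  isNot : Verdict → Verdict → Bool
  isNot accept accept = false
  isNot accept reject = true
  isNot reject accept = true
  isNot reject reject = false

  indicator+isNot : ∀ c v → indicator v c + [ isNot c v ] ≈ 1#
  indicator+isNot accept accept = +-identityʳ 1#
  indicator+isNot accept reject = +-identityˡ 1#
  indicator+isNot reject accept = +-identityˡ 1#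
  indicator+isNot reject reject = +-identityʳ 1#

  count-complement : ∀ {r} (vs : Vec Verdict r) → count (isNot accept) vs ℕ.+ count (isNot reject) vs ≡ r
  count-complement []            = ≡.refl
  count-complement (accept ∷ vs) = ≡.trans (ℕ.+-suc _ _) (≡.cong suc (count-complement vs))
  count-complement (reject ∷ vs) = ≡.cong suc (count-complement vs)

  majority : ∀ {r} → Vec Verdict r → Verdict
  majority {r} vs with r ℕ.≤? 2 ℕ.* count (isNot accept) vs
  ... | yes _ = reject
  ... | no  _ = accept

  majority-wrong : ∀ {r} c (vs : Vec Verdict r) → isNot c (majority vs) ≡ true → r ℕ.≤ 2 ℕ.* count (isNot c) vs
  majority-wrong {r} c vs wrong with r ℕ.≤? 2 ℕ.* count (isNot accept) vs
  majority-wrong accept vs wrong | yes r≤2a = r≤2a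
  majority-wrong {r} reject vs wrong | no r≰2a = ℕ.+-cancelˡ-≤ r _ _ (begin
    r ℕ.+ r                    ≡⟨ ≡.cong (r ℕ.+_) (≡.sym (ℕ.+-identityʳ r)) ⟩
    2 ℕ.* r                    ≡⟨ ≡.cong (2 ℕ.*_) (≡.sym (count-complement vs)) ⟩
    2 ℕ.* (a ℕ.+ b)            ≡⟨ ℕ.*-distribˡ-+ 2 a b ⟩
    2 ℕ.* a ℕ.+ 2 ℕ.* b        ≤⟨ ℕ.+-monoˡ-≤ (2 ℕ.* b) (ℕ.<⇒≤ (ℕ.≰⇒> r≰2a)) ⟩
    r ℕ.+ 2 ℕ.* b              ∎)
    where
    open ℕ.≤-Reasoning
    a = count (isNot accept) vs
    b = count (isNot reject) vs

  module _ {n} (μ : Distribution n) (trial : Prog n Verdict) (c : Verdict)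
           (reliable : lit 6 * E μ trial (λ v → [ isNot c v ]) ≤ 1#) where
    private
      q : Carrier
      q = E μ trial λ v → [ isNot c v ]

      0≤q : 0# ≤ q
      0≤q = 0≤E[] μ trial (isNot c)

      0<2^ : ∀ k → 0# < lit 2 ^ k
      0<2^ k = <-≤-trans 0<1 (1≤^ k (≤-+ 0≤1 refl))

      failure : ℕ → Carrier
      failure r = E μ (repeatᴾ r trial) λ vs → [ isNot c (majority vs) ]

      4^≈2^*2 : ∀ w → lit 4 ^ w ≈ lit 2 ^ (2 ℕ.* w)
      4^≈2^*2 w = trans (^-congˡ w (solve 0 (con (+ 4) := con (+ 2) :* (con (+ 2) :* con (+ 1))) refl)) (^-assocʳ (lit 2) 2 w)

      lit2^-mono : ∀ {a b} → a ℕ.≤ b → lit 2 ^ a ≤ lit 2 ^ b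
      lit2^-mono {a} {b} a≤b = ≤-resp (^-congˡ a (fromℕ≈lit 2)) (^-congˡ b (fromℕ≈lit 2)) (2^-mono a≤b)

      -- If the majority is wrong, at least half of the votes are, and 4 ^ (r / 2) = 2 ^ r.
      markov-exponential : ∀ r → lit 2 ^ r * failure r ≤ (1# + lit 3 * q) ^ r
      markov-exponential r = ≤-resp (E-* μ (repeatᴾ r trial) _ _) (exponential-moment μ trial (isNot c) r)
        (E-mono μ (repeatᴾ r trial) bound)
        where
        bound : ∀ vs → lit 2 ^ r * [ isNot c (majority vs) ] ≤ lit 4 ^ count (isNot c) vs
        bound vs with isNot c (majority vs) in wrong
        ... | true  = ≤-resp (sym (*-identityʳ _)) (sym (4^≈2^*2 (count (isNot c) vs))) (lit2^-mono (majority-wrong c vs wrong))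
        ... | false = ≤-resp (sym (zeroʳ _)) refl (^-nonNeg (count (isNot c) vs) (0≤lit 4))

      -- The inequality 2 (1 + 3 q) ≤ 3 is exactly q ≤ 1 / 6, the origin of the reliability required
      -- of a single trial. The failure probability decays like (3 / 4) ^ r.
      4^failure≤3^ : ∀ r → lit 4 ^ r * failure r ≤ lit 3 ^ r
      4^failure≤3^ r = begin
        lit 4 ^ r * failure r
          ≈⟨ *-congʳ (trans (^-congˡ r (solve 0 (con (+ 4) := con (+ 2) :* con (+ 2)) refl)) (^-distrib-* (lit 2) (lit 2) r)) ⟩
        lit 2 ^ r * lit 2 ^ r * failure r
          ≈⟨ *-assoc _ _ _ ⟩
        lit 2 ^ r * (lit 2 ^ r * failure r)
          ≤⟨ *-monoʳ-≤ (proj₁ (0<2^ r)) (markov-exponential r) ⟩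
        lit 2 ^ r * (1# + lit 3 * q) ^ r
          ≈⟨ sym (^-distrib-* (lit 2) (1# + lit 3 * q) r) ⟩
        (lit 2 * (1# + lit 3 * q)) ^ r
          ≤⟨ ^-monoˡ-≤ r (*-nonNeg (0≤lit 2) (+-nonNeg 0≤1 (*-nonNeg (0≤lit 3) 0≤q)))
               (≤-resp (solve 1 (λ q → con (+ 2) :+ con (+ 6) :* q := con (+ 2) :* (con (+ 1) :+ con (+ 3) :* q)) refl q)
                 (solve 0 (con (+ 2) :+ con (+ 1) := con (+ 3)) refl) (+-monoʳ-≤ (lit 2) reliable)) ⟩
        lit 3 ^ r ∎
        where open ≤-Reasoning

    -- Since 3³ ≤ 2⁵, three trials gain more than one bit of confidence.
    2^failure≤1 : ∀ s → lit 2 ^ s * failure (3 ℕ.* s) ≤ 1#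
    2^failure≤1 s = pos-cancelˡ-≤ (<-≤-trans 0<1 (1≤^ s 1≤32)) (begin
      lit 32 ^ s * (lit 2 ^ s * failure (3 ℕ.* s))
        ≈⟨ trans (sym (*-assoc _ _ _)) (*-congʳ (sym (^-distrib-* (lit 32) (lit 2) s))) ⟩
      (lit 32 * lit 2) ^ s * failure (3 ℕ.* s)
        ≈⟨ *-congʳ (trans (^-congˡ s (solve 0 (con (+ 32) :* con (+ 2) := con (+ 4) :* (con (+ 4) :* (con (+ 4) :* con (+ 1)))) refl)) (^-assocʳ (lit 4) 3 s)) ⟩
      lit 4 ^ (3 ℕ.* s) * failure (3 ℕ.* s)
        ≤⟨ 4^failure≤3^ (3 ℕ.* s) ⟩
      lit 3 ^ (3 ℕ.* s)
        ≈⟨ sym (^-assocʳ (lit 3) 3 s) ⟩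
      (lit 3 ^ 3) ^ s
        ≤⟨ ^-monoˡ-≤ s (^-nonNeg 3 (0≤lit 3)) (≤-+ (0≤lit 5)
             (solve 0 (con (+ 3) :* (con (+ 3) :* (con (+ 3) :* con (+ 1))) :+ con (+ 5) := con (+ 32)) refl)) ⟩
      lit 32 ^ s
        ≈⟨ sym (*-identityʳ _) ⟩
      lit 32 ^ s * 1# ∎)
      where
      open ≤-Reasoning
      1≤32 : 1# ≤ lit 32
      1≤32 = ≤-+ (0≤lit 31) (solve 0 (con (+ 1) :+ con (+ 31) := con (+ 32)) refl)

    amplification : ∀ s {δ} → 0# ≤ δ → 1# ≤ lit 2 ^ s * δ →
                    1# - δ ≤ Pr μ (toAlgorithm (mapᴾ majority (repeatᴾ (3 ℕ.* s) trial))) c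
    amplification s {δ} 0≤δ 1≤2^sδ = ≤-resp refl (sym (trans (Pr-toAlgorithm μ (mapᴾ majority trials) c) (E-mapᴾ μ trials majority λ v → indicator v c)))
      (+-cancelʳ-≤ δ (begin
        (1# - δ) + δ
          ≈⟨ x-y+y≈x 1# δ ⟩
        1#
          ≈⟨ sym (E-const μ trials 1#) ⟩
        E μ trials (λ _ → 1#)
          ≈⟨ trans (E-cong μ trials λ vs → sym (indicator+isNot c (majority vs))) (E-+ μ trials _ _) ⟩
        E μ trials (λ vs → indicator (majority vs) c) + failure (3 ℕ.* s)
          ≤⟨ +-monoʳ-≤ _ (pos-cancelˡ-≤ (0<2^ s) (≤.trans (2^failure≤1 s) 1≤2^sδ)) ⟩
        E μ trials (λ vs → indicator (majority vs) c) + δ ∎))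
      where
      open ≤-Reasoning
      trials = repeatᴾ (3 ℕ.* s) trial

  -- Choice of the parameters

  fromℕ-* : ∀ m n → fromℕ (m ℕ.* n) ≈ fromℕ m * fromℕ n
  fromℕ-* = ×1-homo-*

  bernoulli-lower : ∀ {x} j → 0# ≤ x → 1# + fromℕ j * x ≤ (1# + x) ^ j
  bernoulli-lower {x} zero    0≤x = ≤.reflexive (solve 1 (λ x → con (+ 1) :+ con (+ 0) :* x := con (+ 1)) refl x)
  bernoulli-lower {x} (suc j) 0≤x = ≤.trans
    (≤-+ (*-nonNeg (0≤fromℕ j) (x²-nonNeg x))
      (solve 2 (λ x j → (con (+ 1) :+ (con (+ 1) :+ j) :* x) :+ j :* (x :* x) := (con (+ 1) :+ x) :* (con (+ 1) :+ j :* x)) refl x (fromℕ j)))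
    (*-monoʳ-≤ (+-nonNeg 0≤1 0≤x) (bernoulli-lower j 0≤x))

  -- With e ≥ 1 / ε, the choice of N, m and b makes 4 T / N, bad μ + bad ν and 2 L β at most 1 / (4 e)
  -- each, so that error μ ν < ε. Since k β² = 6, one trial errs with probability at most 1 / 6.
  module Parameters (T e : ℕ) .{{_ : NonZero e}} where
    -- One more than the depth, so that the parameters are positive even at depth 0 and `t * L₁`
    -- lies strictly above all good labels, which are at most `T * L₁`.
    t : ℕ
    t = suc T

    abstract
      N m L₁ L b k : ℕ
      N  = 16 ℕ.* (t ℕ.* e)
      m  = 64 ℕ.* (t ℕ.* ((N ℕ.* N) ℕ.* e))
      L₁ = N ℕ.* m
      L  = t ℕ.* L₁
      b  = 8 ℕ.* (L ℕ.* e)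
      k  = 6 ℕ.* (b ℕ.* b)

      N≡ : N ≡ 16 ℕ.* (t ℕ.* e)
      N≡ = ≡.refl
      m≡ : m ≡ 64 ℕ.* (t ℕ.* ((N ℕ.* N) ℕ.* e))
      m≡ = ≡.refl
      L₁≡ : L₁ ≡ N ℕ.* m
      L₁≡ = ≡.refl
      L≡ : L ≡ t ℕ.* L₁
      L≡ = ≡.refl
      b≡ : b ≡ 8 ℕ.* (L ℕ.* e)
      b≡ = ≡.refl
      k≡ : k ≡ 6 ℕ.* (b ℕ.* b)
      k≡ = ≡.refl

    β : Carrier
    β = fromℕ b ⁻¹

    instance
      N-nonZero : NonZero N
      N-nonZero = ≡.subst NonZero (≡.sym N≡) (ℕ.m*n≢0 16 (t ℕ.* e) {{_}} {{ℕ.m*n≢0 t e}})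
      m-nonZero : NonZero m
      m-nonZero = ≡.subst NonZero (≡.sym m≡) (ℕ.m*n≢0 64 (t ℕ.* ((N ℕ.* N) ℕ.* e)) {{_}}
        {{ℕ.m*n≢0 t ((N ℕ.* N) ℕ.* e) {{_}} {{ℕ.m*n≢0 (N ℕ.* N) e {{ℕ.m*n≢0 N N}}}}}})
      L₁-nonZero : NonZero L₁
      L₁-nonZero = ≡.subst NonZero (≡.sym L₁≡) (ℕ.m*n≢0 N m)
      L-nonZero : NonZero L
      L-nonZero = ≡.subst NonZero (≡.sym L≡) (ℕ.m*n≢0 t L₁)
      b-nonZero : NonZero b
      b-nonZero = ≡.subst NonZero (≡.sym b≡) (ℕ.m*n≢0 8 (L ℕ.* e) {{_}} {{ℕ.m*n≢0 L e}})
      k-nonZero : NonZero k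
      k-nonZero = ≡.subst NonZero (≡.sym k≡) (ℕ.m*n≢0 6 (b ℕ.* b) {{_}} {{ℕ.m*n≢0 b b}})

    TL₁<L : T ℕ.* L₁ ℕ.< L
    TL₁<L = ≡.subst (T ℕ.* L₁ ℕ.<_) (≡.sym L≡) (ℕ.m<n+m (T ℕ.* L₁) (ℕ.>-nonZero⁻¹ L₁))

    private
      x T′ t′ N′ L′ : Carrier
      x  = fromℕ e
      T′ = fromℕ T
      t′ = fromℕ t
      N′ = fromℕ N
      L′ = fromℕ L

      N≈ : N′ ≈ lit 16 * (t′ * x)
      N≈ = trans (reflexive (≡.cong fromℕ N≡)) (trans (fromℕ-* 16 (t ℕ.* e)) (*-cong (fromℕ≈lit 16) (fromℕ-* t e)))
      m≈ : fromℕ m ≈ lit 64 * (t′ * ((N′ * N′) * x))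
      m≈ = trans (reflexive (≡.cong fromℕ m≡)) (trans (fromℕ-* 64 (t ℕ.* ((N ℕ.* N) ℕ.* e))) (*-cong (fromℕ≈lit 64) (trans (fromℕ-* t ((N ℕ.* N) ℕ.* e))
        (*-congˡ (trans (fromℕ-* (N ℕ.* N) e) (*-congʳ (fromℕ-* N N)))))))
      b≈ : fromℕ b ≈ lit 8 * (L′ * x)
      b≈ = trans (reflexive (≡.cong fromℕ b≡)) (trans (fromℕ-* 8 (L ℕ.* e)) (*-cong (fromℕ≈lit 8) (fromℕ-* L e)))
      bβ≈1 : fromℕ b * β ≈ 1#
      bβ≈1 = *-inverseʳ (fromℕ≉0 b)

    0≤β : 0# ≤ β
    0≤β = ⁻¹-nonNeg (0<fromℕ b)

    kββ≈6 : fromℕ k * (β * β) ≈ lit 6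
    kββ≈6 = begin
      fromℕ k * (β * β)                      ≈⟨ *-congʳ (trans (reflexive (≡.cong fromℕ k≡)) (trans (fromℕ-* 6 (b ℕ.* b)) (*-cong (fromℕ≈lit 6) (fromℕ-* b b)))) ⟩
      lit 6 * (fromℕ b * fromℕ b) * (β * β)  ≈⟨ solve 2 (λ b β → con (+ 6) :* (b :* b) :* (β :* β) := con (+ 6) :* ((b :* β) :* (b :* β))) refl (fromℕ b) β ⟩
      lit 6 * ((fromℕ b * β) * (fromℕ b * β)) ≈⟨ *-congˡ (*-cong bβ≈1 bβ≈1) ⟩
      lit 6 * (1# * 1#)                      ≈⟨ solve 0 (con (+ 6) :* (con (+ 1) :* con (+ 1)) := con (+ 6)) refl ⟩
      lit 6 ∎
      where open ≈-Reasoning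

    -- As ρ ^ N ≥ 2, the exponent N m yields at least 2 ^ m. This is a crude choice, but it keeps
    -- the number of labels polynomial.
    m≤ρ^L₁ : fromℕ m ≤ Walk.ρ N m L₁ ^ L₁
    m≤ρ^L₁ = begin
      fromℕ m                 ≤⟨ fromℕ≤2^ m ⟩
      2# ^ m                  ≤⟨ ^-monoˡ-≤ m (0≤fromℕ 2) (≤-resp (sym (fromℕ≈lit 2)) refl 2≤ρ^N) ⟩
      (Walk.ρ N m L₁ ^ N) ^ m ≈⟨ trans (^-assocʳ (Walk.ρ N m L₁) N m) (^-congʳ (Walk.ρ N m L₁) (≡.sym L₁≡)) ⟩
      Walk.ρ N m L₁ ^ L₁      ∎
      where
      open ≤-Reasoning
      2≤ρ^N : lit 2 ≤ Walk.ρ N m L₁ ^ N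
      2≤ρ^N = ≤-resp (+-congˡ (*-inverseʳ (fromℕ≉0 N))) refl (bernoulli-lower N (⁻¹-nonNeg (0<fromℕ N)))

    private
      γ : Carrier
      γ = fromℕ (4 ℕ.* T) * N′ ⁻¹

      T≤t : T′ ≤ t′
      T≤t = ≤-+ 0≤1 (+-comm _ _)

      4xγ≤1 : (lit 4 * x) * γ ≤ 1#
      4xγ≤1 = begin
        (lit 4 * x) * γ                       ≈⟨ *-congˡ (*-congʳ (trans (fromℕ-* 4 T) (*-congʳ (fromℕ≈lit 4)))) ⟩
        (lit 4 * x) * (lit 4 * T′ * N′ ⁻¹)    ≈⟨ solve 3 (λ x T i → (con (+ 4) :* x) :* (con (+ 4) :* T :* i) := con (+ 16) :* (T :* x) :* i) refl x T′ (N′ ⁻¹) ⟩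
        lit 16 * (T′ * x) * N′ ⁻¹             ≤⟨ *-monoˡ-≤ (⁻¹-nonNeg (0<fromℕ N)) (*-monoʳ-≤ (0≤lit 16) (*-monoˡ-≤ (0≤fromℕ e) T≤t)) ⟩
        lit 16 * (t′ * x) * N′ ⁻¹             ≈⟨ *-congʳ (sym N≈) ⟩
        N′ * N′ ⁻¹                            ≈⟨ *-inverseʳ (fromℕ≉0 N) ⟩
        1# ∎
        where open ≤-Reasoning

    γ≤1 : fromℕ (4 ℕ.* T) * fromℕ N ⁻¹ ≤ 1#
    γ≤1 = ≤.trans (≤-resp (*-identityˡ _) refl (*-monoˡ-≤ (*-nonNeg (0≤fromℕ (4 ℕ.* T)) (⁻¹-nonNeg (0<fromℕ N))) 1≤4x)) 4xγ≤1
      where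
      1≤4x : 1# ≤ lit 4 * x
      1≤4x = ≤-resp (*-identityˡ 1#) refl (*-mono-≤ 0≤1 0≤1 (≤-+ (0≤lit 3) (solve 0 (con (+ 1) :+ con (+ 3) := con (+ 4)) refl)) (1≤fromℕ e))

    module _ {n} (i₀ : Fin n) (n≤2^T : n ℕ.≤ 2 ℕ.^ T) where
      open Profile N m L₁ T L i₀ m≤ρ^L₁ n≤2^T TL₁<L using (bad; bad-bound)
      open Nearness N m L₁ T L i₀ m≤ρ^L₁ n≤2^T TL₁<L k β 0≤β γ≤1 using (error)

      8x*bad≤1 : ∀ μ → (lit 8 * x) * bad μ ≤ 1#
      8x*bad≤1 μ = pos-cancelˡ-≤ 0<c (begin
        lit 8 * (t′ * (N′ * N′)) * (lit 8 * x * bad μ)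
          ≈⟨ solve 4 (λ t N x b → con (+ 8) :* (t :* (N :* N)) :* (con (+ 8) :* x :* b) := con (+ 64) :* (t :* (N :* N :* x)) :* b) refl t′ N′ x (bad μ) ⟩
        lit 64 * (t′ * ((N′ * N′) * x)) * bad μ
          ≈⟨ *-congʳ (sym m≈) ⟩
        fromℕ m * bad μ
          ≤⟨ bad-bound μ ⟩
        T′ * (lit 2 * ((lit 2 * N′) * (lit 2 * N′)))
          ≤⟨ *-monoˡ-≤ (*-nonNeg (0≤lit 2) (x²-nonNeg _)) T≤t ⟩
        t′ * (lit 2 * ((lit 2 * N′) * (lit 2 * N′)))
          ≈⟨ solve 2 (λ t N → t :* (con (+ 2) :* ((con (+ 2) :* N) :* (con (+ 2) :* N))) := con (+ 8) :* (t :* (N :* N)) :* con (+ 1)) refl t′ N′ ⟩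
        lit 8 * (t′ * (N′ * N′)) * 1# ∎)
        where
        open ≤-Reasoning
        0<c : 0# < lit 8 * (t′ * (N′ * N′))
        0<c = *-pos (0<lit 8) (*-pos (0<fromℕ t) (*-pos (0<fromℕ N) (0<fromℕ N)))

      error<ε : ∀ {ε} → 1# ≤ x * ε → ∀ μ ν → ¬ (ε ≤ error μ ν)
      error<ε {ε} 1≤xε μ ν ε≤error = <-irrefl (0<lit 2) (+-cancelʳ-≤ (lit 6) (begin
        lit 2 + lit 6
          ≈⟨ solve 0 (con (+ 2) :+ con (+ 6) := con (+ 8) :* con (+ 1)) refl ⟩
        lit 8 * 1#
          ≤⟨ *-monoʳ-≤ (0≤lit 8) (≤.trans 1≤xε (*-monoʳ-≤ (0≤fromℕ e) ε≤error)) ⟩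
        lit 8 * (x * error μ ν)
          ≈⟨ solve 6 (λ x g u v L β → con (+ 8) :* (x :* (g :+ (u :+ (v :+ L :* (con (+ 2) :* β)))))
               := con (+ 2) :* (con (+ 4) :* x :* g) :+ (con (+ 8) :* x :* u :+ (con (+ 8) :* x :* v :+ con (+ 2) :* (con (+ 8) :* (L :* x) :* β))))
               refl x γ (bad μ) (bad ν) L′ β ⟩
        lit 2 * (lit 4 * x * γ) + (lit 8 * x * bad μ + (lit 8 * x * bad ν + lit 2 * (lit 8 * (L′ * x) * β)))
          ≤⟨ +-mono-≤ (*-monoʳ-≤ (0≤lit 2) 4xγ≤1) (+-mono-≤ (8x*bad≤1 μ) (+-mono-≤ (8x*bad≤1 ν)
               (≤.reflexive (*-congˡ (trans (*-congʳ (sym b≈)) bβ≈1))))) ⟩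
        lit 2 * 1# + (1# + (1# + lit 2 * 1#))
          ≈⟨ solve 0 (con (+ 2) :* con (+ 1) :+ (con (+ 1) :+ (con (+ 1) :+ con (+ 2) :* con (+ 1))) := con (+ 0) :+ con (+ 6)) refl ⟩
        0# + lit 6 ∎))
        where open ≤-Reasoning

    module _ {n} (i₀ : Fin n) (n≤2^T : n ℕ.≤ 2 ℕ.^ T) (𝒫 : Property) where
      open Profile N m L₁ T L i₀ m≤ρ^L₁ n≤2^T TL₁<L using (observe; observe-cost; tolerance; Consistent; inconsistent-probability)
      open Nearness N m L₁ T L i₀ m≤ρ^L₁ n≤2^T TL₁<L k β 0≤β γ≤1 using (consistent⇒near)

      Explained : Vec ℕ k → Set
      Explained rs = ∃ λ ν → ν ∈ᴾ 𝒫 × Consistent k β ν rs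

      verdict : Vec ℕ k → Verdict
      verdict rs = if does (em {Explained rs}) then accept else reject

      trial : Prog n Verdict
      trial = mapᴾ verdict (repeatᴾ k observe)

      trial-cost : Cost≤ (k ℕ.* (1 ℕ.+ T ℕ.* m)) trial
      trial-cost = mapᴾ-cost (repeatᴾ-cost k observe-cost)

      -- Both error bounds reduce to one event: that `μ` is inconsistent with its own sample. By
      -- Chebyshev its probability is at most 1 / (k β²).
      trial-reliable : ∀ μ c → (∀ rs → Consistent k β μ rs → isNot c (verdict rs) ≡ false) →
                       lit 6 * E μ trial (λ v → [ isNot c v ]) ≤ 1#
      trial-reliable μ c right = ≤.trans (*-monoʳ-≤ (0≤lit 6) E≤F) (≤-resp (*-congʳ kββ≈6) refl (pos-cancelˡ-≤ (0<fromℕ k) (begin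
        fromℕ k * (fromℕ k * (β * β) * F)
          ≈⟨ solve 3 (λ k β F → k :* (k :* (β :* β) :* F) := (k :* β) :* (k :* β) :* F) refl (fromℕ k) β F ⟩
        tolerance k β * F
          ≤⟨ inconsistent-probability k β μ ⟩
        fromℕ k
          ≈⟨ sym (*-identityʳ _) ⟩
        fromℕ k * 1# ∎)))
        where
        open ≤-Reasoning
        sample = repeatᴾ k observe
        F = E μ sample λ rs → 𝟙 (¬ Consistent k β μ rs)
        E≤F : E μ trial (λ v → [ isNot c v ]) ≤ F
        E≤F = ≤-resp (sym (E-mapᴾ μ sample verdict λ v → [ isNot c v ])) refl (E-mono μ sample λ rs → []≤𝟙¬ (isNot c (verdict rs)) (right rs))

      trial-complete : ∀ μ → μ ∈ᴾ 𝒫 → lit 6 * E μ trial (λ v → [ isNot accept v ]) ≤ 1#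
      trial-complete μ μ∈𝒫 = trial-reliable μ accept λ rs consistent →
        ≡.cong (λ d → isNot accept (if d then accept else reject)) (dec-true (em {Explained rs}) (μ , μ∈𝒫 , consistent))

      trial-sound : LabelInvariant 𝒫 → ∀ {ε} → 1# ≤ fromℕ e * ε → ∀ μ → Far ε μ 𝒫 →
                    lit 6 * E μ trial (λ v → [ isNot reject v ]) ≤ 1#
      trial-sound invariant 1≤xε μ far = trial-reliable μ reject λ rs consistent →
        ≡.cong (λ d → isNot reject (if d then accept else reject)) (dec-false (em {Explained rs}) (unexplained rs consistent))
        where
        unexplained : ∀ rs → Consistent k β μ rs → ¬ Explained rs
        unexplained rs cμ (ν , ν∈𝒫 , cν) =
          let σ , near = consistent⇒near {μ} {ν} {rs} cμ cν
          in error<ε i₀ n≤2^T 1≤xε μ ν (≤.trans (far (relabel σ ν) (invariant σ ν ν∈𝒫)) near)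

  -- Integer ceilings and binary logarithms

  ceiling : (f : ℕ → Carrier) → (∀ y → ∃ λ l → y ≤ f l) → ∀ y →
            ∃ λ l → y ≤ f l × (l ≡ 0 ⊎ ∃ λ k → l ≡ suc k × ¬ (y ≤ f k))
  ceiling f unbounded y with unbounded y
  ... | l , y≤fl with least (λ l → y ≤ f l) l y≤fl
  ...   | l′ , _ , minimal = l′ , minimal

  fromℕ≤1+ : ∀ {f : ℕ → Carrier} {y z l} → 0# ≤ z → (∀ k → f k ≤ y → fromℕ k ≤ z) →
             (l ≡ 0 ⊎ ∃ λ k → l ≡ suc k × ¬ (y ≤ f k)) → fromℕ l ≤ 1# + z
  fromℕ≤1+ 0≤z below (inj₁ ≡.refl)             = +-nonNeg 0≤1 0≤z
  fromℕ≤1+ 0≤z below (inj₂ (k , ≡.refl , y≰f)) = +-monoʳ-≤ 1# (below k (≰⇒≥ y≰f))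

  ⌈_⌉ : Carrier → ℕ
  ⌈ y ⌉ = proj₁ (ceiling fromℕ archimedean y)

  2^-unbounded : ∀ y → ∃ λ l → y ≤ 2# ^ l
  2^-unbounded y with archimedean y
  ... | l , y≤l = l , ≤.trans y≤l (fromℕ≤2^ l)

  ⌈log₂_⌉ : Carrier → ℕ
  ⌈log₂ y ⌉ = proj₁ (ceiling (2# ^_) 2^-unbounded y)

  ≤⌈⌉ : ∀ y → y ≤ fromℕ ⌈ y ⌉
  ≤⌈⌉ y = proj₁ (proj₂ (ceiling fromℕ archimedean y))

  ≤2^⌈log₂⌉ : ∀ y → y ≤ 2# ^ ⌈log₂ y ⌉
  ≤2^⌈log₂⌉ y = proj₁ (proj₂ (ceiling (2# ^_) 2^-unbounded y))

  ⌈⌉≤1+ : ∀ {y} → 0# ≤ y → fromℕ ⌈ y ⌉ ≤ 1# + y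
  ⌈⌉≤1+ {y} 0≤y = fromℕ≤1+ {fromℕ} 0≤y (λ _ k≤y → k≤y) (proj₂ (proj₂ (ceiling fromℕ archimedean y)))

  2^≤⇒≤log₂ : ∀ {y} k → 1# ≤ y → 2# ^ k ≤ y → fromℕ k ≤ log₂ y
  2^≤⇒≤log₂ {y} k 1≤y 2^k≤y = proj₁ (log₂-isSupremum 1≤y)
    -- The number k = k / 1 is one of the fractions whose supremum is `log₂ y`.
    (k , 1 , _ , trans (*-congʳ (+-identityʳ 1#)) (*-identityˡ _) , ≤-resp refl (sym (*-identityʳ y)) 2^k≤y)

  0≤log₂ : ∀ {y} → 1# ≤ y → 0# ≤ log₂ y
  0≤log₂ 1≤y = 2^≤⇒≤log₂ 0 1≤y 1≤y

  ⌈log₂⌉≤1+ : ∀ {y} → 1# ≤ y → fromℕ ⌈log₂ y ⌉ ≤ 1# + log₂ y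
  ⌈log₂⌉≤1+ {y} 1≤y = fromℕ≤1+ {2# ^_} (0≤log₂ 1≤y) (λ k → 2^≤⇒≤log₂ k 1≤y)
    (proj₂ (proj₂ (ceiling (2# ^_) 2^-unbounded y)))

  2^≈fromℕ : ∀ k → 2# ^ k ≈ fromℕ (2 ℕ.^ k)
  2^≈fromℕ zero    = sym (+-identityʳ 1#)
  2^≈fromℕ (suc k) = trans (*-congˡ (2^≈fromℕ k)) (sym (fromℕ-* 2 (2 ℕ.^ k)))

  fromℕ-cancel-≤ : ∀ {m n} → fromℕ m ≤ fromℕ n → m ℕ.≤ n
  fromℕ-cancel-≤ {m} {n} m≤n with m ℕ.≤? n
  ... | yes le = le
  ... | no m≰n = contradiction (+-cancelʳ-≤ (fromℕ n) (≤-resp refl (sym (+-identityˡ _))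
                   (≤.trans (fromℕ-mono (ℕ.≰⇒> m≰n)) m≤n))) 1≰0

  -- Polynomial bounds

  infixl 6 _⊕_
  infixl 7 _⊗_

  _⊕_ : Polynomial₃ → Polynomial₃ → Polynomial₃
  _⊕_ = List._++_

  scaleBy : Carrier × ℕ × ℕ × ℕ → Polynomial₃ → Polynomial₃
  scaleBy (c , i , j , k) = List.map λ (c′ , i′ , j′ , k′) → c * c′ , i ℕ.+ i′ , j ℕ.+ j′ , k ℕ.+ k′

  constant : ℕ → Polynomial₃
  constant c = (fromℕ c , 0 , 0 , 0) ∷ []

  X Y Z : Polynomial₃
  X = (1# , 1 , 0 , 0) ∷ []
  Y = (1# , 0 , 1 , 0) ∷ []
  Z = (1# , 0 , 0 , 1) ∷ []

  module _ {x y z : Carrier} where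

    eval-⊕ : ∀ p q → eval (p ⊕ q) x y z ≈ eval p x y z + eval q x y z
    eval-⊕ []      q = sym (+-identityˡ _)
    eval-⊕ (a ∷ p) q = trans (+-congˡ (eval-⊕ p q)) (sym (+-assoc _ _ _))

    eval-scaleBy : ∀ c i j k q → eval (scaleBy (c , i , j , k) q) x y z ≈ c * (x ^ i * (y ^ j * z ^ k)) * eval q x y z
    eval-scaleBy c i j k [] = sym (zeroʳ _)
    eval-scaleBy c i j k ((c′ , i′ , j′ , k′) ∷ q) = trans
      (+-cong (*-congˡ (*-cong (^-homo-* x i i′) (*-cong (^-homo-* y j j′) (^-homo-* z k k′)))) (eval-scaleBy c i j k q))
      (solve 9 (λ c c′ a a′ b b′ d d′ s → c :* c′ :* (a :* a′ :* (b :* b′ :* (d :* d′))) :+ c :* (a :* (b :* d)) :* s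
        := c :* (a :* (b :* d)) :* (c′ :* (a′ :* (b′ :* d′)) :+ s)) refl c c′ (x ^ i) (x ^ i′) (y ^ j) (y ^ j′) (z ^ k) (z ^ k′) (eval q x y z))

    eval-constant : ∀ c → eval (constant c) x y z ≈ fromℕ c
    eval-constant c = solve 1 (λ c → c :* (con (+ 1) :* (con (+ 1) :* con (+ 1))) :+ con (+ 0) := c) refl (fromℕ c)

    eval-2⊕ : ∀ {p u} → eval p x y z ≈ u → eval (constant 2 ⊕ p) x y z ≈ lit 2 + u
    eval-2⊕ {p} p≈u = trans (eval-⊕ (constant 2) p) (+-cong (trans (eval-constant 2) (fromℕ≈lit 2)) p≈u)

    eval-X : eval X x y z ≈ x
    eval-X = solve 1 (λ x → con (+ 1) :* (x :* con (+ 1) :* (con (+ 1) :* con (+ 1))) :+ con (+ 0) := x) refl x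

    eval-Y : eval Y x y z ≈ y
    eval-Y = solve 1 (λ y → con (+ 1) :* (con (+ 1) :* (y :* con (+ 1) :* con (+ 1))) :+ con (+ 0) := y) refl y

    eval-Z : eval Z x y z ≈ z
    eval-Z = solve 1 (λ z → con (+ 1) :* (con (+ 1) :* (con (+ 1) :* (z :* con (+ 1)))) :+ con (+ 0) := z) refl z

  abstract
    _⊗_ : Polynomial₃ → Polynomial₃ → Polynomial₃
    []      ⊗ q = []
    (a ∷ p) ⊗ q = scaleBy a q ⊕ p ⊗ q

    eval-⊗ : ∀ {x y z} p q → eval (p ⊗ q) x y z ≈ eval p x y z * eval q x y z
    eval-⊗ []      q = sym (zeroˡ _)
    eval-⊗ ((c , i , j , k) ∷ p) q = trans (eval-⊕ (scaleBy (c , i , j , k) q) (p ⊗ q))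
      (trans (+-cong (eval-scaleBy c i j k q) (eval-⊗ p q)) (sym (distribʳ _ _ _)))

  -- These mirror `Parameters`, with `X`, `Y`, `Z` for log n, 1 / ε and log (1 / δ). The constant 2
  -- in `tᴾ` and `eᴾ` accounts for a ceiling and a successor; `sᴾ` has it for uniformity.
  tᴾ eᴾ sᴾ Nᴾ mᴾ Lᴾ bᴾ kᴾ queryBound : Polynomial₃
  tᴾ = constant 2 ⊕ X
  eᴾ = constant 2 ⊕ Y
  sᴾ = constant 2 ⊕ Z
  Nᴾ = constant 16 ⊗ (tᴾ ⊗ eᴾ)
  mᴾ = constant 64 ⊗ (tᴾ ⊗ ((Nᴾ ⊗ Nᴾ) ⊗ eᴾ))
  Lᴾ = tᴾ ⊗ (Nᴾ ⊗ mᴾ)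
  bᴾ = constant 8 ⊗ (Lᴾ ⊗ eᴾ)
  kᴾ = constant 6 ⊗ (bᴾ ⊗ bᴾ)
  queryBound = (constant 3 ⊗ sᴾ) ⊗ (kᴾ ⊗ (tᴾ ⊗ mᴾ))

  module _ {x y z : Carrier} where

    record Bounds (p : Polynomial₃) (v : ℕ) : Set where
      constructor bounds
      field bound : fromℕ v ≤ eval p x y z

    bounds-⊗ : ∀ {p q v w} → Bounds p v → Bounds q w → Bounds (p ⊗ q) (v ℕ.* w)
    bounds-⊗ {p} {q} {v} {w} (bounds v≤p) (bounds w≤q) = bounds (≤-resp (sym (fromℕ-* v w)) (sym (eval-⊗ p q))
      (*-mono-≤ (0≤fromℕ v) (0≤fromℕ w) v≤p w≤q))

    bounds-constant : ∀ c → Bounds (constant c) c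
    bounds-constant c = bounds (≤.reflexive (sym (eval-constant {x} {y} {z} c)))

    queryBound-bounds : ∀ T e .{{_ : NonZero e}} s → let open Parameters T e in
      fromℕ t ≤ lit 2 + x → fromℕ e ≤ lit 2 + y → fromℕ s ≤ lit 2 + z →
      fromℕ ((3 ℕ.* s) ℕ.* (k ℕ.* (1 ℕ.+ T ℕ.* m))) ≤ eval queryBound x y z
    queryBound-bounds T e s t≤ e≤ s≤ = ≤.trans
      -- The initial draw of an observation is charged to one more halving: 1 + T m ≤ t m since m ≥
      -- 1.
      (fromℕ-mono (ℕ.*-monoʳ-≤ (3 ℕ.* s) (ℕ.*-monoʳ-≤ k (ℕ.+-monoˡ-≤ (T ℕ.* m) (ℕ.>-nonZero⁻¹ m)))))
      (Bounds.bound (bounds-⊗ (bounds-⊗ (bounds-constant 3) bs) (bounds-⊗ bk (bounds-⊗ bt bm))))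
      where
      open Parameters T e
      bt : Bounds tᴾ t
      bt = bounds (≤-resp refl (sym (eval-2⊕ {x} {y} {z} {X} (eval-X {x} {y} {z}))) t≤)
      be : Bounds eᴾ e
      be = bounds (≤-resp refl (sym (eval-2⊕ {x} {y} {z} {Y} (eval-Y {x} {y} {z}))) e≤)
      bs : Bounds sᴾ s
      bs = bounds (≤-resp refl (sym (eval-2⊕ {x} {y} {z} {Z} (eval-Z {x} {y} {z}))) s≤)
      bN : Bounds Nᴾ N
      bN = ≡.subst (Bounds Nᴾ) (≡.sym N≡) (bounds-⊗ (bounds-constant 16) (bounds-⊗ bt be))
      bm : Bounds mᴾ m
      bm = ≡.subst (Bounds mᴾ) (≡.sym m≡) (bounds-⊗ (bounds-constant 64) (bounds-⊗ bt (bounds-⊗ (bounds-⊗ bN bN) be)))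
      bL : Bounds Lᴾ L
      bL = ≡.subst (Bounds Lᴾ) (≡.sym L≡) (bounds-⊗ bt (≡.subst (Bounds (Nᴾ ⊗ mᴾ)) (≡.sym L₁≡) (bounds-⊗ bN bm)))
      bb : Bounds bᴾ b
      bb = ≡.subst (Bounds bᴾ) (≡.sym b≡) (bounds-⊗ (bounds-constant 8) (bounds-⊗ bL be))
      bk : Bounds kᴾ k
      bk = ≡.subst (Bounds kᴾ) (≡.sym k≡) (bounds-⊗ (bounds-constant 6) (bounds-⊗ bb bb))

  -- The tester and its query bound

  interval-⁻¹ : ∀ {δ} → InUnitInterval δ → 1# ≤ δ ⁻¹
  interval-⁻¹ {δ} (0<δ , δ<1) = pos-cancelˡ-≤ 0<δ
    (≤-resp (sym (*-identityʳ δ)) (sym (*-inverseʳ (pos⇒≉0 0<δ))) (proj₁ δ<1))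

  n≤2^⌈log₂n⌉ : ∀ n → n ℕ.≤ 2 ℕ.^ ⌈log₂ fromℕ n ⌉
  n≤2^⌈log₂n⌉ n = fromℕ-cancel-≤ (≤-resp refl (2^≈fromℕ ⌈log₂ fromℕ n ⌉) (≤2^⌈log₂⌉ (fromℕ n)))

  module UniversalTester (𝒫 : Property) (invariant : LabelInvariant 𝒫) where

    -- `confidence δ` is chosen with 2 ^ s δ ≥ 1, as amplification requires; the successor in
    -- `accuracy` makes it visibly positive.
    confidence accuracy : Carrier → ℕ
    confidence δ = ⌈log₂ δ ⁻¹ ⌉
    accuracy ε   = suc ⌈ ε ⁻¹ ⌉

    depth : ℕ → ℕ
    depth n = ⌈log₂ fromℕ n ⌉

    trialFor : Carrier → ∀ n → Prog (suc n) Verdict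
    trialFor ε n = trial zero (n≤2^⌈log₂n⌉ (suc n)) 𝒫
      where open Parameters (depth (suc n)) (accuracy ε)

    trials : Carrier → Carrier → ∀ n → Prog (suc n) Verdict
    trials ε δ n = mapᴾ majority (repeatᴾ (3 ℕ.* confidence δ) (trialFor ε n))

    tester : Tester
    tester ε δ zero    = halt accept
    tester ε δ (suc n) = toAlgorithm (trials ε δ n)

    tester-tests : Tests tester 𝒫
    tester-tests ε δ zero    _ _ μ = contradiction (sym (total μ)) 1≉0
    tester-tests ε δ (suc n) ε∈ δ∈ μ =
      (λ μ∈𝒫 → amplification μ (trialFor ε n) accept (trial-complete zero n≤ 𝒫 μ μ∈𝒫) (confidence δ) (proj₁ (proj₁ δ∈)) 1≤2^sδ) ,
      (λ far → amplification μ (trialFor ε n) reject (trial-sound zero n≤ 𝒫 invariant 1≤eε μ far) (confidence δ) (proj₁ (proj₁ δ∈)) 1≤2^sδ)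
      where
      open Parameters (depth (suc n)) (accuracy ε)
      n≤ = n≤2^⌈log₂n⌉ (suc n)
      1≤2^sδ : 1# ≤ lit 2 ^ confidence δ * δ
      1≤2^sδ = ≤-resp (trans (*-comm _ _) (*-inverseʳ (pos⇒≉0 (proj₁ δ∈)))) (*-congʳ (^-congˡ (confidence δ) (fromℕ≈lit 2)))
        (*-monoˡ-≤ (proj₁ (proj₁ δ∈)) (≤2^⌈log₂⌉ (δ ⁻¹)))
      1≤eε : 1# ≤ fromℕ (accuracy ε) * ε
      1≤eε = ≤-resp (trans (*-comm _ _) (*-inverseʳ (pos⇒≉0 (proj₁ ε∈)))) refl
        (*-monoˡ-≤ (proj₁ (proj₁ ε∈)) (≤.trans (≤⌈⌉ (ε ⁻¹)) (≤-+ 0≤1 (+-comm _ _))))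

    tester-queries : QueriesBoundedBy tester queryBound
    tester-queries ε δ (suc n) ε∈ δ∈ = ≤.trans
      (fromℕ-mono (queries-toAlgorithm (mapᴾ-cost (repeatᴾ-cost (3 ℕ.* confidence δ) (trial-cost zero (n≤2^⌈log₂n⌉ (suc n)) 𝒫)))))
      (queryBound-bounds (depth (suc n)) (accuracy ε) (confidence δ)
        (≤-resp refl (sym (+-assoc _ _ _)) (+-monoʳ-≤ 1# (⌈log₂⌉≤1+ (1≤fromℕ (suc n)))))
        (≤-resp refl (sym (+-assoc _ _ _)) (+-monoʳ-≤ 1# (⌈⌉≤1+ (≤.trans 0≤1 (interval-⁻¹ ε∈)))))
        (≤.trans (⌈log₂⌉≤1+ (interval-⁻¹ δ∈)) (≤-+ 0≤1 (solve 1 (λ l → (con (+ 1) :+ l) :+ con (+ 1) := con (+ 2) :+ l) refl _))))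
      where open Parameters (depth (suc n)) (accuracy ε)

theorem6p0p1 : (em : ExcludedMiddle 0ℓ) (ℝ : CompleteOrderedField) →
    let open Testing em ℝ in
    ∃ λ (p : Polynomial₃) →
    (𝒫 : Property) → LabelInvariant 𝒫 →
    ∃ λ (T : Tester) → Tests T 𝒫 × QueriesBoundedBy T p
theorem6p0p1 em ℝ = queryBound , λ 𝒫 invariant →
  tester 𝒫 invariant , tester-tests 𝒫 invariant , tester-queries 𝒫 invariant
  where
  open Development em ℝ
  open UniversalTester
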